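{- Let $\mu\ge 2$ and $\lambda\ge 1$ be integers and let $\epsilon\ge\log_\mu 2$ be real. Let $N$ be a positive integer with $$\log_2 N\ \ge\ 4\mu^{2+\epsilon}+\Big(1+\frac{1}{\epsilon}\Big)\lambda .$$ Then for every positive integer $m$ and every $\mu$-linear polynomial $f\in\mathbb{Z}[X_1,\dots,X_\mu]$ co-prime to $N$, $$\Pr_{\mathbf{x}\leftarrow\{0,\dots,m-1\}^\mu}\big[f(\mathbf{x})\equiv 0\pmod N\big]\le 2^{ -\lambda}+\frac{\mu}{m},$$ where $\mathbf{x}$ is uniform on $\{0,\dots,m-1\}^\mu$.
   Context: A polynomial $f\in\mathbb{Z}[X_1,\dots,X_\mu]$ is $\mu$-linear (multilinear) if it has degree at most $1$ in each variable. $f$ is co-prime to $N$ if the greatest common divisor of $N$ and all coefficients of $f$ equals $1$. -}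

module Defs where

open import Algebra.Bundles using (CommutativeRing)
open import Data.Empty using (⊥-elim)
open import Data.Bool using (if_then_else_)
open import Data.Fin using (Fin)
open import Data.Integer as ℤ using (ℤ; +_; -[1+_])
import Data.Integer.Properties as ℤ
import Data.Integer.Tactic.RingSolver as ℤSolver
open import Data.List as List using (List; []; _∷_; length; filter; foldr; upTo; cartesianProductWith)
import Data.List.Properties as List
open import Data.Nat as ℕ using (ℕ; zero; suc)
open import Data.Nat.GCD using (gcd)
import Data.Nat.Coprimality as Coprime
import Data.Nat.Properties as ℕ
open import Data.Product using (∃; _×_; _,_; proj₁; proj₂)
open import Data.Rational
open import Data.Rational.Properties
open import Data.Rational.Solver
import Data.Rational.Unnormalised as ℚᵘ
import Data.Rational.Unnormalised.Properties as ℚᵘ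
open import Data.Sum using (_⊎_; inj₁; inj₂)
open import Data.Vec as Vec using (Vec; []; _∷_; lookup)
import Data.Vec.Properties as Vec
open import Level using (0ℓ)
open import Relation.Binary.PropositionalEquality
open import Relation.Nullary using (¬_; Dec; does; yes; no)
open import Relation.Unary using (Pred; Decidable)

open import Algebra.Properties.CommutativeSemiring.Exp
  (CommutativeRing.commutativeSemiring +-*-commutativeRing) public

open +-*-Solver using (solve; _:+_; _:*_; _:-_; con; _:=_)

-- Two-sided Dedekind cuts.
record ℝ : Set₁ where
  field
    Lower Upper     : ℚ → Set
    lower-inhabited : ∃ Lower
    upper-inhabited : ∃ Upper
    lower-closed    : ∀ {p q} → p < q → Lower q → Lower p
    upper-closed    : ∀ {p q} → p < q → Upper p → Upper q
    lower-open      : ∀ {p} → Lower p → ∃ λ q → p < q × Lower q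
    upper-open      : ∀ {q} → Upper q → ∃ λ p → p < q × Upper p
    disjoint        : ∀ {q} → ¬ (Lower q × Upper q)
    located         : ∀ {p q} → p < q → Lower p ⊎ Upper q

open ℝ public

infix 4 _≤ᴿ_

_≤ᴿ_ : ℝ → ℝ → Set
x ≤ᴿ y = ∀ {q} → Lower x q → Lower y q

Positiveᴿ : ℝ → Set
Positiveᴿ x = Lower x 0ℚ

lower<upper : ∀ x {p q} → Lower x p → Upper x q → p < q
lower<upper x {p} {q} p∈L q∈U with p <? q
... | yes p<q = p<q
... | no  p≮q with q ≟ p
...   | yes refl = ⊥-elim (disjoint x (p∈L , q∈U))
...   | no  q≢p  = ⊥-elim (disjoint x (p∈L , upper-closed x q<p q∈U))
  where
  q<p : q < p
  q<p = ≰⇒> λ p≤q → q≢p (≤-antisym (≮⇒≥ p≮q) p≤q)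

-- The real x determined by a set A of rationals ≤ x and a set B of
-- rationals ≥ x that come arbitrarily close to each other.
cut : (A B : ℚ → Set) → ∃ A → ∃ B →
      (∀ {a b} → A a → B b → a ≤ b) →
      (∀ {p q} → p < q → (∃ λ a → p ≤ a × A a) ⊎ (∃ λ b → b ≤ q × B b)) →
      ℝ
cut A B (a₀ , A-a₀) (b₀ , B-b₀) sep close = record
  { Lower           = λ q → ∃ λ a → q < a × A a
  ; Upper           = λ q → ∃ λ b → b < q × B b
  ; lower-inhabited = a₀ - 1ℚ , a₀ , a-1<a a₀ , A-a₀
  ; upper-inhabited = b₀ + 1ℚ , b₀ , a<a+1 b₀ , B-b₀
  ; lower-closed    = λ { p<q (a , q<a , Aa) → a , <-trans p<q q<a , Aa }
  ; upper-closed    = λ { p<q (b , b<p , Bb) → b , <-trans b<p p<q , Bb }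
  ; lower-open      = λ { (a , p<a , Aa) →
                          let m , p<m , m<a = <-dense p<a in m , p<m , a , m<a , Aa }
  ; upper-open      = λ { (b , b<q , Bb) →
                          let m , b<m , m<q = <-dense b<q in m , m<q , b , b<m , Bb }
  ; disjoint        = λ { ((a , q<a , Aa) , (b , b<q , Bb)) →
                          <-irrefl refl (<-≤-trans (<-trans b<q q<a) (sep Aa Bb)) }
  ; located         = loc
  }
  where
  a<a+1 : ∀ a → a < a + 1ℚ
  a<a+1 a = subst (_< a + 1ℚ) (+-identityʳ a) (+-monoʳ-< a (positive⁻¹ 1ℚ))

  a-1<a : ∀ a → a - 1ℚ < a
  a-1<a a = subst (a - 1ℚ <_) (+-identityʳ a) (+-monoʳ-< a (negative⁻¹ (- 1ℚ)))

  loc : ∀ {p q} → p < q → (∃ λ a → p < a × A a) ⊎ (∃ λ b → b < q × B b)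
  loc p<q with <-dense p<q
  ... | m , p<m , m<q with <-dense m<q
  ...   | n , m<n , n<q with close m<n
  ...     | inj₁ (a , m≤a , Aa) = inj₁ (a , <-≤-trans p<m m≤a , Aa)
  ...     | inj₂ (b , b≤n , Bb) = inj₂ (b , ≤-<-trans b≤n n<q , Bb)

fromℚ : ℚ → ℝ
fromℚ r = cut (_≤ r) (r ≤_) (r , ≤-refl) (r , ≤-refl) ≤-trans close
  where
  close : ∀ {p q} → p < q → (∃ λ a → p ≤ a × a ≤ r) ⊎ (∃ λ b → b ≤ q × r ≤ b)
  close {p} {q} p<q with ≤-total p r
  ... | inj₁ p≤r = inj₁ (p , ≤-refl , p≤r)
  ... | inj₂ r≤p = inj₂ (q , ≤-refl , ≤-trans r≤p (<⇒≤ p<q))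

fromℕ : ℕ → ℚ
fromℕ n = mkℚ (+ n) 0 (Coprime.sym (Coprime.1-coprimeTo n))

fromℕ-mono-< : ∀ {m n} → m ℕ.< n → fromℕ m < fromℕ n
fromℕ-mono-< {m} {n} m<n =
  *<* (subst₂ ℤ._<_ (sym (ℤ.*-identityʳ (+ m))) (sym (ℤ.*-identityʳ (+ n))) (ℤ.+<+ m<n))

fromℕ-mono-≤ : ∀ {m n} → m ℕ.≤ n → fromℕ m ≤ fromℕ n
fromℕ-mono-≤ {m} {n} m≤n with ℕ.m≤n⇒m<n∨m≡n m≤n
... | inj₁ m<n  = <⇒≤ (fromℕ-mono-< m<n)
... | inj₂ refl = ≤-refl

fromℕ-suc : ∀ n → fromℕ (suc n) ≡ 1ℚ + fromℕ n
fromℕ-suc n = toℚᵘ-injective (ℚᵘ.≃-sym (ℚᵘ.≃-trans (toℚᵘ-homo-+ 1ℚ (fromℕ n))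
  (ℚᵘ.*≡* (cong (λ z → (+ 1 ℤ.+ z) ℤ.* + 1) (ℤ.*-identityʳ (+ n))))))

inverse-fromℕ : ∀ n .{{_ : ℕ.NonZero n}} → (+ 1 / n) * fromℕ n ≡ 1ℚ
inverse-fromℕ n@(suc n-1) = toℚᵘ-injective
  (ℚᵘ.≃-trans (toℚᵘ-homo-* (+ 1 / n) (fromℕ n))
  (ℚᵘ.≃-trans (ℚᵘ.*-cong (toℚᵘ-fromℚᵘ (ℚᵘ.mkℚᵘ (+ 1) n-1)) (ℚᵘ.≃-refl {ℚᵘ.mkℚᵘ (+ n) 0}))
   (ℚᵘ.*≡* (ℤeq (+ n)))))
  where
  ℤeq : ∀ z → (+ 1 ℤ.* z) ℤ.* + 1 ≡ + 1 ℤ.* (z ℤ.* + 1)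
  ℤeq = ℤSolver.solve-∀

1/1+_ : ℕ → ℚ
1/1+ k = mkℚ (+ 1) k (Coprime.1-coprimeTo (suc k))

0<1/1+ : ∀ k → 0ℚ < 1/1+ k
0<1/1+ k = positive⁻¹ (1/1+ k)

*-monoʳ-≤ : ∀ {p q r} → 0ℚ ≤ r → p ≤ q → p * r ≤ q * r
*-monoʳ-≤ {r = r} 0≤r = *-monoʳ-≤-nonNeg r {{nonNegative 0≤r}}

*-monoˡ-≤ : ∀ {p q r} → 0ℚ ≤ r → p ≤ q → r * p ≤ r * q
*-monoˡ-≤ {r = r} 0≤r = *-monoˡ-≤-nonNeg r {{nonNegative 0≤r}}

*-monoˡ-< : ∀ {p q r} → 0ℚ < r → p < q → r * p < r * q
*-monoˡ-< {r = r} 0<r = *-monoʳ-<-pos r {{positive 0<r}}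

*-monoʳ-< : ∀ {p q r} → 0ℚ < r → p < q → p * r < q * r
*-monoʳ-< {r = r} 0<r = *-monoˡ-<-pos r {{positive 0<r}}

*-pos : ∀ {p q} → 0ℚ < p → 0ℚ < q → 0ℚ < p * q
*-pos {p} {q} 0<p 0<q = subst (_< p * q) (*-zeroʳ p) (*-monoˡ-< 0<p 0<q)

inverse : ∀ {p} → 0ℚ < p → ∃ λ r → 0ℚ < r × p * r ≡ 1ℚ
inverse {p} 0<p = 1/ p , positive⁻¹ (1/ p) {{1/pos⇒pos p}} , *-inverseʳ p
  where instance
    p-pos : Positive p
    p-pos = positive 0<p
    p-nonZero : NonZero p
    p-nonZero = pos⇒nonZero p

p≤∣↥p∣ : ∀ p → p ≤ fromℕ ℤ.∣ ↥ p ∣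
p≤∣↥p∣ p@record{} = *≤* (ineq (↥ p) (↧ₙ p))
  where
  ineq : ∀ z d .{{_ : ℕ.NonZero d}} → z ℤ.* + 1 ℤ.≤ + ℤ.∣ z ∣ ℤ.* + d
  ineq (+ n) d rewrite ℤ.*-identityʳ (+ n) | sym (ℤ.pos-* n d) = ℤ.+≤+ (ℕ.m≤m*n n d)
  ineq -[1+ n ] (suc d) = ℤ.-≤+

archimedean : ∀ {t} → 0ℚ < t → ∀ s → ∃ λ n → s ≤ fromℕ n * t
archimedean {t} 0<t s with inverse 0<t
... | r , 0<r , tr≡1 = ℤ.∣ ↥ (s * r) ∣ ,
  subst (_≤ fromℕ ℤ.∣ ↥ (s * r) ∣ * t) eq (*-monoʳ-≤ (<⇒≤ 0<t) (p≤∣↥p∣ (s * r)))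
  where
  eq : s * r * t ≡ s
  eq = trans (solve 3 (λ s r t → s :* r :* t := s :* (t :* r)) refl s r t)
             (trans (cong (s *_) tr≡1) (*-identityʳ s))

p+[q-p]≡q : ∀ p q → p + (q - p) ≡ q
p+[q-p]≡q = solve 2 (λ p q → p :+ (q :- p) := q) refl

p<q⇒0<q-p : ∀ {p q} → p < q → 0ℚ < q - p
p<q⇒0<q-p {p} {q} p<q = subst (_< q - p) (+-inverseʳ p) (+-monoˡ-< (- p) p<q)

module _ (x : ℝ) {h : ℚ} (0<h : 0ℚ < h) where

  private
    a<a+h : ∀ a → a < a + h
    a<a+h a = subst (_< a + h) (+-identityʳ a) (+-monoʳ-< a 0<h)

    shift : ∀ a k → a + (1ℚ + k) * h ≡ (a + h) + k * h
    shift a k = begin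
      a + (1ℚ + k) * h       ≡⟨ cong (λ d → a + d) (*-distribʳ-+ h 1ℚ k) ⟩
      a + (1ℚ * h + k * h)   ≡⟨ cong (λ d → a + (d + k * h)) (*-identityˡ h) ⟩
      a + (h + k * h)        ≡⟨ +-assoc a h (k * h) ⟨
      (a + h) + k * h        ∎
      where open ≡-Reasoning

    walk : ∀ n a → Lower x a → Upper x (a + fromℕ n * h) →
           ∃ λ a → Lower x a × Upper x ((a + h) + h)
    walk zero    a a∈L a∈U = ⊥-elim (disjoint x (a∈L , subst (Upper x)
      (trans (cong (λ d → a + d) (*-zeroˡ h)) (+-identityʳ a)) a∈U))
    walk (suc n) a a∈L c∈U with located x (a<a+h (a + h))
    ... | inj₁ a+h∈L  = walk n (a + h) a+h∈L (subst (Upper x)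
      (trans (cong (λ k → a + k * h) (fromℕ-suc n)) (shift a (fromℕ n))) c∈U)
    ... | inj₂ a+2h∈U = a , a∈L , a+2h∈U

  approximate-twice : ∃ λ a → Lower x a × Upper x ((a + h) + h)
  approximate-twice =
    let a , a∈L       = lower-inhabited x
        d , d∈U       = upper-inhabited x
        c , c<d , c∈U = upper-open x d∈U
        n , d-a≤nh    = archimedean 0<h (d - a)
        d≤a+nh        = subst (_≤ a + fromℕ n * h) (p+[q-p]≡q a d) (+-monoʳ-≤ a d-a≤nh)
    in walk n a a∈L (upper-closed x (<-≤-trans c<d d≤a+nh) c∈U)

approximate : ∀ x {δ} → 0ℚ < δ → ∃ λ a → Lower x a × Upper x (a + δ)
approximate x {δ} 0<δ =
  let a , a∈L , a+δ∈U = approximate-twice x (*-pos (positive⁻¹ ½) 0<δ)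
  in a , a∈L , subst (Upper x) (halves a) a+δ∈U
  where
  ½+½≡1 : ½ + ½ ≡ 1ℚ
  ½+½≡1 = refl

  halves : ∀ a → (a + ½ * δ) + ½ * δ ≡ a + δ
  halves a = begin
    (a + ½ * δ) + ½ * δ   ≡⟨ +-assoc a (½ * δ) (½ * δ) ⟩
    a + (½ * δ + ½ * δ)   ≡⟨ cong (λ d → a + d) (*-distribʳ-+ δ ½ ½) ⟨
    a + (½ + ½) * δ       ≡⟨ cong (λ d → a + d * δ) ½+½≡1 ⟩
    a + 1ℚ * δ            ≡⟨ cong (λ d → a + d) (*-identityˡ δ) ⟩
    a + δ                 ∎
    where open ≡-Reasoning

^-pos : ∀ {p} n → 0ℚ < p → 0ℚ < p ^ n
^-pos zero    0<p = positive⁻¹ 1ℚ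
^-pos (suc n) 0<p = *-pos 0<p (^-pos n 0<p)

^-monoˡ-≤ : ∀ {p q} n → 0ℚ < p → p ≤ q → p ^ n ≤ q ^ n
^-monoˡ-≤ zero    0<p p≤q = ≤-refl
^-monoˡ-≤ (suc n) 0<p p≤q = ≤-trans
  (*-monoʳ-≤ (<⇒≤ (^-pos n 0<p)) p≤q)
  (*-monoˡ-≤ (<⇒≤ (<-≤-trans 0<p p≤q)) (^-monoˡ-≤ n 0<p p≤q))

^-cancelˡ-≤ : ∀ {p q} n .{{_ : ℕ.NonZero n}} → 0ℚ < q → p ^ n ≤ q ^ n → p ≤ q
^-cancelˡ-≤ {p} {q} (suc n) 0<q pⁿ≤qⁿ = ≮⇒≥ λ q<p →
  <-irrefl refl (<-≤-trans (strict q<p) pⁿ≤qⁿ)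
  where
  strict : q < p → q ^ suc n < p ^ suc n
  strict q<p = <-≤-trans
    (*-monoʳ-< (^-pos n 0<q) q<p)
    (*-monoˡ-≤ (<⇒≤ (<-trans 0<q q<p)) (^-monoˡ-≤ n 0<q (<⇒≤ q<p)))

^-monoʳ-< : ∀ {p m n} → 1ℚ < p → m ℕ.< n → p ^ m < p ^ n
^-monoʳ-< {p} {m} {suc n} 1<p (ℕ.s≤s m≤n) with ℕ.m≤n⇒m<n∨m≡n m≤n
... | inj₁ m<n  = <-trans (^-monoʳ-< 1<p m<n) (step n)
  where
  step : ∀ k → p ^ k < p ^ suc k
  step k = subst (_< p ^ suc k) (*-identityˡ (p ^ k))
    (*-monoʳ-< (^-pos k (<-trans (positive⁻¹ 1ℚ) 1<p)) 1<p)
... | inj₂ refl = subst (_< p ^ suc n) (*-identityˡ (p ^ n))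
    (*-monoʳ-< (^-pos n (<-trans (positive⁻¹ 1ℚ) 1<p)) 1<p)

^-antiʳ-< : ∀ {p m n} → 0ℚ < p → p < 1ℚ → m ℕ.< n → p ^ n < p ^ m
^-antiʳ-< {p} {m} {suc n} 0<p p<1 (ℕ.s≤s m≤n) with ℕ.m≤n⇒m<n∨m≡n m≤n
... | inj₁ m<n  = <-trans
    (subst (p ^ suc n <_) (*-identityˡ (p ^ n)) (*-monoʳ-< (^-pos n 0<p) p<1))
    (^-antiʳ-< 0<p p<1 m<n)
... | inj₂ refl = subst (p ^ suc n <_) (*-identityˡ (p ^ n)) (*-monoʳ-< (^-pos n 0<p) p<1)

^-swap : ∀ p m n → (p ^ m) ^ n ≡ (p ^ n) ^ m
^-swap p m n = begin
  (p ^ m) ^ n     ≡⟨ ^-assocʳ p m n ⟩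
  p ^ (m ℕ.* n)   ≡⟨ cong (p ^_) (ℕ.*-comm m n) ⟩
  p ^ (n ℕ.* m)   ≡⟨ ^-assocʳ p n m ⟨
  (p ^ n) ^ m     ∎
  where open ≡-Reasoning

bernoulli : ∀ {t} → 0ℚ < t → ∀ n → 1ℚ + fromℕ n * t ≤ (1ℚ + t) ^ n
bernoulli {t} 0<t zero    = ≤-reflexive (trans (cong (λ d → 1ℚ + d) (*-zeroˡ t)) (+-identityʳ 1ℚ))
bernoulli {t} 0<t (suc n) = ≤-trans
  (subst₂ _≤_
    (+-identityʳ (1ℚ + fromℕ (suc n) * t))
    (trans
      (cong (λ k → 1ℚ + k * t + fromℕ n * (t * t)) (fromℕ-suc n))
      (solve 2 (λ n t → con 1ℚ :+ (con 1ℚ :+ n) :* t :+ n :* (t :* t)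
                        := (con 1ℚ :+ t) :* (con 1ℚ :+ n :* t)) refl (fromℕ n) t))
    (+-monoʳ-≤ (1ℚ + fromℕ (suc n) * t) 0≤ntt))
  (*-monoˡ-≤ (<⇒≤ 0<1+t) (bernoulli 0<t n))
  where
  0<1+t : 0ℚ < 1ℚ + t
  0<1+t = +-mono-< (positive⁻¹ 1ℚ) 0<t

  0≤fromℕ : ∀ n → 0ℚ ≤ fromℕ n
  0≤fromℕ zero    = ≤-refl
  0≤fromℕ (suc n) = <⇒≤ (fromℕ-mono-< {0} {suc n} ℕ.z<s)

  0≤ntt : 0ℚ ≤ fromℕ n * (t * t)
  0≤ntt = subst (_≤ fromℕ n * (t * t)) (*-zeroˡ (t * t))
    (*-monoʳ-≤ (<⇒≤ (*-pos 0<t 0<t)) (0≤fromℕ n))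

^-archimedean : ∀ {r} → 1ℚ < r → ∀ s → ∃ λ n → s ≤ r ^ suc n
^-archimedean {r} 1<r s = n , (begin
  s                        ≤⟨ s≤nt ⟩
  fromℕ n * t              ≡⟨ +-identityˡ (fromℕ n * t) ⟨
  0ℚ + fromℕ n * t         ≤⟨ +-monoˡ-≤ (fromℕ n * t) {0ℚ} {1ℚ} (nonNegative⁻¹ 1ℚ) ⟩
  1ℚ + fromℕ n * t         ≤⟨ bernoulli 0<t n ⟩
  (1ℚ + t) ^ n             ≡⟨ cong (_^ n) (p+[q-p]≡q 1ℚ r) ⟩
  r ^ n                    <⟨ ^-monoʳ-< 1<r (ℕ.n<1+n n) ⟩
  r ^ suc n                ∎)
  where
  open ≤-Reasoning
  t : ℚ
  t = r - 1ℚ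
  0<t : 0ℚ < t
  0<t = p<q⇒0<q-p 1<r
  n : ℕ
  n = proj₁ (archimedean 0<t s)
  s≤nt : s ≤ fromℕ n * t
  s≤nt = proj₂ (archimedean 0<t s)

infixr 8 _^ℤ_

_^ℤ_ : (b : ℕ) .{{_ : ℕ.NonTrivial b}} → ℤ → ℚ
b ^ℤ (+ n)    = fromℕ b ^ n
b ^ℤ -[1+ n ] = (_/_ (+ 1) b {{ℕ.nonTrivial⇒nonZero b}}) ^ suc n

module _ (b : ℕ) .{{b>1 : ℕ.NonTrivial b}} where

  private
    instance
      b≢0 : ℕ.NonZero b
      b≢0 = ℕ.nonTrivial⇒nonZero b

    B c : ℚ
    B = fromℕ b
    c = + 1 / b

    1<B : 1ℚ < B
    1<B = fromℕ-mono-< {1} {b} (ℕ.nonTrivial⇒n>1 b)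

    0<B : 0ℚ < B
    0<B = <-trans (positive⁻¹ 1ℚ) 1<B

    cB≡1 : c * B ≡ 1ℚ
    cB≡1 = inverse-fromℕ b

    0<c : 0ℚ < c
    0<c = ≰⇒> λ c≤0 → <-irrefl refl (<-≤-trans (positive⁻¹ 1ℚ)
      (subst₂ _≤_ cB≡1 (*-zeroˡ B) (*-monoʳ-≤ (<⇒≤ 0<B) c≤0)))

    c<1 : c < 1ℚ
    c<1 = subst₂ _<_ (*-identityʳ c) cB≡1 (*-monoˡ-< 0<c 1<B)

  ^ℤ-pos : ∀ z → 0ℚ < b ^ℤ z
  ^ℤ-pos (+ n)    = ^-pos n 0<B
  ^ℤ-pos -[1+ n ] = ^-pos (suc n) 0<c

  ^ℤ-mono-< : ∀ {y z} → y ℤ.< z → b ^ℤ y < b ^ℤ z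
  ^ℤ-mono-< { -[1+ m ] } { -[1+ n ] } (ℤ.-<- n<m) = ^-antiʳ-< {m = suc n} {suc m} 0<c c<1 (ℕ.s<s n<m)
  ^ℤ-mono-< { -[1+ m ] } {+ n} ℤ.-<+ = <-≤-trans (^-antiʳ-< {m = 0} {suc m} 0<c c<1 ℕ.z<s) (1≤Bⁿ n)
    where
    1≤Bⁿ : ∀ n → 1ℚ ≤ B ^ n
    1≤Bⁿ zero    = ≤-refl
    1≤Bⁿ (suc n) = <⇒≤ (^-monoʳ-< {m = 0} {suc n} 1<B ℕ.z<s)
  ^ℤ-mono-< {+ m} {+ n} (ℤ.+<+ m<n) = ^-monoʳ-< {m = m} {n} 1<B m<n

  ^ℤ-mono-≤ : ∀ {y z} → y ℤ.≤ z → b ^ℤ y ≤ b ^ℤ z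
  ^ℤ-mono-≤ {y} {z} y≤z with y ℤ.≟ z
  ... | yes refl = ≤-refl
  ... | no  y≢z  = <⇒≤ (^ℤ-mono-< (ℤ.≤∧≢⇒< y≤z y≢z))

  ^ℤ-cancel-≤ : ∀ {y z} → b ^ℤ y ≤ b ^ℤ z → y ℤ.≤ z
  ^ℤ-cancel-≤ bʸ≤bᶻ = ℤ.≮⇒≥ λ z<y → <-irrefl refl (<-≤-trans (^ℤ-mono-< z<y) bʸ≤bᶻ)

  ^ℤ-assoc : ∀ z d → (b ^ℤ z) ^ d ≡ b ^ℤ (z ℤ.* + d)
  ^ℤ-assoc (+ n) d = trans (^-assocʳ B n d) (cong (b ^ℤ_) (ℤ.pos-* n d))
  ^ℤ-assoc -[1+ n ] zero    = cong (b ^ℤ_) (sym (ℤ.*-zeroʳ -[1+ n ]))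
  ^ℤ-assoc -[1+ n ] (suc d) = ^-assocʳ c (suc n) (suc d)

  ^ℤ-suc : ∀ z → b ^ℤ (ℤ.suc z) ≡ B * b ^ℤ z
  ^ℤ-suc (+ n)          = refl
  ^ℤ-suc -[1+ zero ]    = sym (trans (cong (B *_) (*-identityʳ c)) (trans (*-comm B c) cB≡1))
  ^ℤ-suc -[1+ suc n ]   = sym (trans
    (solve 3 (λ B c x → B :* (c :* x) := c :* B :* x) refl B c (c ^ suc n))
    (trans (cong (_* c ^ suc n) cB≡1) (*-identityˡ (c ^ suc n))))

  ^ℤ-+ : ∀ z k → b ^ℤ (z ℤ.+ + k) ≡ b ^ℤ z * B ^ k
  ^ℤ-+ z zero    = trans (cong (b ^ℤ_) (ℤ.+-identityʳ z)) (sym (*-identityʳ (b ^ℤ z)))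
  ^ℤ-+ z (suc k) = trans (cong (b ^ℤ_) (eq z (+ k))) (trans (^ℤ-suc (z ℤ.+ + k))
    (trans (cong (B *_) (^ℤ-+ z k))
      (solve 3 (λ B x y → B :* (x :* y) := x :* (B :* y)) refl B (b ^ℤ z) (B ^ k))))
    where
    eq : ∀ z k → z ℤ.+ (+ 1 ℤ.+ k) ≡ + 1 ℤ.+ (z ℤ.+ k)
    eq = ℤSolver.solve-∀

infixl 6 _+ᴿ_
infixl 7 _·ᴿ_

_+ᴿ_ : ℝ → ℝ → ℝ
x +ᴿ y = cut A B
  (proj₁ (lower-inhabited x) + proj₁ (lower-inhabited y) ,
   _ , _ , proj₂ (lower-inhabited x) , proj₂ (lower-inhabited y) , refl)
  (proj₁ (upper-inhabited x) + proj₁ (upper-inhabited y) ,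
   _ , _ , proj₂ (upper-inhabited x) , proj₂ (upper-inhabited y) , refl)
  sep close
  where
  A B : ℚ → Set
  A q = ∃ λ a → ∃ λ b → Lower x a × Lower y b × q ≡ a + b
  B q = ∃ λ a → ∃ λ b → Upper x a × Upper y b × q ≡ a + b

  sep : ∀ {p q} → A p → B q → p ≤ q
  sep (a , b , a∈L , b∈L , p≡a+b) (c , d , c∈U , d∈U , q≡c+d) = subst₂ _≤_ (sym p≡a+b) (sym q≡c+d)
    (<⇒≤ (+-mono-< {a} {c} {b} {d} (lower<upper x a∈L c∈U) (lower<upper y b∈L d∈U)))

  p-a<p-a+q-m : ∀ p a {m q} → m < q → p - a < (p - a) + (q - m)
  p-a<p-a+q-m p a {m} {q} m<q = subst (_< (p - a) + (q - m)) (+-identityʳ (p - a))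
      (+-monoʳ-< (p - a) (p<q⇒0<q-p m<q))

  regroup : ∀ a m p q → q ≡ (a + (m - p)) + ((p - a) + (q - m))
  regroup = solve 4 (λ a m p q → q := (a :+ (m :- p)) :+ ((p :- a) :+ (q :- m))) refl

  close : ∀ {p q} → p < q → (∃ λ a → p ≤ a × A a) ⊎ (∃ λ b → b ≤ q × B b)
  close {p} {q} p<q =
    let m , p<m , m<q      = <-dense p<q
        a , a∈L , a+δ∈U    = approximate x (p<q⇒0<q-p p<m)
    in split m a a∈L a+δ∈U (located y (p-a<p-a+q-m p a m<q))
    where
    split : ∀ m a → Lower x a → Upper x (a + (m - p)) →
            Lower y (p - a) ⊎ Upper y ((p - a) + (q - m)) → _
    split m a a∈L a+δ∈U (inj₁ l) =
      inj₁ (p , ≤-refl , a , p - a , a∈L , l , sym (p+[q-p]≡q a p))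
    split m a a∈L a+δ∈U (inj₂ u) =
      inj₂ (q , ≤-refl , a + (m - p) , (p - a) + (q - m) , a+δ∈U , u , regroup a m p q)

_·ᴿ_ : (n : ℕ) .{{_ : ℕ.NonZero n}} → ℝ → ℝ
n ·ᴿ x = cut A B
  (fromℕ n * proj₁ (lower-inhabited x) , _ , proj₂ (lower-inhabited x) , refl)
  (fromℕ n * proj₁ (upper-inhabited x) , _ , proj₂ (upper-inhabited x) , refl)
  sep close
  where
  A B : ℚ → Set
  A q = ∃ λ a → Lower x a × q ≡ fromℕ n * a
  B q = ∃ λ a → Upper x a × q ≡ fromℕ n * a

  0<n : 0ℚ < fromℕ n
  0<n = fromℕ-mono-< {0} {n} (ℕ.>-nonZero⁻¹ n)

  sep : ∀ {p q} → A p → B q → p ≤ q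
  sep (a , a∈L , p≡na) (b , b∈U , q≡nb) = subst₂ _≤_ (sym p≡na) (sym q≡nb)
    (<⇒≤ (*-monoˡ-< {a} {b} {fromℕ n} 0<n (lower<upper x a∈L b∈U)))

  c : ℚ
  c = + 1 / n

  scale : ∀ r → r ≡ fromℕ n * (c * r)
  scale r = begin
    r                    ≡⟨ *-identityˡ r ⟨
    1ℚ * r               ≡⟨ cong (_* r) (inverse-fromℕ n) ⟨
    c * fromℕ n * r      ≡⟨ cong (_* r) (*-comm c (fromℕ n)) ⟩
    fromℕ n * c * r      ≡⟨ *-assoc (fromℕ n) c r ⟩
    fromℕ n * (c * r)    ∎
    where open ≡-Reasoning

  cp<cq : ∀ {p q} → p < q → c * p < c * q
  cp<cq {p} {q} p<q = *-cancelˡ-<-nonNeg (fromℕ n) {{nonNegative (<⇒≤ 0<n)}}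
    (subst₂ _<_ (scale p) (scale q) p<q)

  close : ∀ {p q} → p < q → (∃ λ a → p ≤ a × A a) ⊎ (∃ λ b → b ≤ q × B b)
  close {p} {q} p<q = split (located x (cp<cq p<q))
    where
    split : Lower x (c * p) ⊎ Upper x (c * q) → _
    split (inj₁ l) = inj₁ (p , ≤-refl , c * p , l , scale p)
    split (inj₂ u) = inj₂ (q , ≤-refl , c * q , u , scale q)

recip : (x : ℝ) → Positiveᴿ x → ℝ
recip x 0∈L = cut A B
  (let r , r∈U = upper-inhabited x in 0ℚ , r , r∈U , 0*r≤1 r)
  (let r , 0<r , r∈L = lower-open x 0∈L ; s , _ , rs≡1 = inverse 0<r
   in s , r , r∈L , 0<r , ≤-reflexive (sym (trans (*-comm s r) rs≡1)))
  sep close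
  where
  A B : ℚ → Set
  A q = ∃ λ r → Upper x r × q * r ≤ 1ℚ
  B q = ∃ λ r → Lower x r × 0ℚ < r × 1ℚ ≤ q * r

  0*r≤1 : ∀ r → 0ℚ * r ≤ 1ℚ
  0*r≤1 r = subst (_≤ 1ℚ) (sym (*-zeroˡ r)) (nonNegative⁻¹ 1ℚ)

  sep : ∀ {a b} → A a → B b → a ≤ b
  sep {a} {b} (r , r∈U , ar≤1) (s , s∈L , 0<s , 1≤bs) = ≮⇒≥ λ b<a →
    <-irrefl refl (begin-strict
      1ℚ      ≤⟨ 1≤bs ⟩
      b * s   <⟨ *-monoʳ-< 0<s b<a ⟩
      a * s   ≤⟨ *-monoˡ-≤ (0≤a b<a) (<⇒≤ (lower<upper x s∈L r∈U)) ⟩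
      a * r   ≤⟨ ar≤1 ⟩
      1ℚ      ∎)
    where
    open ≤-Reasoning
    0≤a : b < a → 0ℚ ≤ a
    0≤a b<a = ≮⇒≥ λ a<0 → <-irrefl refl (begin-strict
      1ℚ      ≤⟨ 1≤bs ⟩
      b * s   <⟨ *-monoʳ-< 0<s (<-trans b<a a<0) ⟩
      0ℚ * s  ≤⟨ 0*r≤1 s ⟩
      1ℚ      ∎)

  close : ∀ {p q} → p < q → (∃ λ a → p ≤ a × A a) ⊎ (∃ λ b → b ≤ q × B b)
  close {p} {q} p<q with 0ℚ <? p
  ... | no  0≮p = let r , r∈U = upper-inhabited x in
    inj₁ (p , ≤-refl , r , r∈U ,
      ≤-trans (*-monoʳ-≤ (<⇒≤ (lower<upper x 0∈L r∈U)) (≮⇒≥ 0≮p)) (0*r≤1 r))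
  ... | yes 0<p with inverse 0<p | inverse (<-trans 0<p p<q)
  ...   | s , 0<s , ps≡1 | t , 0<t , qt≡1 with located x t<s
    where
    t<s : t < s
    t<s = ≰⇒> λ s≤t → <-irrefl refl (begin-strict
      1ℚ      ≡⟨ ps≡1 ⟨
      p * s   <⟨ *-monoʳ-< 0<s p<q ⟩
      q * s   ≤⟨ *-monoˡ-≤ (<⇒≤ (<-trans 0<p p<q)) s≤t ⟩
      q * t   ≡⟨ qt≡1 ⟩
      1ℚ      ∎)
      where open ≤-Reasoning
  ...     | inj₁ t∈L = inj₂ (q , ≤-refl , t , t∈L , 0<t , ≤-reflexive (sym qt≡1))
  ...     | inj₂ s∈U = inj₁ (p , ≤-refl , s , s∈U , ≤-reflexive ps≡1)

-- For a rational e = n/d in lowest terms, e ≤ log_b a iff bⁿ ≤ aᵈ.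
log : (b : ℕ) .{{_ : ℕ.NonTrivial b}} (a : ℕ) .{{_ : ℕ.NonZero a}} → ℝ
log b a = cut A B (0ℚ , 1≤a¹) above sep close
  where
  A B : ℚ → Set
  A e = b ^ℤ (↥ e) ≤ fromℕ a ^ (↧ₙ e)
  B e = fromℕ a ^ (↧ₙ e) ≤ b ^ℤ (↥ e)

  0<a : 0ℚ < fromℕ a
  0<a = fromℕ-mono-< {0} {a} (ℕ.>-nonZero⁻¹ a)

  1≤a¹ : 1ℚ ≤ fromℕ a ^ 1
  1≤a¹ = subst (1ℚ ≤_) (sym (*-identityʳ (fromℕ a))) (fromℕ-mono-≤ {1} {a} (ℕ.>-nonZero⁻¹ a))

  above : ∃ B
  above =
    let n , a≤bⁿ⁺¹ = ^-archimedean (fromℕ-mono-< {1} {b} (ℕ.nonTrivial⇒n>1 b)) (fromℕ a)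
    in mkℚ (+ suc n) 0 (Coprime.sym (Coprime.1-coprimeTo (suc n))) ,
       subst (_≤ fromℕ b ^ suc n) (sym (*-identityʳ (fromℕ a))) a≤bⁿ⁺¹

  sep : ∀ {e f} → A e → B f → e ≤ f
  sep {e} {f} Ae Bf = *≤* (^ℤ-cancel-≤ b (begin
    b ^ℤ (↥ e ℤ.* ↧ f)            ≡⟨ ^ℤ-assoc b (↥ e) (↧ₙ f) ⟨
    (b ^ℤ ↥ e) ^ ↧ₙ f             ≤⟨ ^-monoˡ-≤ (↧ₙ f) (^ℤ-pos b (↥ e)) Ae ⟩
    (fromℕ a ^ ↧ₙ e) ^ ↧ₙ f       ≡⟨ ^-swap (fromℕ a) (↧ₙ e) (↧ₙ f) ⟩
    (fromℕ a ^ ↧ₙ f) ^ ↧ₙ e       ≤⟨ ^-monoˡ-≤ (↧ₙ e) (^-pos (↧ₙ f) 0<a) Bf ⟩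
    (b ^ℤ ↥ f) ^ ↧ₙ e             ≡⟨ ^ℤ-assoc b (↥ f) (↧ₙ e) ⟩
    b ^ℤ (↥ f ℤ.* ↧ e)            ∎))
    where open ≤-Reasoning

  close : ∀ {p q} → p < q → (∃ λ a → p ≤ a × A a) ⊎ (∃ λ b → b ≤ q × B b)
  close {p} {q} p<q = split (≤-total (b ^ℤ ↥ p) (fromℕ a ^ ↧ₙ p))
    where
    split : A p ⊎ B p → _
    split (inj₁ Ap) = inj₁ (p , ≤-refl , Ap)
    split (inj₂ Bp) = inj₂ (p , <⇒≤ p<q , Bp)

-- For a rational e = n/d in lowest terms and q > 0, q ≤ bᵉ iff qᵈ ≤ bⁿ;
-- and bˣ is the supremum of the bᵉ with e < x and the infimum of those with x < e.
infixr 8 _^ᴿ_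

_^ᴿ_ : (b : ℕ) .{{_ : ℕ.NonTrivial b}} → ℝ → ℝ
b ^ᴿ x = cut A B below above sep close
  where
  A B : ℚ → Set
  A q = 0ℚ < q × ∃ λ e → Lower x e × q ^ ↧ₙ e ≤ b ^ℤ ↥ e
  B q = 0ℚ < q × ∃ λ e → Upper x e × b ^ℤ ↥ e ≤ q ^ ↧ₙ e

  z≤∣z∣*d : ∀ z d .{{_ : ℕ.NonZero d}} → z ℤ.≤ + ℤ.∣ z ∣ ℤ.* + d
  z≤∣z∣*d (+ n)    d rewrite sym (ℤ.pos-* n d) = ℤ.+≤+ (ℕ.m≤m*n n d)
  z≤∣z∣*d -[1+ n ] (suc d) = ℤ.-≤+

  below : ∃ A
  below =
    let e , e∈L = lower-inhabited x
        n       = ℤ.∣ ℤ.- ↥ e ∣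
    in b ^ℤ (ℤ.- + n) , ^ℤ-pos b (ℤ.- + n) , e , e∈L ,
       subst (_≤ b ^ℤ ↥ e) (sym (^ℤ-assoc b (ℤ.- + n) (↧ₙ e))) (^ℤ-mono-≤ b (bound (↥ e) (↧ₙ e)))
    where
    bound : ∀ z d .{{_ : ℕ.NonZero d}} → ℤ.- + ℤ.∣ ℤ.- z ∣ ℤ.* + d ℤ.≤ z
    bound z d = subst₂ ℤ._≤_ (ℤ.neg-distribˡ-* (+ ℤ.∣ ℤ.- z ∣) (+ d)) (ℤ.neg-involutive z)
      (ℤ.neg-mono-≤ (z≤∣z∣*d (ℤ.- z) d))

  above : ∃ B
  above =
    let e , e∈U = upper-inhabited x
        n       = ℤ.∣ ↥ e ∣
    in b ^ℤ (+ n) , ^ℤ-pos b (+ n) , e , e∈U ,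
       subst (b ^ℤ ↥ e ≤_) (sym (^ℤ-assoc b (+ n) (↧ₙ e))) (^ℤ-mono-≤ b (z≤∣z∣*d (↥ e) (↧ₙ e)))

  sep : ∀ {p q} → A p → B q → p ≤ q
  sep {p} {q} (0<p , e , e∈L , p≤bᵉ) (0<q , f , f∈U , bᶠ≤q) =
    ^-cancelˡ-≤ (↧ₙ e) 0<q (^-cancelˡ-≤ (↧ₙ f) (^-pos (↧ₙ e) 0<q) (begin
      (p ^ ↧ₙ e) ^ ↧ₙ f        ≤⟨ ^-monoˡ-≤ (↧ₙ f) (^-pos (↧ₙ e) 0<p) p≤bᵉ ⟩
      (b ^ℤ ↥ e) ^ ↧ₙ f        ≡⟨ ^ℤ-assoc b (↥ e) (↧ₙ f) ⟩
      b ^ℤ (↥ e ℤ.* ↧ f)       <⟨ ^ℤ-mono-< b (drop-*<* (lower<upper x e∈L f∈U)) ⟩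
      b ^ℤ (↥ f ℤ.* ↧ e)       ≡⟨ ^ℤ-assoc b (↥ f) (↧ₙ e) ⟨
      (b ^ℤ ↥ f) ^ ↧ₙ e        ≤⟨ ^-monoˡ-≤ (↧ₙ e) (^ℤ-pos b (↥ f)) bᶠ≤q ⟩
      (q ^ ↧ₙ f) ^ ↧ₙ e        ≡⟨ ^-swap q (↧ₙ f) (↧ₙ e) ⟩
      (q ^ ↧ₙ e) ^ ↧ₙ f        ∎))
    where open ≤-Reasoning

  -- With r = q/p: if bᵉ ≤ p and b ≤ r¹⁺ᵏ then b^(e + 1/(1+k)) ≤ q.
  next : ∀ {p q r} e k → 0ℚ < p → 0ℚ < q → p * r ≡ q → fromℕ b ≤ r ^ suc k → b ^ℤ ↥ e ≤ p ^ ↧ₙ e →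
         let f = e + 1/1+ k in b ^ℤ ↥ f ≤ q ^ ↧ₙ f
  next {p} {q} {r} e@record{} k 0<p 0<q pr≡q b≤rᵏ bᵉ≤p =
    ^-cancelˡ-≤ D (^-pos (↧ₙ f) 0<q) (begin
      (b ^ℤ ↥ f) ^ D               ≡⟨ ^ℤ-assoc b (↥ f) D ⟩
      b ^ℤ (↥ f ℤ.* + D)           ≡⟨ cong (b ^ℤ_) f≃e+1/K ⟩
      b ^ℤ (w ℤ.* ↧ f)             ≡⟨ ^ℤ-assoc b w (↧ₙ f) ⟨
      (b ^ℤ w) ^ ↧ₙ f              ≤⟨ ^-monoˡ-≤ (↧ₙ f) (^ℤ-pos b w) bʷ≤qᴰ ⟩
      (q ^ D) ^ ↧ₙ f               ≡⟨ ^-swap q D (↧ₙ f) ⟩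
      (q ^ ↧ₙ f) ^ D               ∎)
    where
    open ≤-Reasoning

    K D : ℕ
    K = suc k
    D = ↧ₙ e ℕ.* K

    f : ℚ
    f = e + 1/1+ k

    w : ℤ
    w = ↥ e ℤ.* + K ℤ.+ + (↧ₙ e)

    0<B : 0ℚ < fromℕ b
    0<B = <-trans (positive⁻¹ 1ℚ) (fromℕ-mono-< {1} {b} (ℕ.nonTrivial⇒n>1 b))

    f≃e+1/K : ↥ f ℤ.* + D ≡ w ℤ.* ↧ f
    f≃e+1/K = trans (cross f (toℚᵘ-homo-+ e (1/1+ k)))
      (cong (λ z → (↥ e ℤ.* + K ℤ.+ z) ℤ.* ↧ f) (ℤ.*-identityˡ (↧ e)))
      where
      cross : ∀ g {n d} → toℚᵘ g ℚᵘ.≃ ℚᵘ.mkℚᵘ n d → ↥ g ℤ.* + suc d ≡ n ℤ.* ↧ g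
      cross record{} (ℚᵘ.*≡* eq) = eq

    bʷ≤qᴰ : b ^ℤ w ≤ q ^ D
    bʷ≤qᴰ = begin
      b ^ℤ w                                     ≡⟨ ^ℤ-+ b (↥ e ℤ.* + K) (↧ₙ e) ⟩
      b ^ℤ (↥ e ℤ.* + K) * fromℕ b ^ ↧ₙ e        ≡⟨ cong (_* fromℕ b ^ ↧ₙ e) (^ℤ-assoc b (↥ e) K) ⟨
      (b ^ℤ ↥ e) ^ K * fromℕ b ^ ↧ₙ e            ≤⟨ *-monoʳ-≤ (<⇒≤ (^-pos (↧ₙ e) 0<B)) (^-monoˡ-≤ K (^ℤ-pos b (↥ e)) bᵉ≤p) ⟩
      (p ^ ↧ₙ e) ^ K * fromℕ b ^ ↧ₙ e            ≤⟨ *-monoˡ-≤ (<⇒≤ (^-pos K (^-pos (↧ₙ e) 0<p))) (^-monoˡ-≤ (↧ₙ e) 0<B b≤rᵏ) ⟩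
      (p ^ ↧ₙ e) ^ K * (r ^ K) ^ ↧ₙ e            ≡⟨ cong₂ _*_ (^-assocʳ p (↧ₙ e) K) (trans (^-swap r K (↧ₙ e)) (^-assocʳ r (↧ₙ e) K)) ⟩
      p ^ D * r ^ D                              ≡⟨ ^-distrib-* p r D ⟨
      (p * r) ^ D                                ≡⟨ cong (_^ D) pr≡q ⟩
      q ^ D                                      ∎

  close : ∀ {p q} → p < q → (∃ λ a → p ≤ a × A a) ⊎ (∃ λ b → b ≤ q × B b)
  close {p} {q} p<q = split₁ (0ℚ <? p)
    where
    split₂ : ∀ k a → b ^ℤ ↥ a ≤ p ^ ↧ₙ a ⊎ p ^ ↧ₙ a ≤ b ^ℤ ↥ a →
             0ℚ < p → (∃ λ r → p * r ≡ q × fromℕ b ≤ r ^ suc k) →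
             Lower x a → Upper x (a + 1/1+ k) →
             (∃ λ a → p ≤ a × A a) ⊎ (∃ λ b → b ≤ q × B b)
    split₂ k a (inj₂ p≤bᵃ) 0<p _ a∈L a+δ∈U =
      inj₁ (p , ≤-refl , 0<p , a , a∈L , p≤bᵃ)
    split₂ k a (inj₁ bᵃ≤p) 0<p (r , pr≡q , b≤rᵏ) a∈L a+δ∈U =
      inj₂ (q , ≤-refl , <-trans 0<p p<q , a + 1/1+ k , a+δ∈U , next a k 0<p (<-trans 0<p p<q) pr≡q b≤rᵏ bᵃ≤p)

    ratio : 0ℚ < p → ∃ λ r → 1ℚ < r × p * r ≡ q
    ratio 0<p =
      let s , 0<s , ps≡1 = inverse 0<p in s * q ,
        subst (_< s * q) (trans (*-comm s p) ps≡1) (*-monoˡ-< 0<s p<q) ,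
        trans (sym (*-assoc p s q)) (trans (cong (_* q) ps≡1) (*-identityˡ q))

    split₃ : 0ℚ < p → (∃ λ r → 1ℚ < r × p * r ≡ q) → (∃ λ a → p ≤ a × A a) ⊎ (∃ λ b → b ≤ q × B b)
    split₃ 0<p (r , 1<r , pr≡q) =
      let k , b≤rᵏ        = ^-archimedean 1<r (fromℕ b)
          a , a∈L , a+δ∈U = approximate x (0<1/1+ k)
      in split₂ k a (≤-total (b ^ℤ ↥ a) (p ^ ↧ₙ a)) 0<p (r , pr≡q , b≤rᵏ) a∈L a+δ∈U

    split₁ : Dec (0ℚ < p) → (∃ λ a → p ≤ a × A a) ⊎ (∃ λ b → b ≤ q × B b)
    split₁ (no  0≮p) =
      let a , Aa = below in inj₁ (a , ≤-trans (≮⇒≥ 0≮p) (<⇒≤ (proj₁ Aa)) , Aa)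
    split₁ (yes 0<p) = split₃ 0<p (ratio 0<p)

log2-positive : (b : ℕ) .{{_ : ℕ.NonTrivial b}} → Positiveᴿ (log b 2)
log2-positive b =
  let k , b≤2ᵏ = ^-archimedean (fromℕ-mono-< {1} {2} (ℕ.s<s ℕ.z<s)) (fromℕ b)
  in 1/1+ k , 0<1/1+ k , subst (_≤ fromℕ 2 ^ suc k) (sym (*-identityʳ (fromℕ b))) b≤2ᵏ

-- A polynomial is a formal sum of terms c·X^e, not necessarily in normal form:
-- the same exponent vector may occur several times.
Poly : ℕ → Set
Poly n = List (ℤ × Vec ℕ n)

coeff : ∀ {n} → Poly n → Vec ℕ n → ℤ
coeff []            e = + 0
coeff ((c , d) ∷ f) e = (if does (Vec.≡-dec ℕ._≟_ d e) then c else + 0) ℤ.+ coeff f e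

monomial : ∀ {n} → Vec ℕ n → Vec ℤ n → ℤ
monomial []      []      = + 1
monomial (k ∷ e) (x ∷ v) = x ℤ.^ k ℤ.* monomial e v

eval : ∀ {n} → Poly n → Vec ℤ n → ℤ
eval []            v = + 0
eval ((c , e) ∷ f) v = c ℤ.* monomial e v ℤ.+ eval f v

DegreeIn≤ : ∀ {n} → Poly n → Fin n → ℕ → Set
DegreeIn≤ f i k = ∀ e → coeff f e ≢ + 0 → lookup e i ℕ.≤ k

Multilinear : ∀ {n} → Poly n → Set
Multilinear f = ∀ i → DegreeIn≤ f i 1

-- The gcd of all coefficients; exponents not listed in f have coefficient 0.
content : ∀ {n} → Poly n → ℕ
content f = foldr gcd 0 (List.map (λ (_ , e) → ℤ.∣ coeff f e ∣) f)

CoprimeTo : ∀ {n} → Poly n → ℕ → Set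
CoprimeTo f N = gcd N (content f) ≡ 1

-- All points of {0,…,m-1}ⁿ, each listed once.
cube : (m n : ℕ) → List (Vec ℕ n)
cube m zero    = [] ∷ []
cube m (suc n) = cartesianProductWith _∷_ (upTo m) (cube m n)

length-product : ∀ {A B C : Set} (f : A → B → C) xs ys →
                 length (cartesianProductWith f xs ys) ≡ length xs ℕ.* length ys
length-product f []       ys = refl
length-product f (x ∷ xs) ys = trans
  (List.length-++ (List.map (f x) ys))
  (cong₂ ℕ._+_ (List.length-map (f x) ys) (length-product f xs ys))

length-cube : ∀ m n → length (cube m n) ≡ m ℕ.^ n
length-cube m zero    = refl
length-cube m (suc n) = trans
  (length-product _∷_ (upTo m) (cube m n))
  (cong₂ ℕ._*_ (List.length-upTo m) (length-cube m n))

cube-nonEmpty : ∀ m n .{{_ : ℕ.NonZero m}} → ℕ.NonZero (length (cube m n))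
cube-nonEmpty m n = subst ℕ.NonZero (sym (length-cube m n)) (ℕ.m^n≢0 m n)

-- The probability of P under the uniform distribution on {0,…,m-1}ⁿ.
Pr : ∀ (m n : ℕ) .{{_ : ℕ.NonZero m}} {P : Pred (Vec ℕ n) 0ℓ} → Decidable P → ℚ
Pr m n P? = _/_ (+ length (filter P? (cube m n))) (length (cube m n)) {{cube-nonEmpty m n}}

{-# OPTIONS --safe #-}

-- Reveal the coordinates of x one at a time and follow D, the gcd of N and of the content of the
-- remaining polynomial. If e divides the contents of both g + x h and g + y h, then it divides x - y
-- times the content of g + X h; hence X₁⋯X_μ is the worst polynomial coprime to N, and the
-- probability is at most μ/m plus the proportion of y ∈ (ℤ/N)^μ with N ∣ y₁⋯y_μ. Such a y is
-- divisible componentwise by one of the τ_μ(N) factorisations N = d₁⋯d_μ, which bounds that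
-- proportion by τ_μ(N)/N.
--
-- Replace ε by a slightly larger rational a/b, and put σ = b/(a+b) and P = ⌊μ^(1+a/b)⌋. A prime
-- p > P contributes at most μ^r ≤ p^(σr) to τ_μ(N), where p^r is its power in N; every prime
-- contributes at most p^(σr) (1 - p^(-σ))^(-μ), by the generating function of the binomial
-- coefficients. Hence τ_μ(N) ≤ N^σ ∏_{p≤P} (1 - p^(-σ))^(-μ), and the product, extended over all
-- integers 2 ≤ p ≤ P, is estimated by replacing p^(-σ) by rational upper bounds from the weighted
-- inequality of arithmetic and geometric means. The hypothesis on log₂ N then gives
-- τ_μ(N)/N ≤ 2^(-λ). The constant 31/8 instead of 4 absorbs the rational approximation of ε.

module Submission where

open import Data.Bool using (true; false; if_then_else_)
open import Data.Product using (∃; ∃₂; _×_; _,_; proj₁; proj₂)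
open import Data.Sum using (_⊎_; inj₁; inj₂)
open import Function using (_∘_; id; it)
open import Level using (0ℓ)
open import Relation.Binary.PropositionalEquality
open import Relation.Nullary using (Dec; does; yes; no; ¬_; ¬?; contradiction)
open import Relation.Nullary.Decidable using (from-yes)
open import Relation.Unary using (Pred; Decidable)

-- The rational a/b has to lie above ε: then 2^b ≤ μ^a follows from ε ≥ log_μ 2, and 1 + b/a ≤ 1 +
-- 1/ε, so that only the term 4μ^(2+ε) suffers from the approximation. With s = a + b, the
-- hypothesis on N leaves room for ∏ (1 - p^(-σ))^(-1) ≤ 2^((31/8)·(a/s)·P). All of this is stated
-- in ℕ after raising to the power 24s, which clears σ = b/s and the fractions below.
--
-- The mean of a copies of p and b copies of 1 gives p^(-σ) ≤ (ap+b)/(sp), and then the product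
-- telescopes to (s/b)^(P-1)·P. In units of (a/s)·P, the logarithms of the two factors are at most 2
-- and 15/8 for a ≤ b, and at most 8/3 and 1 for b ≤ a ≤ 3b; the first pair is the origin of 31/8.
-- The cost of the first factor grows like log(a/b), so this estimate breaks down for large a/b. For
-- a ≥ 3b only the integers up to about 2b(P+1)/s receive a factor that grows with a/b, and the
-- others receive the constant 4.

-- Finite sums, sums over cubes, and counting inside a residue class

module Sums where

  open import Data.Nat
  open import Data.Nat.Divisibility
  open import Data.Nat.DivMod
  open import Data.Nat.Properties
  open import Data.Nat.Tactic.RingSolver using (solve-∀)
  open import Data.Vec using (Vec; []; _∷_)

  𝟙 : ∀ {A : Set} → Dec A → ℕ
  𝟙 a? = if does a? then 1 else 0

  𝟙-mono : ∀ {A B : Set} (a? : Dec A) (b? : Dec B) → (A → B) → 𝟙 a? ≤ 𝟙 b?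
  𝟙-mono (no _)  _       _   = z≤n
  𝟙-mono (yes a) (yes _) _   = ≤-refl
  𝟙-mono (yes a) (no ¬b) a⇒b = contradiction (a⇒b a) ¬b

  𝟙-yes : ∀ {A : Set} (a? : Dec A) → A → 1 ≤ 𝟙 a?
  𝟙-yes (yes _) _ = ≤-refl
  𝟙-yes (no ¬a) a = contradiction a ¬a

  Σ< : ℕ → (ℕ → ℕ) → ℕ
  Σ< zero    f = 0
  Σ< (suc n) f = f 0 + Σ< n (f ∘ suc)

  Σ-mono : ∀ n {f g} → (∀ i → f i ≤ g i) → Σ< n f ≤ Σ< n g
  Σ-mono zero    f≤g = z≤n
  Σ-mono (suc n) f≤g = +-mono-≤ (f≤g 0) (Σ-mono n (f≤g ∘ suc))

  Σ-cong : ∀ n {f g} → (∀ i → f i ≡ g i) → Σ< n f ≡ Σ< n g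
  Σ-cong n f≡g = ≤-antisym (Σ-mono n (≤-reflexive ∘ f≡g)) (Σ-mono n (≤-reflexive ∘ sym ∘ f≡g))

  Σ-const : ∀ n c → Σ< n (λ _ → c) ≡ n * c
  Σ-const zero    c = refl
  Σ-const (suc n) c = cong (c +_) (Σ-const n c)

  Σ-* : ∀ n c f → Σ< n (λ i → c * f i) ≡ c * Σ< n f
  Σ-* zero    c f = sym (*-zeroʳ c)
  Σ-* (suc n) c f = trans (cong (c * f 0 +_) (Σ-* n c (f ∘ suc))) (sym (*-distribˡ-+ c (f 0) _))

  Σ-+ : ∀ n f g → Σ< n (λ i → f i + g i) ≡ Σ< n f + Σ< n g
  Σ-+ zero    f g = refl
  Σ-+ (suc n) f g = trans (cong (f 0 + g 0 +_) (Σ-+ n (f ∘ suc) (g ∘ suc)))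
    (interchange (f 0) (g 0) (Σ< n (f ∘ suc)) (Σ< n (g ∘ suc)))
    where
    interchange : ∀ a b c d → a + b + (c + d) ≡ a + c + (b + d)
    interchange = solve-∀

  Σ-swap : ∀ m n (f : ℕ → ℕ → ℕ) → Σ< m (λ i → Σ< n (f i)) ≡ Σ< n (λ j → Σ< m (λ i → f i j))
  Σ-swap zero    n f = sym (trans (Σ-const n 0) (*-zeroʳ n))
  Σ-swap (suc m) n f = trans (cong (Σ< n (f 0) +_) (Σ-swap m n (f ∘ suc)))
    (sym (Σ-+ n (f 0) (λ j → Σ< m (λ i → f (suc i) j))))

  Σ-split : ∀ m n f → Σ< (m + n) f ≡ Σ< m f + Σ< n (λ i → f (m + i))
  Σ-split zero    n f = refl
  Σ-split (suc m) n f = trans (cong (f 0 +_) (Σ-split m n (f ∘ suc))) (sym (+-assoc (f 0) _ _))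

  Σ-monoˡ : ∀ {m n} → m ≤ n → ∀ f → Σ< m f ≤ Σ< n f
  Σ-monoˡ {m} {n} m≤n f = subst (λ l → Σ< m f ≤ Σ< l f) (m+[n∸m]≡n m≤n)
    (subst (Σ< m f ≤_) (sym (Σ-split m (n ∸ m) f)) (m≤m+n _ _))

  cubeΣ : ℕ → ∀ k → (Vec ℕ k → ℕ) → ℕ
  cubeΣ n zero    f = f []
  cubeΣ n (suc k) f = Σ< n λ x → cubeΣ n k λ xs → f (x ∷ xs)

  cubeΣ-mono : ∀ n k {f g} → (∀ xs → f xs ≤ g xs) → cubeΣ n k f ≤ cubeΣ n k g
  cubeΣ-mono n zero    f≤g = f≤g []
  cubeΣ-mono n (suc k) f≤g = Σ-mono n λ x → cubeΣ-mono n k λ xs → f≤g (x ∷ xs)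

  cubeΣ-+ : ∀ n k f g → cubeΣ n k (λ xs → f xs + g xs) ≡ cubeΣ n k f + cubeΣ n k g
  cubeΣ-+ n zero    f g = refl
  cubeΣ-+ n (suc k) f g = trans (Σ-cong n λ x → cubeΣ-+ n k (λ xs → f (x ∷ xs)) (λ xs → g (x ∷ xs)))
    (Σ-+ n _ _)

  cubeΣ-* : ∀ n k c f → cubeΣ n k (λ xs → c * f xs) ≡ c * cubeΣ n k f
  cubeΣ-* n zero    c f = refl
  cubeΣ-* n (suc k) c f = trans (Σ-cong n λ x → cubeΣ-* n k c (λ xs → f (x ∷ xs))) (Σ-* n c _)

  cubeΣ-0 : ∀ n k → cubeΣ n k (λ _ → 0) ≡ 0
  cubeΣ-0 n k = cubeΣ-* n k 0 (λ _ → 0)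

  -- Q lies in a single residue class mod e; phrased by differences, this needs no choice of a
  -- representative and survives shifts.
  Spaced : ℕ → Pred ℕ 0ℓ → Set
  Spaced e Q = ∀ {i j} → i ≤ j → Q i → Q j → e ∣ j ∸ i

  module _ {Q : Pred ℕ 0ℓ} (Q? : Decidable Q) where

    count : ℕ → ℕ
    count n = Σ< n (𝟙 ∘ Q?)

  Spaced-shift : ∀ {e Q} d → Spaced e Q → Spaced e (λ i → Q (d + i))
  Spaced-shift {e} d sp {i} {j} i≤j qi qj =
    subst (e ∣_) ([m+n]∸[m+o]≡n∸o d j i) (sp (+-monoʳ-≤ d i≤j) qi qj)

  count-none : ∀ n {Q : Pred ℕ 0ℓ} (Q? : Decidable Q) → (∀ i → i < n → Q i → 1 ≤ 0) → count Q? n ≤ 0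
  count-none zero    Q? none = z≤n
  count-none (suc n) Q? none with Q? 0
  ... | yes q0 = contradiction (none 0 z<s q0) λ ()
  ... | no  _  = count-none n (Q? ∘ suc) λ i i<n → none (suc i) (s<s i<n)

  count-block : ∀ n {e Q} (Q? : Decidable Q) → n ≤ e → Spaced e Q → count Q? n ≤ 1
  count-block zero    Q? n≤e sp = z≤n
  count-block (suc n) {e} Q? n≤e sp with Q? 0
  ... | yes q0 = +-monoʳ-≤ 1 (count-none n (Q? ∘ suc) λ i i<n q →
          contradiction (∣⇒≤ (sp z≤n q0 q)) (<⇒≱ (<-≤-trans (s<s i<n) n≤e)))
  ... | no  _  = count-block n (Q? ∘ suc) (<⇒≤ n≤e) (Spaced-shift 1 sp)

  count-blocks : ∀ l {e Q} (Q? : Decidable Q) → Spaced e Q → count Q? (l * e) ≤ l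
  count-blocks zero        Q? sp = z≤n
  count-blocks (suc l) {e} Q? sp = subst (_≤ suc l) (sym (Σ-split e (l * e) (𝟙 ∘ Q?)))
    (+-mono-≤ (count-block e Q? ≤-refl sp) (count-blocks l (λ i → Q? (e + i)) (Spaced-shift e sp)))

  -- The interval is enlarged to `suc (m / e)` full blocks of length e, each with at most one
  -- element. The excess e on the right is the source of the term μ/m in the theorem.
  count-spaced : ∀ m {e Q} .{{_ : NonZero e}} (Q? : Decidable Q) → Spaced e Q → e * count Q? m ≤ m + e
  count-spaced m {e} Q? sp = begin
    e * count Q? m                   ≤⟨ *-monoʳ-≤ e (Σ-monoˡ m≤[1+l]e (𝟙 ∘ Q?)) ⟩
    e * count Q? (suc (m / e) * e)   ≤⟨ *-monoʳ-≤ e (count-blocks (suc (m / e)) Q? sp) ⟩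
    e * suc (m / e)                  ≡⟨ trans (*-suc e (m / e)) (+-comm e _) ⟩
    e * (m / e) + e                  ≡⟨ cong (_+ e) (*-comm e (m / e)) ⟩
    m / e * e + e                    ≤⟨ +-monoˡ-≤ e (m/n*n≤m m e) ⟩
    m + e                            ∎
    where
    open import Data.Nat.DivMod
    open ≤-Reasoning
    m≤[1+l]e : m ≤ suc (m / e) * e
    m≤[1+l]e = begin
      m                      ≡⟨ m≡m%n+[m/n]*n m e ⟩
      m % e + m / e * e      ≤⟨ +-monoˡ-≤ (m / e * e) (m%n≤n m e) ⟩
      suc (m / e) * e        ∎

  count-multiples : ∀ l {e Q} .{{_ : NonZero e}} (Q? : Decidable Q) → (∀ i → Q (i * e)) → l ≤ count Q? (l * e)
  count-multiples zero            Q? q = z≤n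
  count-multiples (suc l) {suc e} Q? q = subst (suc l ≤_) (sym (Σ-split (suc e) (l * suc e) (𝟙 ∘ Q?)))
    (+-mono-≤ (≤-trans (𝟙-yes (Q? 0) (q 0)) (m≤m+n _ _))
              (count-multiples l (λ i → Q? (suc e + i)) (q ∘ suc)))

-- Zeros of a multilinear polynomial compared with zeros of a monomial

module Zeros where

  open Sums
  open import Data.Integer as ℤ using (ℤ; +_; ∣_∣)
  import Data.Integer.Divisibility.Signed as ℤ
  import Data.Integer.Properties as ℤ
  import Data.Integer.Tactic.RingSolver as ℤSolver
  open import Data.Nat
  open import Data.Nat.Divisibility
  open import Data.Nat.GCD
  open import Data.Nat.Properties
  open import Data.Nat.Tactic.RingSolver using (solve-∀)
  open import Data.Vec using (Vec; []; _∷_)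

  -- (g , h) represents the polynomial g + X·h, where X is the first variable.
  Tree : ℕ → Set
  Tree zero    = ℤ
  Tree (suc k) = Tree k × Tree k

  infixl 6 _+[_]_

  _+[_]_ : ∀ {k} → Tree k → ℕ → Tree k → Tree k
  _+[_]_ {zero}  a         x b         = a ℤ.+ + x ℤ.* b
  _+[_]_ {suc k} (g₀ , g₁) x (h₀ , h₁) = g₀ +[ x ] h₀ , g₁ +[ x ] h₁

  evalᵗ : ∀ {k} → Tree k → Vec ℕ k → ℤ
  evalᵗ a       []       = a
  evalᵗ (g , h) (x ∷ xs) = evalᵗ (g +[ x ] h) xs

  contentᵗ : ∀ {k} → Tree k → ℕ
  contentᵗ {zero}  a       = ∣ a ∣
  contentᵗ {suc k} (g , h) = gcd (contentᵗ g) (contentᵗ h)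

  ∣-*gcd : ∀ {e} d a b → e ∣ d * a → e ∣ d * b → e ∣ d * gcd a b
  ∣-*gcd d a b e∣da e∣db = subst (_ ∣_) (sym (c*gcd[m,n]≡gcd[cm,cn] d a b)) (gcd-greatest e∣da e∣db)

  content-difference : ∀ {k} (g h : Tree k) {e} x d →
    e ∣ contentᵗ (g +[ x ] h) → e ∣ contentᵗ (g +[ x + d ] h) →
    (e ∣ d * contentᵗ g) × (e ∣ d * contentᵗ h)
  content-difference {zero} a b {e} x d e∣x e∣y =
    scaled a (ℤ.∣m∣n⇒∣m-n (ℤ.∣n⇒∣m*n (+ (x + d)) p) (ℤ.∣n⇒∣m*n (+ x) q))
      (trans (cong (λ z → z ℤ.* (a ℤ.+ + x ℤ.* b) ℤ.- + x ℤ.* (a ℤ.+ z ℤ.* b)) (ℤ.pos-+ x d)) (elim-b a b (+ x) (+ d))) ,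
    scaled b (ℤ.∣m∣n⇒∣m-n q p)
      (trans (cong (λ z → a ℤ.+ z ℤ.* b ℤ.- (a ℤ.+ + x ℤ.* b)) (ℤ.pos-+ x d)) (elim-a a b (+ x) (+ d)))
    where
    p : + e ℤ.∣ a ℤ.+ + x ℤ.* b
    p = ℤ.∣ᵤ⇒∣ e∣x
    q : + e ℤ.∣ a ℤ.+ + (x + d) ℤ.* b
    q = ℤ.∣ᵤ⇒∣ e∣y
    scaled : ∀ z {w} → + e ℤ.∣ w → w ≡ + d ℤ.* z → e ∣ d * ∣ z ∣
    scaled z e∣w refl = subst (e ∣_) (ℤ.abs-* (+ d) z) (ℤ.∣⇒∣ᵤ e∣w)
    elim-b : ∀ a b x d → (x ℤ.+ d) ℤ.* (a ℤ.+ x ℤ.* b) ℤ.- x ℤ.* (a ℤ.+ (x ℤ.+ d) ℤ.* b) ≡ d ℤ.* a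
    elim-b = ℤSolver.solve-∀
    elim-a : ∀ a b x d → a ℤ.+ (x ℤ.+ d) ℤ.* b ℤ.- (a ℤ.+ x ℤ.* b) ≡ d ℤ.* b
    elim-a = ℤSolver.solve-∀
  content-difference {suc k} (g₀ , g₁) (h₀ , h₁) x d e∣x e∣y
    with content-difference g₀ h₀ x d (∣-trans e∣x (gcd[m,n]∣m _ _)) (∣-trans e∣y (gcd[m,n]∣m _ _))
       | content-difference g₁ h₁ x d (∣-trans e∣x (gcd[m,n]∣n (contentᵗ (g₀ +[ x ] h₀)) _))
                                      (∣-trans e∣y (gcd[m,n]∣n (contentᵗ (g₀ +[ x + d ] h₀)) _))
  ... | e∣g₀ , e∣h₀ | e∣g₁ , e∣h₁ =
    ∣-*gcd d (contentᵗ g₀) (contentᵗ g₁) e∣g₀ e∣g₁ , ∣-*gcd d (contentᵗ h₀) (contentᵗ h₁) e∣h₀ e∣h₁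

  module _ (N : ℕ) .{{_ : NonZero N}} where

    -- The accumulator makes `prodZeros (suc k) c` unfold to the sum over y of
    -- `prodZeros k (c * y)`, so that one coordinate at a time can be moved into the coefficient c.
    prodFrom : ∀ {k} → ℕ → Vec ℕ k → ℕ
    prodFrom c []       = c
    prodFrom c (y ∷ ys) = prodFrom (c * y) ys

    prodZeros : ℕ → ℕ → ℕ
    prodZeros k c = cubeΣ N k λ ys → 𝟙 (N ∣? prodFrom c ys)

    zeros : ∀ {k} → ℕ → Tree k → ℕ
    zeros {k} m t = cubeΣ m k λ xs → 𝟙 (N ∣? ∣ evalᵗ t xs ∣)

    gcdContent : ∀ {k} → Tree k → ℕ
    gcdContent t = gcd N (contentᵗ t)

    -- Let X and Y be the two gcds, e = gcd(X, Y) and D the gcd of N with the content of `(g , h)`.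
    -- Then N divides ec, and e divides Dd by `content-difference`; hence N divides Dcd.
    gcdContent-spaced : ∀ {k} (g h : Tree k) c x d →
      N ∣ gcdContent (g +[ x ] h) * c → N ∣ gcdContent (g +[ x + d ] h) * c →
      N ∣ gcdContent {suc k} (g , h) * c * d
    gcdContent-spaced {k} g h c x d N∣x N∣y = ∣-trans N∣ec (subst (e * c ∣_) (rearrange d (gcdContent {suc k} (g , h)) c)
        (*-monoˡ-∣ c (∣-*gcd d N _ (∣n⇒∣m*n d (∣-trans (gcd[m,n]∣m _ _) (gcd[m,n]∣m _ _))) e∣d[g,h])))
      where
      X Y e : ℕ
      X = gcdContent (g +[ x ] h)
      Y = gcdContent (g +[ x + d ] h)
      e = gcd X Y
      rearrange : ∀ d D c → d * D * c ≡ D * c * d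
      rearrange = solve-∀
      N∣ec : N ∣ e * c
      N∣ec = subst (N ∣_) (*-comm c e) (∣-*gcd c X Y (subst (N ∣_) (*-comm X c) N∣x) (subst (N ∣_) (*-comm Y c) N∣y))
      e∣d[g,h] : e ∣ d * contentᵗ {suc k} (g , h)
      e∣d[g,h] with content-difference g h x d
        (∣-trans (gcd[m,n]∣m X Y) (gcd[m,n]∣n N _)) (∣-trans (gcd[m,n]∣n X Y) (gcd[m,n]∣n N _))
      ... | e∣g , e∣h = ∣-*gcd d (contentᵗ g) (contentᵗ h) e∣g e∣h

    -- Let f be the gcd of N and `gcdContent (g , h) * c`. The x on the left lie in one class mod
    -- N/f, while the f multiples of N/f below N all occur among the y on the right. Both
    -- proportions are thus compared with f/N, up to 1/m.
    count-gcdContent : ∀ {k} (g h : Tree k) m c →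
      N * Σ< m (λ x → 𝟙 (N ∣? gcdContent (g +[ x ] h) * c)) ≤
      m * Σ< N (λ y → 𝟙 (N ∣? gcdContent {suc k} (g , h) * c * y)) + N
    count-gcdContent {k} g h m c = begin
      N * S               ≡⟨ cong (_* S) N≡f*e ⟩
      f * e * S           ≡⟨ *-assoc f e S ⟩
      f * (e * S)         ≤⟨ *-monoʳ-≤ f (count-spaced m S? spaced) ⟩
      f * (m + e)         ≡⟨ *-distribˡ-+ f m e ⟩
      f * m + f * e       ≡⟨ cong₂ _+_ (*-comm f m) (sym N≡f*e) ⟩
      m * f + N           ≤⟨ +-monoˡ-≤ N (*-monoʳ-≤ m f≤T) ⟩
      m * T + N           ∎
      where
      open ≤-Reasoning
      D f e S T : ℕ
      D = gcdContent {suc k} (g , h) * c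
      f = gcd N D
      f∣N : f ∣ N
      f∣N = gcd[m,n]∣m N D
      e = quotient f∣N
      N≡f*e : N ≡ f * e
      N≡f*e = m∣n⇒n≡m*quotient f∣N
      instance
        e≢0 : NonZero e
        e≢0 = quotient≢0 f∣N
        f≢0 : NonZero f
        f≢0 = m*n≢0⇒m≢0 f {{subst NonZero N≡f*e it}}
          where open import Function using (it)
      S? : ∀ x → _
      S? x = N ∣? gcdContent (g +[ x ] h) * c
      S = Σ< m (𝟙 ∘ S?)
      T = Σ< N (λ y → 𝟙 (N ∣? D * y))
      spaced : Spaced e _
      spaced {x} {y} x≤y N∣x N∣y = *-cancelˡ-∣ f (subst (_∣ f * (y ∸ x)) N≡f*e
        (subst (N ∣_) (*-comm (y ∸ x) f) (∣-*gcd (y ∸ x) N D (n∣m*n (y ∸ x))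
          (subst (N ∣_) (*-comm D (y ∸ x)) (gcdContent-spaced g h c x (y ∸ x) N∣x
            (subst (λ y → N ∣ gcdContent (g +[ y ] h) * c) (sym (m+[n∸m]≡n x≤y)) N∣y))))))
      f≤T : f ≤ T
      f≤T = subst (λ n → f ≤ Σ< n (λ y → 𝟙 (N ∣? D * y))) (sym N≡f*e)
        (count-multiples f (λ y → N ∣? D * y) λ i →
          subst₂ _∣_ (sym N≡f*e) (rearrange D i e) (∣n⇒∣m*n i (*-monoˡ-∣ e (gcd[m,n]∣n N D))))
        where
        rearrange : ∀ D i e → i * (D * e) ≡ D * (i * e)
        rearrange = solve-∀

    -- Exchanging the sums and absorbing y into c removes one of the j coordinates. This induction
    -- is the reason for a general c, which is 1 in the application.
    sum-prodZeros : ∀ {k} (g h : Tree k) m j c →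
      N * Σ< m (λ x → prodZeros j (gcdContent (g +[ x ] h) * c)) ≤
      m * prodZeros (suc j) (gcdContent {suc k} (g , h) * c) + N ^ suc j
    sum-prodZeros {k} g h m zero c = ≤-trans (count-gcdContent g h m c)
      (≤-reflexive (cong (λ n → m * prodZeros 1 (gcdContent {suc k} (g , h) * c) + n) (sym (*-identityʳ N))))
    sum-prodZeros {k} g h m (suc j) c = begin
      N * Σ< m (λ x → Σ< N λ y → Z (X x * c * y))            ≡⟨ cong (N *_) (Σ-swap m N _) ⟩
      N * Σ< N (λ y → Σ< m λ x → Z (X x * c * y))            ≡⟨ Σ-* N N _ ⟨
      Σ< N (λ y → N * Σ< m λ x → Z (X x * c * y))            ≡⟨ Σ-cong N (λ y → cong (N *_) (Σ-cong m λ x → cong Z (*-assoc (X x) c y))) ⟩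
      Σ< N (λ y → N * Σ< m λ x → Z (X x * (c * y)))          ≤⟨ Σ-mono N (λ y → sum-prodZeros g h m j (c * y)) ⟩
      Σ< N (λ y → m * Z′ (D * (c * y)) + N ^ suc j)          ≡⟨ Σ-+ N (λ y → m * Z′ (D * (c * y))) (λ _ → N ^ suc j) ⟩
      Σ< N (λ y → m * Z′ (D * (c * y))) + Σ< N (λ _ → N ^ suc j)
        ≡⟨ cong₂ _+_ (trans (Σ-* N m (λ y → Z′ (D * (c * y)))) (cong (m *_) (Σ-cong N λ y → cong Z′ (sym (*-assoc D c y))))) (Σ-const N (N ^ suc j)) ⟩
      m * Σ< N (λ y → Z′ (D * c * y)) + N ^ suc (suc j)      ∎
      where
      open ≤-Reasoning
      D : ℕ
      D = gcdContent {suc k} (g , h)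
      X : ℕ → ℕ
      X x = gcdContent (g +[ x ] h)
      Z Z′ : ℕ → ℕ
      Z  = prodZeros j
      Z′ = prodZeros (suc j)

    -- Among the polynomials with a given gcd D of N and the content, D·X₁⋯Xₖ has the most zeros mod N,
    -- up to an error that stems from m not being a multiple of N.
    zeros-bound : ∀ {k} m (t : Tree k) →
      m * zeros m t * N ^ k ≤ m ^ suc k * prodZeros k (gcdContent t) + k * m ^ k * N ^ k
    zeros-bound {zero} m a = begin
      m * 𝟙 (N ∣? ∣ a ∣) * 1                    ≡⟨ *-identityʳ _ ⟩
      m * 𝟙 (N ∣? ∣ a ∣)                        ≤⟨ *-monoʳ-≤ m (𝟙-mono (N ∣? ∣ a ∣) (N ∣? gcd N ∣ a ∣) (gcd-greatest ∣-refl)) ⟩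
      m * 𝟙 (N ∣? gcd N ∣ a ∣)                  ≡⟨ cong (_* 𝟙 (N ∣? gcd N ∣ a ∣)) (*-identityʳ m) ⟨
      m * 1 * 𝟙 (N ∣? gcd N ∣ a ∣)              ≡⟨ +-identityʳ _ ⟨
      m * 1 * 𝟙 (N ∣? gcd N ∣ a ∣) + 0          ∎
      where open ≤-Reasoning
    zeros-bound {suc k} m (g , h) = begin
      m * Σ< m Z * N ^ suc k                                ≡⟨ rearrange₁ m (Σ< m Z) N (N ^ k) ⟩
      N * (m * N ^ k * Σ< m Z)                              ≡⟨ cong (N *_) (Σ-* m (m * N ^ k) Z) ⟨
      N * Σ< m (λ x → m * N ^ k * Z x)                      ≤⟨ *-monoʳ-≤ N (Σ-mono m bound) ⟩
      N * Σ< m (λ x → m ^ suc k * W x + k * m ^ k * N ^ k)  ≡⟨ cong (N *_) (trans (Σ-+ m _ _) (cong₂ _+_ (Σ-* m (m ^ suc k) W) (Σ-const m _))) ⟩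
      N * (m ^ suc k * Σ< m W + m * (k * m ^ k * N ^ k))    ≡⟨ rearrange₂ N (m ^ suc k) (Σ< m W) m k (m ^ k) (N ^ k) ⟩
      m ^ suc k * (N * Σ< m W) + k * m ^ suc k * N ^ suc k  ≤⟨ +-monoˡ-≤ _ (*-monoʳ-≤ (m ^ suc k) sumW) ⟩
      m ^ suc k * (m * W′ + N ^ suc k) + k * m ^ suc k * N ^ suc k  ≡⟨ rearrange₃ m (m ^ suc k) W′ (N ^ suc k) k ⟩
      m ^ suc (suc k) * W′ + suc k * m ^ suc k * N ^ suc k  ∎
      where
      open ≤-Reasoning
      Z W : ℕ → ℕ
      Z x = zeros m (g +[ x ] h)
      W x = prodZeros k (gcdContent (g +[ x ] h))
      W′ : ℕ
      W′ = prodZeros (suc k) (gcdContent {suc k} (g , h))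
      bound : ∀ x → m * N ^ k * Z x ≤ m ^ suc k * W x + k * m ^ k * N ^ k
      bound x = subst (_≤ m ^ suc k * W x + k * m ^ k * N ^ k) (swap m (Z x) (N ^ k)) (zeros-bound m (g +[ x ] h))
        where
        swap : ∀ a b c → a * b * c ≡ a * c * b
        swap = solve-∀
      sumW : N * Σ< m W ≤ m * W′ + N ^ suc k
      sumW = subst₂ (λ f d → N * f ≤ m * prodZeros (suc k) d + N ^ suc k)
        (Σ-cong m λ x → cong (prodZeros k) (*-identityʳ (gcdContent (g +[ x ] h))))
        (*-identityʳ (gcdContent {suc k} (g , h)))
        (sum-prodZeros g h m k 1)
      rearrange₁ : ∀ m z N n → m * z * (N * n) ≡ N * (m * n * z)
      rearrange₁ = solve-∀
      rearrange₂ : ∀ N p w m k q n → N * (p * w + m * (k * q * n)) ≡ p * (N * w) + k * (m * q) * (N * n)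
      rearrange₂ = solve-∀
      rearrange₃ : ∀ m p w n k → p * (m * w + n) + k * p * n ≡ m * p * w + (p + k * p) * n
      rearrange₃ = solve-∀

-- Covering the zeros of y₁⋯yₖ mod N by factorisations of N

module Covers where

  open Sums
  open Zeros
  open import Defs using (length-product)
  open import Data.List as List using (List; []; _∷_; length; cartesianProductWith)
  import Data.List.Properties as List
  open import Data.List.Relation.Unary.All as All using (All; []; _∷_)
  import Data.List.Relation.Unary.All.Properties as All
  open import Data.List.Relation.Unary.Any as Any using (Any; here; there)
  import Data.List.Relation.Unary.Any.Properties as Any
  open import Data.Nat
  open import Data.Nat.Coprimality as Coprime using (Coprime)
  open import Data.Nat.Divisibility
  open import Data.Nat.Primality
  open import Data.Nat.Properties
  open import Data.Nat.Tactic.RingSolver using (solve-∀)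
  open import Data.Vec as Vec using (Vec; []; _∷_)
  open import Data.Vec.Relation.Binary.Pointwise.Inductive using (Pointwise; []; _∷_)

  prod : ∀ {k} → Vec ℕ k → ℕ
  prod []       = 1
  prod (y ∷ ys) = y * prod ys

  prodFrom≡*prod : ∀ N .{{_ : NonZero N}} {k} c (ys : Vec ℕ k) → prodFrom N c ys ≡ c * prod ys
  prodFrom≡*prod N c []       = sym (*-identityʳ c)
  prodFrom≡*prod N c (y ∷ ys) = trans (prodFrom≡*prod N (c * y) ys) (*-assoc c y (prod ys))

  -- The size c is what enters the union bound; as an index it is computed along with the
  -- construction of the list, and can be estimated without looking into it.
  record Cover (k N c : ℕ) : Set where
    field
      divisors : List (Vec ℕ k)
      size     : length divisors ≡ c
      prod≡N   : All (λ d → prod d ≡ N) divisors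
      covers   : ∀ (ys : Vec ℕ k) → N ∣ prod ys → Any (λ (d : Vec ℕ k) → Pointwise _∣_ d ys) divisors

  open Cover

  χ : ∀ {k} → Vec ℕ k → Vec ℕ k → ℕ
  χ []       []       = 1
  χ (d ∷ ds) (y ∷ ys) = 𝟙 (d ∣? y) * χ ds ys

  χ-∣ : ∀ {k} {ds ys : Vec ℕ k} → Pointwise _∣_ ds ys → 1 ≤ χ ds ys
  χ-∣ []                = ≤-refl
  χ-∣ (d∣y ∷ ds∣ys) = *-mono-≤ (𝟙-yes (_ ∣? _) d∣y) (χ-∣ ds∣ys)

  count-∣ : ∀ {d N} → d ∣ N → Σ< N (λ y → 𝟙 (d ∣? y)) * d ≤ N
  count-∣ {d} (divides-refl l) = *-monoˡ-≤ d (count-blocks l (d ∣?_) spaced)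
    where
    spaced : Spaced d (d ∣_)
    spaced i≤j d∣i d∣j = ∣m+n∣m⇒∣n (subst (d ∣_) (sym (m+[n∸m]≡n i≤j)) d∣j) d∣i

  -- The coordinates are independent, and each d divides N, so that the range of y consists of whole
  -- periods.
  χ-count : ∀ {k N} (ds : Vec ℕ k) → prod ds ∣ N → cubeΣ N k (χ ds) * prod ds ≤ N ^ k
  χ-count             []       ds∣N = ≤-refl
  χ-count {suc k} {N} (d ∷ ds) ds∣N = begin
    Σ< N (λ y → cubeΣ N k λ ys → 𝟙 (d ∣? y) * χ ds ys) * (d * P)
      ≡⟨ cong (_* (d * P)) (Σ-cong N λ y → trans (cubeΣ-* N k (𝟙 (d ∣? y)) (χ ds)) (*-comm _ C)) ⟩
    Σ< N (λ y → C * 𝟙 (d ∣? y)) * (d * P)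
      ≡⟨ cong (_* (d * P)) (Σ-* N C (λ y → 𝟙 (d ∣? y))) ⟩
    C * Σ< N (λ y → 𝟙 (d ∣? y)) * (d * P)
      ≡⟨ rearrange C (Σ< N (λ y → 𝟙 (d ∣? y))) d P ⟩
    Σ< N (λ y → 𝟙 (d ∣? y)) * d * (C * P)
      ≤⟨ *-mono-≤ (count-∣ (m*n∣⇒m∣ d P ds∣N)) (χ-count ds (m*n∣⇒n∣ d P ds∣N)) ⟩
    N * N ^ k ∎
    where
    open ≤-Reasoning
    C P : ℕ
    C = cubeΣ N k (χ ds)
    P = prod ds
    rearrange : ∀ C S d P → C * S * (d * P) ≡ S * d * (C * P)
    rearrange = solve-∀

  hits : ∀ {k} → List (Vec ℕ k) → Vec ℕ k → ℕ
  hits []         ys = 0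
  hits (ds ∷ dss) ys = χ ds ys + hits dss ys

  hits-any : ∀ {k} {dss : List (Vec ℕ k)} {ys} → Any (λ (d : Vec ℕ k) → Pointwise _∣_ d ys) dss → 1 ≤ hits dss ys
  hits-any (here ds∣ys) = ≤-trans (χ-∣ ds∣ys) (m≤m+n _ _)
  hits-any (there any)  = ≤-trans (hits-any any) (m≤n+m _ _)

  hits-count : ∀ {k N} (dss : List (Vec ℕ k)) → All (λ d → prod d ≡ N) dss →
               cubeΣ N k (hits dss) * N ≤ length dss * N ^ k
  hits-count {k} {N} []         []           = ≤-reflexive (cong (_* N) (cubeΣ-0 N k))
  hits-count {k} {N} (ds ∷ dss) (ds≡N ∷ all) = begin
    cubeΣ N k (λ ys → χ ds ys + hits dss ys) * N              ≡⟨ cong (_* N) (cubeΣ-+ N k (χ ds) (hits dss)) ⟩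
    (cubeΣ N k (χ ds) + cubeΣ N k (hits dss)) * N             ≡⟨ *-distribʳ-+ N (cubeΣ N k (χ ds)) _ ⟩
    cubeΣ N k (χ ds) * N + cubeΣ N k (hits dss) * N           ≡⟨ cong (λ n → cubeΣ N k (χ ds) * n + cubeΣ N k (hits dss) * N) ds≡N ⟨
    cubeΣ N k (χ ds) * prod ds + cubeΣ N k (hits dss) * N     ≤⟨ +-mono-≤ (χ-count ds (∣-reflexive ds≡N)) (hits-count dss all) ⟩
    N ^ k + length dss * N ^ k                                ∎
    where open ≤-Reasoning

  -- Union bound: each vector in the cover has product N, hence divides at most a proportion 1/N of
  -- the `ys` componentwise.
  prodZeros-cover : ∀ {k N c} .{{_ : NonZero N}} → Cover k N c → prodZeros N k 1 * N ≤ c * N ^ k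
  prodZeros-cover {k} {N} {c} S = begin
    prodZeros N k 1 * N              ≤⟨ *-monoˡ-≤ N (cubeΣ-mono N k covered) ⟩
    cubeΣ N k (hits (divisors S)) * N  ≤⟨ hits-count (divisors S) (prod≡N S) ⟩
    length (divisors S) * N ^ k      ≡⟨ cong (_* N ^ k) (size S) ⟩
    c * N ^ k                        ∎
    where
    open ≤-Reasoning
    covered : ∀ ys → 𝟙 (N ∣? prodFrom N 1 ys) ≤ hits (divisors S) ys
    covered ys with N ∣? prodFrom N 1 ys
    ... | no  _   = z≤n
    ... | yes N∣y = hits-any (covers S ys (subst (N ∣_) (trans (prodFrom≡*prod N 1 ys) (*-identityˡ _)) N∣y))

  cover-1 : ∀ k → Cover k 1 1
  cover-1 k = record
    { divisors = Vec.replicate k 1 ∷ []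
    ; size     = refl
    ; prod≡N   = prod-1s k ∷ []
    ; covers   = λ ys _ → here (1s∣ ys)
    }
    where
    prod-1s : ∀ k → prod (Vec.replicate k 1) ≡ 1
    prod-1s zero    = refl
    prod-1s (suc k) = trans (*-identityˡ _) (prod-1s k)
    1s∣ : ∀ {k} (ys : Vec ℕ k) → Pointwise _∣_ (Vec.replicate k 1) ys
    1s∣ []       = []
    1s∣ (y ∷ ys) = 1∣ y ∷ 1s∣ ys

  coprime-*-∣ : ∀ {m n o} → Coprime m n → m ∣ o → n ∣ o → m * n ∣ o
  coprime-*-∣ {m} {n} cop (divides-refl q) n∣qm =
    subst (_∣ q * m) (*-comm n m) (*-monoˡ-∣ m (Coprime.coprime-divisor (Coprime.sym cop) (subst (n ∣_) (*-comm q m) n∣qm)))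

  all-any : ∀ {A : Set} {P Q : A → Set} {xs} → All P xs → Any Q xs → Any (λ x → P x × Q x) xs
  all-any (p ∷ _)  (here q)  = here (p , q)
  all-any (_ ∷ ps) (there q) = there (all-any ps q)

  prod-zip : ∀ {k} (xs ys : Vec ℕ k) → prod (Vec.zipWith _*_ xs ys) ≡ prod xs * prod ys
  prod-zip []       []       = refl
  prod-zip (x ∷ xs) (y ∷ ys) = trans (cong (x * y *_) (prod-zip xs ys)) (rearrange x y (prod xs) (prod ys))
    where
    rearrange : ∀ x y p q → x * y * (p * q) ≡ x * p * (y * q)
    rearrange = solve-∀

  zip-∣ : ∀ {k M N} {ss ts ys : Vec ℕ k} → Coprime M N → prod ss ∣ M → prod ts ∣ N →
          Pointwise _∣_ ss ys → Pointwise _∣_ ts ys → Pointwise _∣_ (Vec.zipWith _*_ ss ts) ys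
  zip-∣ cop M N [] [] = []
  zip-∣ {ss = s ∷ ss} {t ∷ ts} cop ss∣M ts∣N (s∣y ∷ ss∣ys) (t∣y ∷ ts∣ys) =
    coprime-*-∣ (λ (d∣s , d∣t) → cop (∣-trans d∣s (m*n∣⇒m∣ s (prod ss) ss∣M) , ∣-trans d∣t (m*n∣⇒m∣ t (prod ts) ts∣N))) s∣y t∣y
    ∷ zip-∣ cop (m*n∣⇒n∣ s (prod ss) ss∣M) (m*n∣⇒n∣ t (prod ts) ts∣N) ss∣ys ts∣ys

  -- If M * N divides the product of `ys`, then each of the two covers has a member dividing `ys`.
  -- Corresponding components divide the coprime numbers M and N, so their product divides the
  -- component of `ys` too.
  cover-* : ∀ {k M N c d} → Coprime M N → Cover k M c → Cover k N d → Cover k (M * N) (c * d)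
  cover-* {k} {M} {N} cop S T = record
    { divisors = cartesianProductWith (Vec.zipWith _*_) (divisors S) (divisors T)
    ; size     = trans (length-product (Vec.zipWith _*_) (divisors S) (divisors T)) (cong₂ _*_ (size S) (size T))
    ; prod≡N   = All.cartesianProductWith⁺ (setoid _) (setoid _) _ (divisors S) (divisors T) λ {s} {t} s∈S t∈T →
        trans (prod-zip s t) (cong₂ _*_ (All.lookup (prod≡N S) s∈S) (All.lookup (prod≡N T) t∈T))
    ; covers   = λ ys MN∣ys → Any.cartesianProductWith⁺ (Vec.zipWith _*_)
        (λ (s≡M , s∣ys) (t≡N , t∣ys) → zip-∣ cop (∣-reflexive s≡M) (∣-reflexive t≡N) s∣ys t∣ys)
        (all-any (prod≡N S) (covers S ys (m*n∣⇒m∣ M N MN∣ys)))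
        (all-any (prod≡N T) (covers T ys (m*n∣⇒n∣ M N MN∣ys)))
    }

  coprime-^ : ∀ {m n} → Coprime m n → ∀ r → Coprime (m ^ r) n
  coprime-^ cop zero    (d∣1 , _)      = ∣1⇒≡1 d∣1
  coprime-^ cop (suc r) (d∣mm^r , d∣n) = coprime-^ cop r
    (Coprime.coprime-divisor (λ (e∣d , e∣m) → cop (e∣m , ∣-trans e∣d d∣n)) d∣mm^r , d∣n)

  prime∤⇒coprime : ∀ {p n} → Prime p → ¬ p ∣ n → Coprime p n
  prime∤⇒coprime p-prime p∤n (d∣p , d∣n) with prime⇒irreducible p-prime d∣p
  ... | inj₁ d≡1  = d≡1
  ... | inj₂ refl = contradiction d∣n p∤n

  -- The number of k-tuples of natural numbers with sum r.
  compositions : ℕ → ℕ → ℕ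
  compositions zero    zero    = 1
  compositions zero    (suc r) = 0
  compositions (suc k) zero    = 1
  compositions (suc k) (suc r) = compositions k (suc r) + compositions (suc k) r

  -- If p does not divide the first coordinate, the whole power divides the product of the others;
  -- if it does, one factor p is split off and the exponent drops. These two cases are the two
  -- summands in the recursion of `compositions`.
  cover-prime^ : ∀ {p} → Prime p → ∀ k r → Cover k (p ^ r) (compositions k r)
  cover-prime^ p-prime zero    zero    = cover-1 0
  cover-prime^ p-prime (suc k) zero    = cover-1 (suc k)
  cover-prime^ {p} p-prime zero (suc r) = record
    { divisors = []
    ; size     = refl
    ; prod≡N   = []
    ; covers   = λ { [] p^[1+r]∣1 → contradiction (subst Prime (∣1⇒≡1 (∣-trans (m∣m*n (p ^ r)) p^[1+r]∣1)) p-prime) ¬prime[1] }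
    }
  cover-prime^ {p} p-prime (suc k) (suc r) = record
    { divisors = List.map (1 ∷_) (divisors S) List.++ List.map mulHead (divisors T)
    ; size     = trans (List.length-++ (List.map (1 ∷_) (divisors S)))
        (cong₂ _+_ (trans (List.length-map (1 ∷_) (divisors S)) (size S)) (trans (List.length-map mulHead (divisors T)) (size T)))
    ; prod≡N   = All.++⁺ (All.map⁺ (All.map (trans (*-identityˡ _)) (prod≡N S)))
        (All.map⁺ (All.map (λ {d} d≡p^r → trans (prod-mulHead d) (cong (p *_) d≡p^r)) (prod≡N T)))
    ; covers   = λ { (y ∷ ys) → cover y ys (p ∣? y) }
    }
    where
    S : Cover k (p ^ suc r) (compositions k (suc r))
    S = cover-prime^ p-prime k (suc r)
    T : Cover (suc k) (p ^ r) (compositions (suc k) r)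
    T = cover-prime^ p-prime (suc k) r
    mulHead : Vec ℕ (suc k) → Vec ℕ (suc k)
    mulHead (d ∷ ds) = p * d ∷ ds
    prod-mulHead : ∀ ds → prod (mulHead ds) ≡ p * prod ds
    prod-mulHead (d ∷ ds) = *-assoc p d (prod ds)
    mulHead-∣ : ∀ {ds y ys} → Pointwise _∣_ ds (y ∷ ys) → Pointwise _∣_ (mulHead ds) (y * p ∷ ys)
    mulHead-∣ {d ∷ ds} {y} (d∣y ∷ ds∣ys) = subst (_∣ y * p) (*-comm d p) (*-monoˡ-∣ p d∣y) ∷ ds∣ys
    cover : ∀ y ys → Dec (p ∣ y) → p ^ suc r ∣ prod (y ∷ ys) →
            Any (λ (d : Vec ℕ (suc k)) → Pointwise _∣_ d (y ∷ ys)) (List.map (1 ∷_) (divisors S) List.++ List.map mulHead (divisors T))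
    cover y ys (no p∤y) p^∣ = Any.++⁺ˡ (Any.map⁺ (Any.map (1∣ y ∷_)
      (covers S ys (Coprime.coprime-divisor (coprime-^ (prime∤⇒coprime p-prime p∤y) (suc r)) p^∣))))
    cover .(y * p) ys (yes (divides-refl y)) p^∣ = Any.++⁺ʳ _ (Any.map⁺ (Any.map mulHead-∣
      (covers T (y ∷ ys) (*-cancelˡ-∣ p {{prime⇒nonZero p-prime}} (subst (p ^ suc r ∣_) (rearrange y p (prod ys)) p^∣)))))
      where
      rearrange : ∀ y p q → y * p * q ≡ p * (y * q)
      rearrange = solve-∀

-- Integer forms of Young's inequality and the inequality of means, and the cost of the telescoped
-- product

module Inequalities where

  open import Data.Nat
  open import Data.Nat.Properties
  open import Data.Nat.Tactic.RingSolver using (solve-∀)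

  ^-distribʳ-* : ∀ m n k → (m * n) ^ k ≡ m ^ k * n ^ k
  ^-distribʳ-* m n zero    = refl
  ^-distribʳ-* m n (suc k) = trans (cong (m * n *_) (^-distribʳ-* m n k)) (rearrange m n (m ^ k) (n ^ k))
    where
    rearrange : ∀ m n p q → m * n * (p * q) ≡ m * p * (n * q)
    rearrange = solve-∀

  ^-comm : ∀ m n k → (m ^ n) ^ k ≡ (m ^ k) ^ n
  ^-comm m n k = trans (^-*-assoc m n k) (trans (cong (m ^_) (*-comm n k)) (sym (^-*-assoc m k n)))

  ^-cancelˡ-≤ : ∀ {m n} k .{{_ : NonZero k}} → m ^ k ≤ n ^ k → m ≤ n
  ^-cancelˡ-≤ k m^k≤n^k = ≮⇒≥ λ n<m → <⇒≱ (^-monoˡ-< k n<m) m^k≤n^k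

  cross-≤ : ∀ {a b c d} → a ≤ b → c ≤ d → a * d + b * c ≤ a * c + b * d
  cross-≤ {a} {b} {c} {d} a≤b c≤d = subst₂ (λ b d → a * d + b * c ≤ a * c + b * d) (m+[n∸m]≡n a≤b) (m+[n∸m]≡n c≤d)
    (subst (a * (c + (d ∸ c)) + (a + (b ∸ a)) * c ≤_) (expand a (b ∸ a) c (d ∸ c)) (m≤m+n _ ((b ∸ a) * (d ∸ c))))
    where
    expand : ∀ a b c d → a * (c + d) + (a + b) * c + b * d ≡ a * c + (a + b) * (c + d)
    expand = solve-∀

  -- Young's inequality with integer exponents. The induction step multiplies by z; what is left to
  -- show is the rearrangement inequality, since z, w are ordered like their powers.
  young : ∀ n z w → suc n * (z ^ n * w) ≤ w ^ suc n + n * z ^ suc n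
  young zero    z w = ≤-reflexive (eq w)
    where
    eq : ∀ w → 1 * (1 * w) ≡ w * 1 + 0
    eq = solve-∀
  young (suc n) z w = begin
    suc (suc n) * (z * zⁿ * w)                           ≡⟨ eq₁ n z zⁿ w ⟩
    z * (suc n * (zⁿ * w)) + z * zⁿ * w                  ≤⟨ +-monoˡ-≤ _ (*-monoʳ-≤ z (young n z w)) ⟩
    z * (w * wⁿ + n * (z * zⁿ)) + z * zⁿ * w             ≡⟨ eq₂ n z zⁿ w wⁿ ⟩
    z * (w * wⁿ) + w * (z * zⁿ) + n * (z * (z * zⁿ))     ≤⟨ +-monoˡ-≤ _ swap ⟩
    z * (z * zⁿ) + w * (w * wⁿ) + n * (z * (z * zⁿ))     ≡⟨ eq₃ n (z * (z * zⁿ)) (w * (w * wⁿ)) ⟩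
    w * (w * wⁿ) + suc n * (z * (z * zⁿ))                ∎
    where
    open ≤-Reasoning
    zⁿ wⁿ : ℕ
    zⁿ = z ^ n
    wⁿ = w ^ n
    swap : z * (w * wⁿ) + w * (z * zⁿ) ≤ z * (z * zⁿ) + w * (w * wⁿ)
    swap with ≤-total z w
    ... | inj₁ z≤w = cross-≤ z≤w (^-monoˡ-≤ (suc n) z≤w)
    ... | inj₂ w≤z = subst₂ _≤_ (+-comm (w * (z * zⁿ)) _) (+-comm (w * (w * wⁿ)) _) (cross-≤ w≤z (^-monoˡ-≤ (suc n) w≤z))
    eq₁ : ∀ n z q w → suc (suc n) * (z * q * w) ≡ z * (suc n * (q * w)) + z * q * w
    eq₁ = solve-∀
    eq₂ : ∀ n z q w r → z * (w * r + n * (z * q)) + z * q * w ≡ z * (w * r) + w * (z * q) + n * (z * (z * q))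
    eq₂ = solve-∀
    eq₃ : ∀ n p q → p + q + n * p ≡ q + (p + n * p)
    eq₃ = solve-∀

  -- For the means z = S/n and w = (S+x)/(n+1), Young's inequality says z^n·((n+1)w - nz) ≤ w^(n+1),
  -- and (n+1)w - nz = x. The proof uses n(n+1) times these means to stay in ℕ.
  am-gm-step : ∀ n S x → suc n ^ suc n * (S ^ n * x) ≤ n ^ n * (S + x) ^ suc n
  am-gm-step zero    S x = subst₂ _≤_ (sym (eq x)) (sym (eq′ (S + x))) (m≤n+m x S)
    where
    eq : ∀ x → 1 * (1 * x) ≡ x
    eq = solve-∀
    eq′ : ∀ x → 1 * (x * 1) ≡ x
    eq′ = solve-∀
  am-gm-step n@(suc _) S x = *-cancelˡ-≤ n (+-cancelʳ-≤ (n * z ^ suc n) _ _ (begin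
    n * (suc n ^ suc n * (S ^ n * x)) + n * (z * z ^ n)
      ≡⟨ cong (λ zⁿ → n * (suc n ^ suc n * (S ^ n * x)) + n * (z * zⁿ)) (^-distribʳ-* (suc n) S n) ⟩
    n * (suc n * q * (s * x)) + n * (suc n * S * (q * s))  ≡⟨ eq₁ n q s x S ⟩
    suc n * (q * s * (n * (S + x)))                        ≡⟨ cong (λ zⁿ → suc n * (zⁿ * w)) (^-distribʳ-* (suc n) S n) ⟨
    suc n * (z ^ n * w)                                    ≤⟨ young n z w ⟩
    w ^ suc n + n * z ^ suc n                              ≡⟨ cong (_+ n * z ^ suc n) (^-distribʳ-* n (S + x) (suc n)) ⟩
    n * n ^ n * (S + x) ^ suc n + n * z ^ suc n            ≡⟨ cong (_+ n * z ^ suc n) (*-assoc n (n ^ n) _) ⟩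
    n * (n ^ n * (S + x) ^ suc n) + n * z ^ suc n          ∎))
    where
    open ≤-Reasoning
    z w q s : ℕ
    z = suc n * S
    w = n * (S + x)
    q = suc n ^ n
    s = S ^ n
    eq₁ : ∀ n q s x S → n * ((1 + n) * q * (s * x)) + n * ((1 + n) * S * (q * s)) ≡ (1 + n) * (q * s * (n * (S + x)))
    eq₁ = solve-∀

  n^n≢0 : ∀ n → NonZero (n ^ n)
  n^n≢0 zero      = nonZero
  n^n≢0 n@(suc _) = m^n≢0 n n

  am-gm : ∀ m n x y → x ^ m * y ^ n * (m + n) ^ (m + n) ≤ (m * x + n * y) ^ (m + n)
  am-gm zero    zero    x y = ≤-refl
  am-gm zero    (suc n) x y = *-cancelˡ-≤ (n ^ n) {{n^n≢0 n}} (begin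
    n ^ n * (1 * (y * y ^ n) * suc n ^ suc n)        ≡⟨ eq (n ^ n) y (y ^ n) (suc n ^ suc n) ⟩
    suc n ^ suc n * (1 * y ^ n * n ^ n * y)          ≤⟨ *-monoʳ-≤ (suc n ^ suc n) (*-monoˡ-≤ y (am-gm zero n x y)) ⟩
    suc n ^ suc n * ((n * y) ^ n * y)                ≤⟨ am-gm-step n (n * y) y ⟩
    n ^ n * (n * y + y) ^ suc n                      ≡⟨ cong (λ S → n ^ n * S ^ suc n) (+-comm (n * y) y) ⟩
    n ^ n * (suc n * y) ^ suc n                      ∎)
    where
    open ≤-Reasoning
    eq : ∀ a y q t → a * (1 * (y * q) * t) ≡ t * (1 * q * a * y)
    eq = solve-∀
  am-gm (suc m) n       x y = *-cancelˡ-≤ (t ^ t) {{n^n≢0 t}} (begin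
    t ^ t * (x * x ^ m * y ^ n * suc t ^ suc t)      ≡⟨ eq (t ^ t) x (x ^ m) (y ^ n) (suc t ^ suc t) ⟩
    suc t ^ suc t * (x ^ m * y ^ n * t ^ t * x)      ≤⟨ *-monoʳ-≤ (suc t ^ suc t) (*-monoˡ-≤ x (am-gm m n x y)) ⟩
    suc t ^ suc t * (S ^ t * x)                      ≤⟨ am-gm-step t S x ⟩
    t ^ t * (S + x) ^ suc t                          ≡⟨ cong (λ S → t ^ t * S ^ suc t) (eq′ m n x y) ⟩
    t ^ t * (suc m * x + n * y) ^ suc t              ∎)
    where
    open ≤-Reasoning
    t S : ℕ
    t = m + n
    S = m * x + n * y
    eq : ∀ a x p q t → a * (x * p * q * t) ≡ t * (p * q * a * x)
    eq = solve-∀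
    eq′ : ∀ m n x y → m * x + n * y + x ≡ (1 + m) * x + n * y
    eq′ = solve-∀

  m*m≤2^m : ∀ m → 4 ≤ m → m * m ≤ 2 ^ m
  m*m≤2^m m 4≤m = subst (λ m → m * m ≤ 2 ^ m) (m+[n∸m]≡n 4≤m) (go (m ∸ 4))
    where
    open ≤-Reasoning
    eq : ∀ d → (5 + d) * (5 + d) + (7 + 6 * d + d * d) ≡ 2 * ((4 + d) * (4 + d))
    eq = solve-∀
    go : ∀ d → (4 + d) * (4 + d) ≤ 2 ^ (4 + d)
    go zero    = ≤-refl
    go (suc d) = begin
      (4 + suc d) * (4 + suc d)               ≡⟨ cong (λ n → n * n) (+-suc 4 d) ⟩
      (5 + d) * (5 + d)                       ≤⟨ m≤m+n _ _ ⟩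
      (5 + d) * (5 + d) + (7 + 6 * d + d * d) ≡⟨ eq d ⟩
      2 * ((4 + d) * (4 + d))                 ≤⟨ *-monoʳ-≤ 2 (go d) ⟩
      2 ^ (5 + d)                             ≡⟨ cong (2 ^_) (+-suc 4 d) ⟨
      2 ^ (4 + suc d)                         ∎

  -- With H = `suc h`, this yields the constant 15/8 for H² against the least P with ⌈log₂ P⌉ = H.
  -- It is tight at H = 3, where 72 ≤ 75, and without the summand 1 on the right it fails for H = 2,
  -- 3, 4. From H = 5 on, doubling outgrows the square.
  8h²≤15[1+2^[h-1]] : ∀ h → 8 * (suc h * suc h) ≤ 15 * suc (2 ^ h)
  8h²≤15[1+2^[h-1]] 0 = m≤m+n 8 22
  8h²≤15[1+2^[h-1]] 1 = m≤m+n 32 13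
  8h²≤15[1+2^[h-1]] 2 = m≤m+n 72 3
  8h²≤15[1+2^[h-1]] 3 = m≤m+n 128 7
  8h²≤15[1+2^[h-1]] (suc (suc (suc (suc d)))) = ≤-trans (go d) (*-monoʳ-≤ 15 (n≤1+n (2 ^ (4 + d))))
    where
    open ≤-Reasoning
    eq : ∀ d → 8 * ((6 + d) * (6 + d)) + 8 * (14 + 8 * d + d * d) ≡ 2 * (8 * ((5 + d) * (5 + d)))
    eq = solve-∀
    eq′ : ∀ p → 2 * (15 * p) ≡ 15 * (2 * p)
    eq′ = solve-∀
    go : ∀ d → 8 * ((5 + d) * (5 + d)) ≤ 15 * 2 ^ (4 + d)
    go zero    = m≤m+n 200 40
    go (suc d) = begin
      8 * ((5 + suc d) * (5 + suc d))         ≡⟨ cong (λ n → 8 * (n * n)) (+-suc 5 d) ⟩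
      8 * ((6 + d) * (6 + d))                 ≤⟨ m≤m+n _ _ ⟩
      8 * ((6 + d) * (6 + d)) + 8 * (14 + 8 * d + d * d) ≡⟨ eq d ⟩
      2 * (8 * ((5 + d) * (5 + d)))           ≤⟨ *-monoʳ-≤ 2 (go d) ⟩
      2 * (15 * 2 ^ (4 + d))                  ≡⟨ eq′ (2 ^ (4 + d)) ⟩
      15 * 2 ^ (5 + d)                        ≡⟨ cong (λ n → 15 * 2 ^ n) (+-suc 4 d) ⟨
      15 * 2 ^ (4 + suc d)                    ∎

  ⌈log₂⌉-1 : ∀ n → 2 ≤ n → ∃ λ h → 2 ^ h < n × n ≤ 2 ^ suc h
  ⌈log₂⌉-1 (suc zero)          (s≤s ())
  ⌈log₂⌉-1 (suc (suc zero))    _ = 0 , ≤-refl , ≤-refl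
  ⌈log₂⌉-1 (suc n@(suc (suc _))) _ with ⌈log₂⌉-1 n (s≤s (s≤s z≤n))
  ... | h , 2^h<n , n≤2^[1+h] with n <? 2 ^ suc h
  ...   | yes n< = h , m<n⇒m<1+n 2^h<n , n<
  ...   | no  n≮ = suc h , s≤s (≮⇒≥ n≮) , (begin
    suc n             ≤⟨ +-mono-≤ {1} {n} (s≤s z≤n) ≤-refl ⟩
    n + n             ≤⟨ +-mono-≤ n≤2^[1+h] n≤2^[1+h] ⟩
    2 ^ suc h + 2 ^ suc h   ≡⟨ cong (2 ^ suc h +_) (sym (+-identityʳ _)) ⟩
    2 ^ suc (suc h)   ∎)
    where open ≤-Reasoning

  -- ((a+b)/b)^((a+b)/a) is increasing in a/b; the next two lemmas bound it by its value at a/b = 1 and 3.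
  [a+b]^[a+b]≤-a≤b : ∀ {a b} → a ≤ b → (a + b) ^ (a + b) ≤ 2 ^ (2 * a) * b ^ (a + b)
  [a+b]^[a+b]≤-a≤b {a} {b} a≤b = *-cancelˡ-≤ (2 ^ d) {{m^n≢0 2 d}} (begin
    2 ^ d * s ^ s                          ≡⟨ cong (_* s ^ s) (*-identityˡ (2 ^ d)) ⟨
    1 * 2 ^ d * s ^ s                      ≡⟨ cong₂ (λ p t → p * 2 ^ d * t ^ t) (^-zeroˡ (2 * a)) 2a+d≡s ⟨
    1 ^ (2 * a) * 2 ^ d * (2 * a + d) ^ (2 * a + d)   ≤⟨ am-gm (2 * a) d 1 2 ⟩
    (2 * a * 1 + d * 2) ^ (2 * a + d)      ≡⟨ cong₂ _^_ (trans (eq₂ a d) (cong (2 *_) a+d≡b)) 2a+d≡s ⟩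
    (2 * b) ^ s                            ≡⟨ ^-distribʳ-* 2 b s ⟩
    2 ^ s * b ^ s                          ≡⟨ cong (λ t → 2 ^ t * b ^ s) (trans (+-comm d (2 * a)) 2a+d≡s) ⟨
    2 ^ (d + 2 * a) * b ^ s                ≡⟨ cong (_* b ^ s) (^-distribˡ-+-* 2 d (2 * a)) ⟩
    2 ^ d * 2 ^ (2 * a) * b ^ s            ≡⟨ *-assoc (2 ^ d) _ _ ⟩
    2 ^ d * (2 ^ (2 * a) * b ^ s)          ∎)
    where
    open ≤-Reasoning
    d s : ℕ
    d = b ∸ a
    s = a + b
    a+d≡b : a + d ≡ b
    a+d≡b = m+[n∸m]≡n a≤b
    eq₁ : ∀ a d → 2 * a + d ≡ a + (a + d)
    eq₁ = solve-∀
    eq₂ : ∀ a d → 2 * a * 1 + d * 2 ≡ 2 * (a + d)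
    eq₂ = solve-∀
    2a+d≡s : 2 * a + d ≡ s
    2a+d≡s = trans (eq₁ a d) (cong (a +_) a+d≡b)

  [a+b]^[a+b]≤-a≤3b : ∀ {a b} → a ≤ 3 * b → (a + b) ^ (3 * (a + b)) ≤ 2 ^ (8 * a) * b ^ (3 * (a + b))
  [a+b]^[a+b]≤-a≤3b {a} {b} a≤3b = *-cancelˡ-≤ (4 ^ d * 3 ^ t) {{m*n≢0 (4 ^ d) (3 ^ t) {{m^n≢0 4 d}} {{m^n≢0 3 t}}}} (begin
    4 ^ d * 3 ^ t * s ^ t                  ≡⟨ *-assoc (4 ^ d) (3 ^ t) (s ^ t) ⟩
    4 ^ d * (3 ^ t * s ^ t)                ≡⟨ cong (4 ^ d *_) (^-distribʳ-* 3 s t) ⟨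
    4 ^ d * t ^ t                          ≡⟨ cong (_* t ^ t) (*-identityˡ (4 ^ d)) ⟨
    1 * 4 ^ d * t ^ t                      ≡⟨ cong₂ (λ p t → p * 4 ^ d * t ^ t) (^-zeroˡ (4 * a)) 4a+d≡t ⟨
    1 ^ (4 * a) * 4 ^ d * (4 * a + d) ^ (4 * a + d)   ≤⟨ am-gm (4 * a) d 1 4 ⟩
    (4 * a * 1 + d * 4) ^ (4 * a + d)      ≡⟨ cong₂ _^_ (trans (eq₂ a d) (cong (4 *_) a+d≡3b)) 4a+d≡t ⟩
    (4 * (3 * b)) ^ t                      ≡⟨ ^-distribʳ-* 4 (3 * b) t ⟩
    4 ^ t * (3 * b) ^ t                    ≡⟨ cong₂ (λ u p → 4 ^ u * p) (trans (+-comm d (4 * a)) 4a+d≡t) (sym (^-distribʳ-* 3 b t)) ⟨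
    4 ^ (d + 4 * a) * (3 ^ t * b ^ t)      ≡⟨ cong (_* (3 ^ t * b ^ t)) (^-distribˡ-+-* 4 d (4 * a)) ⟩
    4 ^ d * 4 ^ (4 * a) * (3 ^ t * b ^ t)  ≡⟨ eq₃ (4 ^ d) (4 ^ (4 * a)) (3 ^ t) (b ^ t) ⟩
    4 ^ d * 3 ^ t * (4 ^ (4 * a) * b ^ t)  ≡⟨ cong (λ p → 4 ^ d * 3 ^ t * (p * b ^ t)) (trans (^-*-assoc 2 2 (4 * a)) (cong (2 ^_) (eq₄ a))) ⟩
    4 ^ d * 3 ^ t * (2 ^ (8 * a) * b ^ t)  ∎)
    where
    open ≤-Reasoning
    d s t : ℕ
    d = 3 * b ∸ a
    s = a + b
    t = 3 * s
    a+d≡3b : a + d ≡ 3 * b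
    a+d≡3b = m+[n∸m]≡n a≤3b
    eq₁ : ∀ a d → 4 * a + d ≡ 3 * a + (a + d)
    eq₁ = solve-∀
    eq₂ : ∀ a d → 4 * a * 1 + d * 4 ≡ 4 * (a + d)
    eq₂ = solve-∀
    eq₃ : ∀ p q r s → p * q * (r * s) ≡ p * r * (q * s)
    eq₃ = solve-∀
    eq₄ : ∀ a → 2 * (4 * a) ≡ 8 * a
    eq₄ = solve-∀
    4a+d≡t : 4 * a + d ≡ t
    4a+d≡t = trans (eq₁ a d) (trans (cong (3 * a +_) a+d≡3b) (sym (*-distribˡ-+ 3 a b)))

  -- For H = ⌈log₂ P⌉ the hypotheses give 2^(a+b) ≤ (2μ)^a ≤ P^a ≤ 2^(aH). Hence P^(a+b) ≤
  -- 2^(H(a+b)) ≤ 2^(aH²), and H² is at most (15/8)P.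
  ^[a+b]≤ : ∀ {a b μ P} → 2 ≤ P → 2 ^ b ≤ μ ^ a → 2 * μ ≤ P → P ^ (8 * (a + b)) ≤ 2 ^ (15 * (a * P))
  ^[a+b]≤ {a} {b} {μ} {P} 2≤P 2^b≤μ^a 2μ≤P with ⌈log₂⌉-1 P 2≤P
  ... | h , 2^h<P , P≤2^H = begin
    P ^ (8 * (a + b))                ≡⟨ trans (cong (P ^_) (*-comm 8 (a + b))) (sym (^-*-assoc P (a + b) 8)) ⟩
    (P ^ (a + b)) ^ 8                ≤⟨ ^-monoˡ-≤ 8 P^[a+b]≤ ⟩
    (2 ^ (H * a * H)) ^ 8            ≡⟨ trans (^-*-assoc 2 (H * a * H) 8) (cong (2 ^_) (eq₁ a H)) ⟩
    2 ^ (a * (8 * (H * H)))          ≤⟨ ^-monoʳ-≤ 2 (*-monoʳ-≤ a (≤-trans (8h²≤15[1+2^[h-1]] h) (*-monoʳ-≤ 15 2^h<P))) ⟩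
    2 ^ (a * (15 * P))               ≡⟨ cong (2 ^_) (eq₂ a P) ⟩
    2 ^ (15 * (a * P))               ∎
    where
    open ≤-Reasoning
    H : ℕ
    H = suc h
    eq₁ : ∀ a H → H * a * H * 8 ≡ a * (8 * (H * H))
    eq₁ = solve-∀
    eq₂ : ∀ a P → a * (15 * P) ≡ 15 * (a * P)
    eq₂ = solve-∀
    P^[a+b]≤ : P ^ (a + b) ≤ 2 ^ (H * a * H)
    P^[a+b]≤ = begin
      P ^ (a + b)                    ≤⟨ ^-monoˡ-≤ (a + b) P≤2^H ⟩
      (2 ^ H) ^ (a + b)              ≡⟨ ^-comm 2 H (a + b) ⟩
      (2 ^ (a + b)) ^ H              ≡⟨ cong (_^ H) (^-distribˡ-+-* 2 a b) ⟩
      (2 ^ a * 2 ^ b) ^ H            ≤⟨ ^-monoˡ-≤ H (*-monoʳ-≤ (2 ^ a) 2^b≤μ^a) ⟩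
      (2 ^ a * μ ^ a) ^ H            ≡⟨ cong (_^ H) (^-distribʳ-* 2 μ a) ⟨
      ((2 * μ) ^ a) ^ H              ≤⟨ ^-monoˡ-≤ H (^-monoˡ-≤ a (≤-trans 2μ≤P P≤2^H)) ⟩
      ((2 ^ H) ^ a) ^ H              ≡⟨ cong (_^ H) (^-*-assoc 2 H a) ⟩
      (2 ^ (H * a)) ^ H              ≡⟨ ^-*-assoc 2 (H * a) H ⟩
      2 ^ (H * a * H)                ∎

  module _ {a b μ P : ℕ} (2^b≤μ^a : 2 ^ b ≤ μ ^ a) (2μ≤P : 2 * μ ≤ P) (4≤P : 4 ≤ P) where

    private
      s : ℕ
      s = a + b

    -- In units of aP/s, the logarithms of (s/b)^n and P add up to at most 2 + 15/8 = 93/24 if a ≤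
    -- b, and to 8/3 + 1 = 88/24 if b ≤ a ≤ 3b. In the second case the bound for P comes from s ≤ 2a
    -- and P² ≤ 2^P.
    small-cost : a ≤ 3 * b → ∀ {n} → n ≤ P → (s ^ n * P) ^ (24 * s) ≤ (b ^ n) ^ (24 * s) * 2 ^ (93 * (a * P))
    small-cost a≤3b {n} n≤P = begin
      (s ^ n * P) ^ (24 * s)                   ≡⟨ ^-distribʳ-* (s ^ n) P (24 * s) ⟩
      (s ^ n) ^ (24 * s) * P ^ (24 * s)        ≤⟨ bound (≤-total a b) ⟩
      (b ^ n) ^ (24 * s) * 2 ^ (93 * (a * P))  ∎
      where
      open ≤-Reasoning
      an≤aP : a * n ≤ a * P
      an≤aP = *-monoʳ-≤ a n≤P
      combine : ∀ {x} y e f g → x ≤ 2 ^ e * y → P ^ (24 * s) ≤ 2 ^ f → e + f ≤ g → x * P ^ (24 * s) ≤ y * 2 ^ g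
      combine {x} y e f g x≤ P≤ e+f≤g = begin
        x * P ^ (24 * s)      ≤⟨ *-mono-≤ x≤ P≤ ⟩
        2 ^ e * y * 2 ^ f     ≡⟨ rearrange (2 ^ e) y (2 ^ f) ⟩
        y * (2 ^ e * 2 ^ f)   ≡⟨ cong (y *_) (^-distribˡ-+-* 2 e f) ⟨
        y * 2 ^ (e + f)       ≤⟨ *-monoʳ-≤ y (^-monoʳ-≤ 2 e+f≤g) ⟩
        y * 2 ^ g             ∎
        where
        rearrange : ∀ e y f → e * y * f ≡ y * (e * f)
        rearrange = solve-∀
      raise : ∀ e t j → 24 * s ≡ t * j → s ^ t ≤ 2 ^ e * b ^ t → (s ^ n) ^ (24 * s) ≤ 2 ^ (e * (n * j)) * (b ^ n) ^ (24 * s)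
      raise e t j 24s≡tj s^t≤ = begin
        (s ^ n) ^ (24 * s)                     ≡⟨ to s ⟩
        (s ^ t) ^ (n * j)                      ≤⟨ ^-monoˡ-≤ (n * j) s^t≤ ⟩
        (2 ^ e * b ^ t) ^ (n * j)              ≡⟨ ^-distribʳ-* (2 ^ e) (b ^ t) (n * j) ⟩
        (2 ^ e) ^ (n * j) * (b ^ t) ^ (n * j)  ≡⟨ cong₂ _*_ (^-*-assoc 2 e (n * j)) (sym (to b)) ⟩
        2 ^ (e * (n * j)) * (b ^ n) ^ (24 * s) ∎
        where
        assoc : ∀ n t j → n * (t * j) ≡ t * (n * j)
        assoc = solve-∀
        to : ∀ x → (x ^ n) ^ (24 * s) ≡ (x ^ t) ^ (n * j)
        to x = trans (^-*-assoc x n (24 * s)) (trans (cong (x ^_) (trans (cong (n *_) 24s≡tj) (assoc n t j))) (sym (^-*-assoc x t (n * j))))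
      bound : a ≤ b ⊎ b ≤ a → (s ^ n) ^ (24 * s) * P ^ (24 * s) ≤ (b ^ n) ^ (24 * s) * 2 ^ (93 * (a * P))
      bound (inj₁ a≤b) = combine ((b ^ n) ^ (24 * s)) (2 * a * (n * 24)) (45 * (a * P)) _
        (raise (2 * a) s 24 (*-comm 24 s) ([a+b]^[a+b]≤-a≤b a≤b))
        P^24s≤
        (≤-trans (≤-reflexive (eq₁ a n (a * P))) (≤-trans (+-monoˡ-≤ _ (*-monoʳ-≤ 48 an≤aP)) (≤-reflexive (eq₂ (a * P)))))
        where
        eq₁ : ∀ a n p → 2 * a * (n * 24) + 45 * p ≡ 48 * (a * n) + 45 * p
        eq₁ = solve-∀
        eq₂ : ∀ p → 48 * p + 45 * p ≡ 93 * p
        eq₂ = solve-∀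
        eq₃ : ∀ s → 24 * s ≡ 8 * s * 3
        eq₃ = solve-∀
        eq₄ : ∀ p → 15 * p * 3 ≡ 45 * p
        eq₄ = solve-∀
        P^24s≤ : P ^ (24 * s) ≤ 2 ^ (45 * (a * P))
        P^24s≤ = begin
          P ^ (24 * s)             ≡⟨ trans (cong (P ^_) (eq₃ s)) (sym (^-*-assoc P (8 * s) 3)) ⟩
          (P ^ (8 * s)) ^ 3        ≤⟨ ^-monoˡ-≤ 3 (^[a+b]≤ {a} {b} {μ} (≤-trans (s≤s (s≤s z≤n)) 4≤P) 2^b≤μ^a 2μ≤P) ⟩
          (2 ^ (15 * (a * P))) ^ 3 ≡⟨ trans (^-*-assoc 2 (15 * (a * P)) 3) (cong (2 ^_) (eq₄ (a * P))) ⟩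
          2 ^ (45 * (a * P))       ∎
      bound (inj₂ b≤a) = combine ((b ^ n) ^ (24 * s)) (8 * a * (n * 8)) (24 * (a * P)) _
        (raise (8 * a) (3 * s) 8 (eq₃ s) ([a+b]^[a+b]≤-a≤3b a≤3b))
        P^24s≤
        (≤-trans (≤-reflexive (eq₁ a n (a * P))) (≤-trans (+-monoˡ-≤ _ (*-monoʳ-≤ 64 an≤aP))
          (≤-trans (≤-reflexive (eq₂ (a * P))) (*-monoˡ-≤ (a * P) (m≤m+n 88 5)))))
        where
        eq₁ : ∀ a n p → 8 * a * (n * 8) + 24 * p ≡ 64 * (a * n) + 24 * p
        eq₁ = solve-∀
        eq₂ : ∀ p → 64 * p + 24 * p ≡ 88 * p
        eq₂ = solve-∀
        eq₃ : ∀ s → 24 * s ≡ 3 * s * 8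
        eq₃ = solve-∀
        eq₄ : ∀ a → 24 * (a + a) ≡ 2 * (24 * a)
        eq₄ = solve-∀
        eq₅ : ∀ a p → p * (24 * a) ≡ 24 * (a * p)
        eq₅ = solve-∀
        instance
          P≢0 : NonZero P
          P≢0 = >-nonZero (≤-trans (s≤s z≤n) 4≤P)
        P^24s≤ : P ^ (24 * s) ≤ 2 ^ (24 * (a * P))
        P^24s≤ = begin
          P ^ (24 * (a + b))       ≤⟨ ^-monoʳ-≤ P (*-monoʳ-≤ 24 (+-monoʳ-≤ a b≤a)) ⟩
          P ^ (24 * (a + a))       ≡⟨ trans (cong (P ^_) (eq₄ a)) (sym (^-*-assoc P 2 (24 * a))) ⟩
          (P * (P * 1)) ^ (24 * a) ≡⟨ cong (λ Q → (P * Q) ^ (24 * a)) (*-identityʳ P) ⟩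
          (P * P) ^ (24 * a)       ≤⟨ ^-monoˡ-≤ (24 * a) (m*m≤2^m P 4≤P) ⟩
          (2 ^ P) ^ (24 * a)       ≡⟨ trans (^-*-assoc 2 P (24 * a)) (cong (2 ^_) (eq₅ a P)) ⟩
          2 ^ (24 * (a * P))       ∎

-- The number of factorisations of N

module CoverSize where

  open Covers
  open Inequalities
  open import Data.Nat
  open import Data.Nat.Divisibility
  open import Data.Nat.DivMod using (m≡m%n+[m/n]*n; m/n*n≤m; m%n<n)
  open import Data.Nat.Induction using (<-rec)
  open import Data.Nat.Primality
  open import Data.Nat.Properties
  open import Data.Nat.Tactic.RingSolver using (solve-∀)

  module _ {b P : ℕ} .{{_ : NonZero b}} where

    -- For x = (a+b)/(2b) = 2 + d/(2b), where a = 3b + d, this is log₂ x ≤ x - 1. It is the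
    -- inequality of means for 2b copies of a+b and d copies of 2b, whose mean is exactly 4b.
    [a+b]^2b≤ : ∀ d → (3 * b + d + b) ^ (2 * b) ≤ 2 ^ (2 * b + d) * (2 * b) ^ (2 * b)
    [a+b]^2b≤ d = *-cancelʳ-≤ _ _ ((2 * b) ^ d) {{m^n≢0 (2 * b) d {{m*n≢0 2 b}}}}
      (*-cancelʳ-≤ _ _ (t ^ t) {{n^n≢0 t}} (begin
      s ^ (2 * b) * (2 * b) ^ d * t ^ t                  ≤⟨ am-gm (2 * b) d s (2 * b) ⟩
      (2 * b * s + d * (2 * b)) ^ t                      ≡⟨ cong (_^ t) (eq₁ b d) ⟩
      (2 * (2 * b) * t) ^ t                              ≡⟨ trans (^-distribʳ-* (2 * (2 * b)) t t) (cong (_* t ^ t) (^-distribʳ-* 2 (2 * b) t)) ⟩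
      2 ^ t * (2 * b) ^ t * t ^ t                        ≡⟨ cong (λ p → 2 ^ t * p * t ^ t) (^-distribˡ-+-* (2 * b) (2 * b) d) ⟩
      2 ^ t * ((2 * b) ^ (2 * b) * (2 * b) ^ d) * t ^ t  ≡⟨ cong (_* t ^ t) (*-assoc (2 ^ t) _ _) ⟨
      2 ^ t * (2 * b) ^ (2 * b) * (2 * b) ^ d * t ^ t    ∎))
      where
      open ≤-Reasoning
      s t : ℕ
      s = 3 * b + d + b
      t = 2 * b + d
      eq₁ : ∀ b d → 2 * b * (3 * b + d + b) + d * (2 * b) ≡ 2 * (2 * b) * (2 * b + d)
      eq₁ = solve-∀

    -- Split (2s/b)^l into 4^l and (s/(2b))^l. Together with 4^h the powers of 4 cost at most 4^P.
    -- Since ls ≤ 2b(P+1) and s ≥ 2b, the s-th power of the rest is at most 2^((2b+d)(P+1)) by the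
    -- previous lemma.
    large-cost : ∀ {a} → 3 * b ≤ a → 2 ≤ P → ∀ {l h} → l * (a + b) ≤ 2 * b * suc P → l + h ≤ P →
      ((2 * (a + b)) ^ l * 4 ^ h) ^ (24 * (a + b)) ≤ (b ^ l) ^ (24 * (a + b)) * 2 ^ (93 * (a * P))
    large-cost 3b≤a 2≤P {l} {h} ls≤ l+h≤P with m≤n⇒∃[o]m+o≡n 3b≤a
    ... | d , refl = begin
      ((2 * s) ^ l * 4 ^ h) ^ (24 * s)                        ≡⟨ trans (cong (X ^_) (*-comm 24 s)) (sym (^-*-assoc X s 24)) ⟩
      (((2 * s) ^ l * 4 ^ h) ^ s) ^ 24                        ≤⟨ ^-monoˡ-≤ 24 step ⟩
      (2 ^ e * (b ^ l) ^ s) ^ 24                              ≡⟨ ^-distribʳ-* (2 ^ e) _ 24 ⟩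
      (2 ^ e) ^ 24 * ((b ^ l) ^ s) ^ 24                       ≡⟨ *-comm ((2 ^ e) ^ 24) _ ⟩
      ((b ^ l) ^ s) ^ 24 * (2 ^ e) ^ 24                       ≡⟨ cong₂ _*_ (trans (^-*-assoc (b ^ l) s 24) (cong ((b ^ l) ^_) (*-comm s 24))) (^-*-assoc 2 e 24) ⟩
      (b ^ l) ^ (24 * s) * 2 ^ (e * 24)                       ≤⟨ *-monoʳ-≤ ((b ^ l) ^ (24 * s)) (^-monoʳ-≤ 2 e*24≤) ⟩
      (b ^ l) ^ (24 * s) * 2 ^ (93 * ((3 * b + d) * P))       ∎
      where
      open ≤-Reasoning
      s r t e X : ℕ
      s = 3 * b + d + b
      r = 2 * b * suc P ∸ l * s
      t = 2 * b + d
      e = 2 * (s * (l + h)) + t * suc P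
      X = (2 * s) ^ l * 4 ^ h
      ls+r : l * s + r ≡ 2 * b * suc P
      ls+r = m+[n∸m]≡n ls≤
      2b≤s : 2 * b ≤ s
      2b≤s = subst (2 * b ≤_) (eq b d) (m≤m+n (2 * b) (2 * b + d))
        where
        eq : ∀ b d → 2 * b + (2 * b + d) ≡ 3 * b + d + b
        eq = solve-∀
      s^ls≤ : s ^ (l * s) ≤ 2 ^ (t * suc P) * (2 * b) ^ (l * s)
      s^ls≤ = *-cancelʳ-≤ _ _ ((2 * b) ^ r) {{m^n≢0 (2 * b) r {{m*n≢0 2 b}}}} (begin
        s ^ (l * s) * (2 * b) ^ r                              ≤⟨ *-monoʳ-≤ (s ^ (l * s)) (^-monoˡ-≤ r 2b≤s) ⟩
        s ^ (l * s) * s ^ r                                    ≡⟨ trans (sym (^-distribˡ-+-* s (l * s) r)) (cong (s ^_) ls+r) ⟩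
        s ^ (2 * b * suc P)                                    ≡⟨ ^-*-assoc s (2 * b) (suc P) ⟨
        (s ^ (2 * b)) ^ suc P                                  ≤⟨ ^-monoˡ-≤ (suc P) ([a+b]^2b≤ d) ⟩
        (2 ^ t * (2 * b) ^ (2 * b)) ^ suc P                    ≡⟨ ^-distribʳ-* (2 ^ t) _ (suc P) ⟩
        (2 ^ t) ^ suc P * ((2 * b) ^ (2 * b)) ^ suc P          ≡⟨ cong₂ _*_ (^-*-assoc 2 t (suc P)) (^-*-assoc (2 * b) (2 * b) (suc P)) ⟩
        2 ^ (t * suc P) * (2 * b) ^ (2 * b * suc P)            ≡⟨ cong (λ n → 2 ^ (t * suc P) * (2 * b) ^ n) ls+r ⟨
        2 ^ (t * suc P) * (2 * b) ^ (l * s + r)                ≡⟨ cong (2 ^ (t * suc P) *_) (^-distribˡ-+-* (2 * b) (l * s) r) ⟩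
        2 ^ (t * suc P) * ((2 * b) ^ (l * s) * (2 * b) ^ r)    ≡⟨ *-assoc (2 ^ (t * suc P)) _ _ ⟨
        2 ^ (t * suc P) * (2 * b) ^ (l * s) * (2 * b) ^ r      ∎)
      step : X ^ s ≤ 2 ^ e * (b ^ l) ^ s
      step = begin
        ((2 * s) ^ l * 4 ^ h) ^ s                              ≡⟨ ^-distribʳ-* ((2 * s) ^ l) (4 ^ h) s ⟩
        ((2 * s) ^ l) ^ s * (4 ^ h) ^ s                        ≡⟨ cong₂ _*_ (^-*-assoc (2 * s) l s) (^-*-assoc 4 h s) ⟩
        (2 * s) ^ (l * s) * 4 ^ (h * s)                        ≡⟨ cong₂ _*_ (^-distribʳ-* 2 s (l * s)) (^-*-assoc 2 2 (h * s)) ⟩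
        2 ^ (l * s) * s ^ (l * s) * 2 ^ (2 * (h * s))          ≤⟨ *-monoˡ-≤ (2 ^ (2 * (h * s))) (*-monoʳ-≤ (2 ^ (l * s)) s^ls≤) ⟩
        2 ^ (l * s) * (2 ^ (t * suc P) * (2 * b) ^ (l * s)) * 2 ^ (2 * (h * s))
          ≡⟨ cong (λ p → 2 ^ (l * s) * (2 ^ (t * suc P) * p) * 2 ^ (2 * (h * s))) (^-distribʳ-* 2 b (l * s)) ⟩
        2 ^ (l * s) * (2 ^ (t * suc P) * (2 ^ (l * s) * b ^ (l * s))) * 2 ^ (2 * (h * s))
          ≡⟨ eq₁ (2 ^ (l * s)) (2 ^ (t * suc P)) (b ^ (l * s)) (2 ^ (2 * (h * s))) ⟩
        2 ^ (l * s) * 2 ^ (l * s) * 2 ^ (2 * (h * s)) * 2 ^ (t * suc P) * b ^ (l * s)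
          ≡⟨ cong (_* b ^ (l * s)) 2^-+ ⟨
        2 ^ (l * s + l * s + 2 * (h * s) + t * suc P) * b ^ (l * s)
          ≡⟨ cong₂ (λ n p → 2 ^ n * p) (eq₂ l s h (t * suc P)) (sym (^-*-assoc b l s)) ⟩
        2 ^ e * (b ^ l) ^ s                                    ∎
        where
        eq₁ : ∀ p q r u → p * (q * (p * r)) * u ≡ p * p * u * q * r
        eq₁ = solve-∀
        eq₂ : ∀ l s h t → l * s + l * s + 2 * (h * s) + t ≡ 2 * (s * (l + h)) + t
        eq₂ = solve-∀
        2^-+ : 2 ^ (l * s + l * s + 2 * (h * s) + t * suc P) ≡ 2 ^ (l * s) * 2 ^ (l * s) * 2 ^ (2 * (h * s)) * 2 ^ (t * suc P)
        2^-+ = trans (^-distribˡ-+-* 2 (l * s + l * s + 2 * (h * s)) (t * suc P))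
          (cong (_* 2 ^ (t * suc P)) (trans (^-distribˡ-+-* 2 (l * s + l * s) (2 * (h * s)))
            (cong (_* 2 ^ (2 * (h * s))) (^-distribˡ-+-* 2 (l * s) (l * s)))))
      e*24≤ : e * 24 ≤ 93 * ((3 * b + d) * P)
      e*24≤ = begin
        (2 * (s * (l + h)) + t * suc P) * 24                   ≤⟨ *-monoˡ-≤ 24 (+-monoˡ-≤ (t * suc P) (*-monoʳ-≤ 2 (*-monoʳ-≤ s l+h≤P))) ⟩
        (2 * (s * P) + t * suc P) * 24                         ≡⟨ eq₁ b d P ⟩
        -- The budget 93a = 279b + 93d leaves 39b + 21d per unit of P, and P ≥ 2 turns this into
        -- enough for the constant term.
        P * (240 * b + 72 * d) + 2 * (24 * b + 12 * d)         ≤⟨ +-monoʳ-≤ (P * (240 * b + 72 * d)) (*-mono-≤ 2≤P (+-mono-≤ (*-monoˡ-≤ b (m≤m+n 24 15)) (*-monoˡ-≤ d (m≤m+n 12 9)))) ⟩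
        P * (240 * b + 72 * d) + P * (39 * b + 21 * d)         ≡⟨ eq₂ b d P ⟩
        93 * ((3 * b + d) * P)                                 ∎
        where
        eq₁ : ∀ b d P → (2 * ((3 * b + d + b) * P) + (2 * b + d) * (1 + P)) * 24 ≡ P * (240 * b + 72 * d) + 2 * (24 * b + 12 * d)
        eq₁ = solve-∀
        eq₂ : ∀ b d P → P * (240 * b + 72 * d) + P * (39 * b + 21 * d) ≡ 93 * ((3 * b + d) * P)
        eq₂ = solve-∀

  compositions-≤-^ : ∀ k r → compositions k r ≤ k ^ r
  compositions-≤-^ zero    zero    = ≤-refl
  compositions-≤-^ zero    (suc r) = z≤n
  compositions-≤-^ (suc k) zero    = ≤-refl
  compositions-≤-^ (suc k) (suc r) = begin
    compositions k (suc r) + compositions (suc k) r   ≤⟨ +-mono-≤ (compositions-≤-^ k (suc r)) (compositions-≤-^ (suc k) r) ⟩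
    k * k ^ r + suc k ^ r                             ≤⟨ +-monoˡ-≤ _ (*-monoʳ-≤ k (^-monoˡ-≤ r (n≤1+n k))) ⟩
    k * suc k ^ r + suc k ^ r                         ≡⟨ +-comm (k * suc k ^ r) _ ⟩
    suc k ^ suc r                                     ∎
    where open ≤-Reasoning

  -- ∑ᵣ compositions k r · xʳ = (1 - x)⁻ᵏ at x = u/(u+w), for a single term of the sum.
  compositions-generating : ∀ u w k r → compositions k r * (u ^ r * w ^ k) ≤ (u + w) ^ (k + r)
  compositions-generating u w zero    zero    = ≤-refl
  compositions-generating u w zero    (suc r) = z≤n
  compositions-generating u w (suc k) zero    = begin
    1 * (1 * w ^ suc k)      ≡⟨ trans (*-identityˡ _) (*-identityˡ _) ⟩
    w ^ suc k                ≤⟨ ^-monoˡ-≤ (suc k) (m≤n+m w u) ⟩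
    (u + w) ^ suc k          ≡⟨ cong (λ n → (u + w) ^ suc n) (+-identityʳ k) ⟨
    (u + w) ^ suc (k + 0)    ∎
    where open ≤-Reasoning
  compositions-generating u w (suc k) (suc r) = begin
    (C + D) * (u * u ^ r * (w * w ^ k))                                 ≡⟨ eq₁ C D u (u ^ r) w (w ^ k) ⟩
    w * (C * (u * u ^ r * w ^ k)) + u * (D * (u ^ r * (w * w ^ k)))     ≤⟨ +-mono-≤ (*-monoʳ-≤ w (compositions-generating u w k (suc r))) (*-monoʳ-≤ u (compositions-generating u w (suc k) r)) ⟩
    w * (u + w) ^ (k + suc r) + u * (u + w) ^ suc (k + r)               ≡⟨ cong (λ n → w * (u + w) ^ (k + suc r) + u * (u + w) ^ n) (sym (+-suc k r)) ⟩
    w * (u + w) ^ (k + suc r) + u * (u + w) ^ (k + suc r)               ≡⟨ eq₂ u w ((u + w) ^ (k + suc r)) ⟩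
    (u + w) * (u + w) ^ (k + suc r)                                     ∎
    where
    open ≤-Reasoning
    C D : ℕ
    C = compositions k (suc r)
    D = compositions (suc k) r
    eq₁ : ∀ C D u p w q → (C + D) * (u * p * (w * q)) ≡ w * (C * (u * p * q)) + u * (D * (p * (w * q)))
    eq₁ = solve-∀
    eq₂ : ∀ u w p → w * p + u * p ≡ (u + w) * p
    eq₂ = solve-∀

  strip : ∀ p .{{_ : NonTrivial p}} n .{{_ : NonZero n}} → ∃₂ λ r m → n ≡ p ^ r * m × ¬ p ∣ m
  strip p = <-rec (λ n → .{{_ : NonZero n}} → _) go
    where
    go : ∀ n → (∀ {m} → m < n → .{{_ : NonZero m}} → ∃₂ λ r l → m ≡ p ^ r * l × ¬ p ∣ l) →
         .{{_ : NonZero n}} → ∃₂ λ r m → n ≡ p ^ r * m × ¬ p ∣ m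
    go n rec with p ∣? n
    ... | no  p∤n = 0 , n , sym (+-identityʳ n) , p∤n
    ... | yes p∣n with rec (quotient-< p∣n) {{quotient≢0 p∣n}}
    ...   | r , m , q≡ , p∤m = suc r , m , trans (m∣n⇒n≡m*quotient p∣n) (trans (cong (p *_) q≡) (sym (*-assoc p (p ^ r) m))) , p∤m

  rough∧<⇒≡1 : ∀ n {x} .{{_ : NonZero n}} → x Rough n → n < x → n ≡ 1
  rough∧<⇒≡1 1                  _     _   = refl
  rough∧<⇒≡1 n@(suc (suc _)) rough n<x = contradiction n<x (≤⇒≯ (rough⇒≤ rough))

  ∏ : (ℕ → ℕ) → ℕ → ℕ → ℕ
  ∏ f x zero    = 1
  ∏ f x (suc n) = f x * ∏ f (suc x) n

  -- Splitting off one prime at a time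

  module Peel (k s b N₀ : ℕ) where

    -- The number of factorisations of N into k factors is at most N^(b/s) times the product of (v/w)ᵏ over all primes p.
    Loss : ℕ → ℕ → ℕ → Set
    Loss p v w = ∀ r → compositions k r ^ s * w ^ (k * s) ≤ v ^ (k * s) * (p ^ r) ^ b

    -- The cap N₀ gives a downward induction on x a starting point: beyond N₀, the only x-rough
    -- number left is 1.
    Bound : ℕ → ℕ → ℕ → Set
    Bound x V W = ∀ N .{{_ : NonZero N}} → N ≤ N₀ → x Rough N →
      ∃ λ c → Cover k N c × c ^ s * W ^ (k * s) ≤ V ^ (k * s) * N ^ b

    bound-top : ∀ {x} → N₀ < x → Bound x 1 1
    bound-top {x} N₀<x N N≤N₀ rough = 1 , subst (λ N → Cover k N 1) (sym N≡1) (cover-1 k) , ≤-reflexive (begin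
      1 ^ s * 1 ^ (k * s)     ≡⟨ trans (cong (_* 1 ^ (k * s)) (^-zeroˡ s)) (*-comm 1 (1 ^ (k * s))) ⟩
      1 ^ (k * s) * 1         ≡⟨ cong (1 ^ (k * s) *_) (trans (cong (_^ b) N≡1) (^-zeroˡ b)) ⟨
      1 ^ (k * s) * N ^ b     ∎)
      where
      open ≡-Reasoning
      N≡1 : N ≡ 1
      N≡1 = rough∧<⇒≡1 N rough (≤-<-trans N≤N₀ N₀<x)

    -- All integers x are treated alike. If x divides an x-rough N, then x is prime, and its full
    -- power in N is coprime to the rest. Otherwise its factor (v/w)^(k*s) does no harm, being at
    -- least 1 by `loss` at r = 0; in particular this covers composite x.
    bound-step : ∀ {x v w V W} .{{_ : NonTrivial x}} → Loss x v w → Bound (suc x) V W → Bound x (v * V) (w * W)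
    bound-step {x} {v} {w} {V} {W} loss bound N N≤N₀ rough with x ∣? N
    ... | no x∤N with bound N N≤N₀ (∤⇒rough-suc x∤N rough)
    ...   | c , S , c≤ = c , S , (begin
      c ^ s * (w * W) ^ (k * s)               ≡⟨ cong (c ^ s *_) (^-distribʳ-* w W (k * s)) ⟩
      c ^ s * (w ^ (k * s) * W ^ (k * s))     ≡⟨ eq (c ^ s) (w ^ (k * s)) (W ^ (k * s)) ⟩
      w ^ (k * s) * (c ^ s * W ^ (k * s))     ≤⟨ *-mono-≤ w≤v c≤ ⟩
      v ^ (k * s) * (V ^ (k * s) * N ^ b)     ≡⟨ *-assoc (v ^ (k * s)) _ _ ⟨
      v ^ (k * s) * V ^ (k * s) * N ^ b       ≡⟨ cong (_* N ^ b) (^-distribʳ-* v V (k * s)) ⟨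
      (v * V) ^ (k * s) * N ^ b               ∎)
      where
      open ≤-Reasoning
      eq : ∀ c w W → c * (w * W) ≡ w * (c * W)
      eq = solve-∀
      compositions-0 : ∀ k → compositions k 0 ≡ 1
      compositions-0 zero    = refl
      compositions-0 (suc k) = refl
      w≤v : w ^ (k * s) ≤ v ^ (k * s)
      w≤v = subst₂ _≤_
        (trans (cong (_* w ^ (k * s)) (trans (cong (_^ s) (compositions-0 k)) (^-zeroˡ s))) (*-identityˡ _))
        (trans (cong (v ^ (k * s) *_) (^-zeroˡ b)) (*-identityʳ _))
        (loss 0)
    bound-step {x} {v} {w} {V} {W} loss bound N N≤N₀ rough | yes x∣N with strip x N
    ... | r , M , refl , x∤M
      with bound M {{m*n≢0⇒n≢0 (x ^ r)}} (≤-trans (∣⇒≤ (n∣m*n (x ^ r))) N≤N₀) (∤⇒rough-suc x∤M (rough∧∣⇒rough rough (n∣m*n (x ^ r))))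
    ...   | c , S , c≤ = C * c , cover-* (coprime-^ (prime∤⇒coprime x-prime x∤M) r) (cover-prime^ x-prime k r) S , (begin
      (C * c) ^ s * (w * W) ^ (k * s)                        ≡⟨ cong₂ _*_ (^-distribʳ-* C c s) (^-distribʳ-* w W (k * s)) ⟩
      C ^ s * c ^ s * (w ^ (k * s) * W ^ (k * s))            ≡⟨ eq (C ^ s) (c ^ s) (w ^ (k * s)) (W ^ (k * s)) ⟩
      C ^ s * w ^ (k * s) * (c ^ s * W ^ (k * s))            ≤⟨ *-mono-≤ (loss r) c≤ ⟩
      v ^ (k * s) * (x ^ r) ^ b * (V ^ (k * s) * M ^ b)      ≡⟨ eq (v ^ (k * s)) ((x ^ r) ^ b) (V ^ (k * s)) (M ^ b) ⟩
      v ^ (k * s) * V ^ (k * s) * ((x ^ r) ^ b * M ^ b)      ≡⟨ cong₂ _*_ (^-distribʳ-* v V (k * s)) (^-distribʳ-* (x ^ r) M b) ⟨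
      (v * V) ^ (k * s) * (x ^ r * M) ^ b                    ∎)
      where
      open ≤-Reasoning
      C : ℕ
      C = compositions k r
      x-prime : Prime x
      x-prime = rough∧∣⇒prime rough x∣N
      eq : ∀ C c w W → C * c * (w * W) ≡ C * w * (c * W)
      eq = solve-∀

    descend : ∀ {v w : ℕ → ℕ} {V W} x n → 2 ≤ x → (∀ p → x ≤ p → p < x + n → Loss p (v p) (w p)) →
              Bound (x + n) V W → Bound x (∏ v x n * V) (∏ w x n * W)
    descend {V = V} {W} x zero 2≤x loss bound = subst₂ (Bound x) (sym (+-identityʳ V)) (sym (+-identityʳ W))
      (subst (λ y → Bound y V W) (+-identityʳ x) bound)
    descend {v} {w} {V} {W} x (suc n) 2≤x loss bound = subst₂ (Bound x)
      (sym (*-assoc (v x) (∏ v (suc x) n) V)) (sym (*-assoc (w x) (∏ w (suc x) n) W))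
      (bound-step {{n>1⇒nonTrivial 2≤x}} (loss x ≤-refl (m<m+n x z<s))
        (descend (suc x) n (m≤n⇒m≤1+n 2≤x)
          (λ p x<p p< → loss p (<⇒≤ x<p) (subst (p <_) (sym (+-suc x n)) p<))
          (subst (λ y → Bound y V W) (+-suc x n) bound)))

    -- The hypothesis means k ≤ p^σ for σ = b/s, so even the crude bound k^r on the number of
    -- compositions is at most p^(σr).
    loss-large : ∀ {p} → k ^ s ≤ p ^ b → Loss p 1 1
    loss-large {p} k^s≤p^b r = begin
      compositions k r ^ s * 1 ^ (k * s)     ≡⟨ trans (cong (compositions k r ^ s *_) (^-zeroˡ (k * s))) (*-identityʳ _) ⟩
      compositions k r ^ s                   ≤⟨ ^-monoˡ-≤ s (compositions-≤-^ k r) ⟩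
      (k ^ r) ^ s                            ≡⟨ ^-comm k r s ⟩
      (k ^ s) ^ r                            ≤⟨ ^-monoˡ-≤ r k^s≤p^b ⟩
      (p ^ b) ^ r                            ≡⟨ ^-comm p b r ⟩
      (p ^ r) ^ b                            ≡⟨ trans (cong (_* (p ^ r) ^ b) (^-zeroˡ (k * s))) (*-identityˡ _) ⟨
      1 ^ (k * s) * (p ^ r) ^ b              ∎
      where open ≤-Reasoning

    -- The hypothesis means p^(-σ) ≤ x for x = u/(u+w). The r-th term of the generating function at
    -- x is at most (1 - x)^(-k) = ((u+w)/w)^k.
    loss-small : ∀ {p u w} .{{_ : NonZero u}} → (u + w) ^ s ≤ u ^ s * p ^ b → Loss p (u + w) w
    loss-small {p} {u} {w} v^s≤ r = *-cancelʳ-≤ _ _ ((u ^ r) ^ s) {{m^n≢0 (u ^ r) s {{m^n≢0 u r}}}} (begin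
      C ^ s * w ^ (k * s) * (u ^ r) ^ s                     ≡⟨ cong (λ q → C ^ s * q * (u ^ r) ^ s) (^-*-assoc w k s) ⟨
      C ^ s * (w ^ k) ^ s * (u ^ r) ^ s                     ≡⟨ eq (C ^ s) ((w ^ k) ^ s) ((u ^ r) ^ s) ⟩
      C ^ s * ((u ^ r) ^ s * (w ^ k) ^ s)                   ≡⟨ trans (^-distribʳ-* C (u ^ r * w ^ k) s) (cong (C ^ s *_) (^-distribʳ-* (u ^ r) (w ^ k) s)) ⟨
      (C * (u ^ r * w ^ k)) ^ s                             ≤⟨ ^-monoˡ-≤ s (compositions-generating u w k r) ⟩
      ((u + w) ^ (k + r)) ^ s                               ≡⟨ trans (cong (_^ s) (^-distribˡ-+-* (u + w) k r)) (^-distribʳ-* ((u + w) ^ k) _ s) ⟩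
      ((u + w) ^ k) ^ s * ((u + w) ^ r) ^ s                 ≡⟨ cong₂ _*_ (^-*-assoc (u + w) k s) (^-comm (u + w) r s) ⟩
      (u + w) ^ (k * s) * ((u + w) ^ s) ^ r                 ≤⟨ *-monoʳ-≤ ((u + w) ^ (k * s)) (^-monoˡ-≤ r v^s≤) ⟩
      (u + w) ^ (k * s) * (u ^ s * p ^ b) ^ r               ≡⟨ cong ((u + w) ^ (k * s) *_) (trans (^-distribʳ-* (u ^ s) (p ^ b) r) (cong₂ _*_ (^-comm u s r) (^-comm p b r))) ⟩
      (u + w) ^ (k * s) * ((u ^ r) ^ s * (p ^ r) ^ b)       ≡⟨ eq′ ((u + w) ^ (k * s)) ((u ^ r) ^ s) ((p ^ r) ^ b) ⟩
      (u + w) ^ (k * s) * (p ^ r) ^ b * (u ^ r) ^ s         ∎)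
      where
      open ≤-Reasoning
      C : ℕ
      C = compositions k r
      eq : ∀ c w u → c * w * u ≡ c * (u * w)
      eq = solve-∀
      eq′ : ∀ v u p → v * (u * p) ≡ v * p * u
      eq′ = solve-∀

  ∏-const : ∀ c x n → ∏ (λ _ → c) x n ≡ c ^ n
  ∏-const c x zero    = refl
  ∏-const c x (suc n) = cong (c *_) (∏-const c (suc x) n)

  -- The product of sp/(b(p-1)) over x < p ≤ x+n is (s/b)^n·(x+n)/x, with denominators cleared.
  ∏-telescope : ∀ s b x n → ∏ (s *_) (suc x) n * (b ^ n * x) ≡ ∏ (λ p → b * pred p) (suc x) n * (s ^ n * (x + n))
  ∏-telescope s b x zero    = cong (λ n → 1 * (1 * n)) (sym (+-identityʳ x))
  ∏-telescope s b x (suc n) = begin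
    s * suc x * V * (b * b ^ n * x)                ≡⟨ eq₁ s x V b (b ^ n) ⟩
    b * x * s * (V * (b ^ n * suc x))              ≡⟨ cong (b * x * s *_) (∏-telescope s b (suc x) n) ⟩
    b * x * s * (W * (s ^ n * (suc x + n)))        ≡⟨ cong (λ m → b * x * s * (W * (s ^ n * m))) (sym (+-suc x n)) ⟩
    b * x * s * (W * (s ^ n * (x + suc n)))        ≡⟨ eq₂ (b * x) s W (s ^ n) (x + suc n) ⟩
    b * x * W * (s * s ^ n * (x + suc n))          ∎
    where
    open ≡-Reasoning
    V W : ℕ
    V = ∏ (s *_) (2 + x) n
    W = ∏ (λ p → b * pred p) (2 + x) n
    eq₁ : ∀ s x V b q → s * (1 + x) * V * (b * q * x) ≡ b * x * s * (V * (q * (1 + x)))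
    eq₁ = solve-∀
    eq₂ : ∀ c s W q y → c * s * (W * (q * y)) ≡ c * W * (s * q * y)
    eq₂ = solve-∀

  ∏-pred≢0 : ∀ b .{{_ : NonZero b}} x n → NonZero (∏ (λ p → b * pred p) (2 + x) n)
  ∏-pred≢0 b x zero    = nonZero
  ∏-pred≢0 b x (suc n) = m*n≢0 (b * suc x) _ {{m*n≢0 b (suc x)}} {{∏-pred≢0 b (suc x) n}}

  -- The factors for p ≤ P, according to the size of a/b

  module _ {k a b P : ℕ} .{{_ : NonZero a}} .{{_ : NonZero b}} (2≤k : 2 ≤ k)
           (2^b≤k^a : 2 ^ b ≤ k ^ a) (k^[a+b]< : k ^ (a + b) < suc P ^ b) where

    private
      s : ℕ
      s = a + b

      instance
        s≢0 : NonZero s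
        s≢0 = m+n≢0 a
          where
          m+n≢0 : ∀ m {n} .{{_ : NonZero m}} → NonZero (m + n)
          m+n≢0 (suc m) = nonZero

      2k≤P : 2 * k ≤ P
      2k≤P = s≤s⁻¹ (≰⇒> λ sP≤2k → <⇒≱ k^[a+b]< (begin
        suc P ^ b           ≤⟨ ^-monoˡ-≤ b sP≤2k ⟩
        (2 * k) ^ b         ≡⟨ ^-distribʳ-* 2 k b ⟩
        2 ^ b * k ^ b       ≤⟨ *-monoˡ-≤ (k ^ b) 2^b≤k^a ⟩
        k ^ a * k ^ b       ≡⟨ ^-distribˡ-+-* k a b ⟨
        k ^ (a + b)         ∎))
        where open ≤-Reasoning

      4≤P : 4 ≤ P
      4≤P = ≤-trans (*-monoʳ-≤ 2 2≤k) 2k≤P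

      -- This is p^(-σ) ≤ (ap+b)/(sp): the weighted mean of p and 1 bounds p^(a/s) = p^(1-σ).
      am-gm-p : ∀ p → (s * p) ^ s ≤ (a * p + b * 1) ^ s * p ^ b
      am-gm-p p = begin
        (s * p) ^ s                        ≡⟨ ^-distribʳ-* s p s ⟩
        s ^ s * p ^ s                      ≡⟨ cong (s ^ s *_) (^-distribˡ-+-* p a b) ⟩
        s ^ s * (p ^ a * p ^ b)            ≡⟨ eq (s ^ s) (p ^ a) (p ^ b) ⟩
        p ^ a * 1 * s ^ s * p ^ b          ≡⟨ cong (λ q → p ^ a * q * s ^ s * p ^ b) (^-zeroˡ b) ⟨
        p ^ a * 1 ^ b * s ^ s * p ^ b      ≤⟨ *-monoˡ-≤ (p ^ b) (am-gm a b p 1) ⟩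
        (a * p + b * 1) ^ s * p ^ b        ∎
        where
        open ≤-Reasoning
        eq : ∀ s p q → s * (p * q) ≡ p * 1 * s * q
        eq = solve-∀

    module _ (N : ℕ) .{{_ : NonZero N}} where
      open Peel k s b N

      private
        -- N steps from P + 1 lead past N, where `bound-top` applies; for all these p the lossless
        -- estimate `loss-large` is available.
        bound-large : Bound (suc P) 1 1
        bound-large = subst (λ n → Bound (suc P) n n) (trans (*-identityʳ _) (trans (∏-const 1 (suc P) N) (^-zeroˡ N)))
          (descend {λ _ → 1} {λ _ → 1} (suc P) N (s≤s (≤-trans (s≤s z≤n) 4≤P))
            (λ p P<p _ → loss-large (<⇒≤ (<-≤-trans k^[a+b]< (^-monoˡ-≤ b P<p))))
            (bound-top (s≤s (m≤n+m N P))))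

        conclude : ∀ {V W} .{{_ : NonZero W}} → V ^ (24 * s) ≤ W ^ (24 * s) * 2 ^ (93 * (a * P)) → Bound 2 V W →
                   ∃ λ c → Cover k N c × c ^ (24 * s) ≤ 2 ^ (93 * (a * P) * k) * N ^ (24 * b)
        conclude {V} {W} V≤ bound with bound N ≤-refl 2-rough
        ... | c , S , c≤ = c , S , *-cancelʳ-≤ _ _ ((W ^ (24 * s)) ^ k) {{m^n≢0 _ k {{m^n≢0 W (24 * s)}}}} (begin
          c ^ (24 * s) * (W ^ (24 * s)) ^ k                          ≡⟨ cong₂ _*_ (trans (cong (c ^_) (*-comm 24 s)) (sym (^-*-assoc c s 24))) (to24 W) ⟩
          (c ^ s) ^ 24 * (W ^ (k * s)) ^ 24                          ≡⟨ ^-distribʳ-* (c ^ s) _ 24 ⟨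
          (c ^ s * W ^ (k * s)) ^ 24                                 ≤⟨ ^-monoˡ-≤ 24 c≤ ⟩
          (V ^ (k * s) * N ^ b) ^ 24                                 ≡⟨ ^-distribʳ-* (V ^ (k * s)) _ 24 ⟩
          (V ^ (k * s)) ^ 24 * (N ^ b) ^ 24                          ≡⟨ cong₂ _*_ (sym (to24 V)) (trans (^-*-assoc N b 24) (cong (N ^_) (*-comm b 24))) ⟩
          (V ^ (24 * s)) ^ k * N ^ (24 * b)                          ≤⟨ *-monoˡ-≤ _ (^-monoˡ-≤ k V≤) ⟩
          (W ^ (24 * s) * 2 ^ (93 * (a * P))) ^ k * N ^ (24 * b)     ≡⟨ cong (_* N ^ (24 * b)) (trans (^-distribʳ-* (W ^ (24 * s)) _ k) (cong ((W ^ (24 * s)) ^ k *_) (^-*-assoc 2 (93 * (a * P)) k))) ⟩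
          (W ^ (24 * s)) ^ k * 2 ^ (93 * (a * P) * k) * N ^ (24 * b) ≡⟨ eq ((W ^ (24 * s)) ^ k) (2 ^ (93 * (a * P) * k)) (N ^ (24 * b)) ⟩
          2 ^ (93 * (a * P) * k) * N ^ (24 * b) * (W ^ (24 * s)) ^ k ∎)
          where
          open ≤-Reasoning
          eq : ∀ w e n → w * e * n ≡ e * n * w
          eq = solve-∀
          eq′ : ∀ s k → 24 * s * k ≡ k * s * 24
          eq′ = solve-∀
          to24 : ∀ x → (x ^ (24 * s)) ^ k ≡ (x ^ (k * s)) ^ 24
          to24 x = trans (^-*-assoc x (24 * s) k) (trans (cong (x ^_) (eq′ s k)) (sym (^-*-assoc x (k * s) 24)))

        a≤3b-case : a ≤ 3 * b → ∃ λ c → Cover k N c × c ^ (24 * s) ≤ 2 ^ (93 * (a * P) * k) * N ^ (24 * b)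
        a≤3b-case a≤3b = conclude {V} {W} V≤ (subst₂ (Bound 2) (*-identityʳ V) (*-identityʳ W)
          (descend 2 n ≤-refl loss (subst (λ m → Bound m 1 1) (cong suc P≡1+n) bound-large)))
          where
          n V W : ℕ
          n = pred P
          V = ∏ (s *_) 2 n
          W = ∏ (λ p → b * pred p) 2 n
          P≡1+n : P ≡ suc n
          P≡1+n = sym (suc-pred P {{>-nonZero (≤-trans (s≤s z≤n) 4≤P)}})
          instance
            W≢0 : NonZero W
            W≢0 = ∏-pred≢0 b 0 n
          loss : ∀ p → 2 ≤ p → _ → Loss p (s * p) (b * pred p)
          -- The numerator u = ap + b and w = b(p-1) add up to sp.
          loss (suc q) _ _ = subst (λ v → Loss (suc q) v (b * q)) (eq a b q)
            (loss-small {suc q} {a * suc q + b * 1} {{m*1+n≢0 (a * suc q) b}}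
              (subst (λ v → v ^ s ≤ (a * suc q + b * 1) ^ s * suc q ^ b) (sym (eq a b q)) (am-gm-p (suc q))))
            where
            eq : ∀ a b q → a * (1 + q) + b * 1 + b * q ≡ (a + b) * (1 + q)
            eq = solve-∀
            m*1+n≢0 : ∀ m n .{{_ : NonZero n}} → NonZero (m + n * 1)
            m*1+n≢0 m n@(suc _) = >-nonZero (≤-trans z<s (m≤n+m (n * 1) m))
          V≤ : V ^ (24 * s) ≤ W ^ (24 * s) * 2 ^ (93 * (a * P))
          V≤ = *-cancelʳ-≤ _ _ ((b ^ n) ^ (24 * s)) {{m^n≢0 (b ^ n) (24 * s) {{m^n≢0 b n}}}} (begin
            V ^ (24 * s) * (b ^ n) ^ (24 * s)           ≡⟨ ^-distribʳ-* V (b ^ n) (24 * s) ⟨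
            (V * b ^ n) ^ (24 * s)                      ≡⟨ cong (λ q → (V * q) ^ (24 * s)) (*-identityʳ (b ^ n)) ⟨
            (V * (b ^ n * 1)) ^ (24 * s)                ≡⟨ cong (_^ (24 * s)) (∏-telescope s b 1 n) ⟩
            (W * (s ^ n * (1 + n))) ^ (24 * s)          ≡⟨ cong (λ m → (W * (s ^ n * m)) ^ (24 * s)) P≡1+n ⟨
            (W * (s ^ n * P)) ^ (24 * s)                ≡⟨ ^-distribʳ-* W _ (24 * s) ⟩
            W ^ (24 * s) * (s ^ n * P) ^ (24 * s)       ≤⟨ *-monoʳ-≤ (W ^ (24 * s)) (small-cost 2^b≤k^a 2k≤P 4≤P a≤3b (≤-trans (n≤1+n n) (≤-reflexive (sym P≡1+n)))) ⟩
            W ^ (24 * s) * ((b ^ n) ^ (24 * s) * 2 ^ (93 * (a * P)))   ≡⟨ eq (W ^ (24 * s)) ((b ^ n) ^ (24 * s)) (2 ^ (93 * (a * P))) ⟩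
            W ^ (24 * s) * 2 ^ (93 * (a * P)) * (b ^ n) ^ (24 * s)     ∎)
            where
            open ≤-Reasoning
            eq : ∀ w b e → w * (b * e) ≡ w * e * b
            eq = solve-∀

        3b≤a-case : 3 * b ≤ a → ∃ λ c → Cover k N c × c ^ (24 * s) ≤ 2 ^ (93 * (a * P) * k) * N ^ (24 * b)
        3b≤a-case 3b≤a = conclude {V} {b ^ l} {{m^n≢0 b l}} (large-cost 3b≤a (≤-trans (s≤s (s≤s z≤n)) 4≤P) {l} {h} (m/n*n≤m _ s) l+h≤P)
          (subst₂ (Bound 2)
            (cong₂ _*_ (∏-const (2 * s) 2 l) (trans (*-identityʳ _) (∏-const 4 (2 + l) h)))
            (trans (cong₂ _*_ (∏-const b 2 l) (trans (*-identityʳ _) (trans (∏-const 1 (2 + l) h) (^-zeroˡ h)))) (*-identityʳ _))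
            (descend {λ _ → 2 * s} {λ _ → b} 2 l ≤-refl loss-low
              (descend {λ _ → 4} {λ _ → 1} (2 + l) h (s≤s (s≤s z≤n)) loss-high
                (subst (λ m → Bound m 1 1) (cong suc (sym 1+l+h≡P)) bound-large))))
          where
          open ≤-Reasoning
          -- Primes p ≤ l+1 get v/w = 2(a+b)/b; for p > l, where (a+b)p ≥ 2b(P+1), v/w = 4 is enough.
          l h V : ℕ
          l = 2 * b * suc P / s
          h = P ∸ suc l
          V = (2 * s) ^ l * 4 ^ h
          4b≤s : 4 * b ≤ s
          4b≤s = ≤-trans (≤-reflexive (+-comm b (3 * b))) (+-monoˡ-≤ b 3b≤a)
          2l≤1+P : 2 * l ≤ suc P
          2l≤1+P = *-cancelʳ-≤ _ _ (2 * b) {{m*n≢0 2 b}} (begin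
            2 * l * (2 * b)       ≡⟨ eq l b ⟩
            l * (4 * b)           ≤⟨ *-monoʳ-≤ l 4b≤s ⟩
            l * s                 ≤⟨ m/n*n≤m _ s ⟩
            2 * b * suc P         ≡⟨ *-comm (2 * b) (suc P) ⟩
            suc P * (2 * b)       ∎)
            where
            eq : ∀ l b → 2 * l * (2 * b) ≡ l * (4 * b)
            eq = solve-∀
          l<P : l < P
          l<P = *-cancelˡ-< 2 l P (begin-strict
            2 * l                 ≤⟨ 2l≤1+P ⟩
            1 + P                 <⟨ +-monoˡ-< P {1} {P} (≤-trans (s≤s (s≤s z≤n)) 4≤P) ⟩
            P + P                 ≡⟨ cong (P +_) (+-identityʳ P) ⟨
            2 * P                 ∎)
          1+l+h≡P : suc l + h ≡ P
          1+l+h≡P = m+[n∸m]≡n l<P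
          l+h≤P : l + h ≤ P
          l+h≤P = ≤-trans (n≤1+n (l + h)) (≤-reflexive 1+l+h≡P)
          -- The mean is taken at 2 in place of p, which suffices because p^(-σ) decreases in p. It
          -- gives u = 2a + b and w = b, with sum 2s.
          loss-low : ∀ p → 2 ≤ p → _ → Loss p (2 * s) b
          loss-low p 2≤p _ = subst (λ v → Loss p v b) (eq a b)
            (loss-small {p} {a * 2 + b * 1} {{>-nonZero (<-≤-trans (*-mono-≤ {1} (>-nonZero⁻¹ a) (s≤s z≤n)) (m≤m+n (a * 2) (b * 1)))}} (begin
              (a * 2 + b * 1 + b) ^ s            ≡⟨ cong (_^ s) (trans (eq a b) (*-comm 2 s)) ⟩
              (s * 2) ^ s                        ≤⟨ am-gm-p 2 ⟩
              (a * 2 + b * 1) ^ s * 2 ^ b        ≤⟨ *-monoʳ-≤ ((a * 2 + b * 1) ^ s) (^-monoˡ-≤ b 2≤p) ⟩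
              (a * 2 + b * 1) ^ s * p ^ b        ∎))
            where
            eq : ∀ a b → a * 2 + b * 1 + b ≡ 2 * (a + b)
            eq = solve-∀
          -- Here x = 3/4. On the one hand (P+1)^σ > k ≥ 2; on the other, the inequality of means
          -- gives ((P+1)/p)^σ ≤ a/s + b(P+1)/(sp) ≤ 1 + 1/2. Hence p^(-σ) ≤ (1/2)·(3/2).
          loss-high : ∀ p → 2 + l ≤ p → _ → Loss p 4 1
          loss-high p l<p _ = loss-small {p} {3} {1} (begin
            4 ^ s                    ≡⟨ ^-distribʳ-* 2 2 s ⟩
            2 ^ s * 2 ^ s            ≤⟨ *-monoʳ-≤ (2 ^ s) (≤-trans (^-monoˡ-≤ s 2≤k) (<⇒≤ k^[a+b]<)) ⟩
            2 ^ s * suc P ^ b        ≤⟨ *-cancelʳ-≤ _ _ (p ^ a * s ^ s) {{m*n≢0 (p ^ a) (s ^ s) {{m^n≢0 p a}} {{m^n≢0 s s}}}} cancelled ⟩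
            3 ^ s * p ^ b            ∎)
            where
            instance
              p≢0 : NonZero p
              p≢0 = >-nonZero (≤-trans (s≤s z≤n) l<p)
            2b[1+P]≤sp : 2 * b * suc P ≤ s * p
            2b[1+P]≤sp = begin
              2 * b * suc P                            ≡⟨ m≡m%n+[m/n]*n _ s ⟩
              2 * b * suc P % s + l * s                ≤⟨ +-monoˡ-≤ (l * s) (<⇒≤ (m%n<n (2 * b * suc P) s)) ⟩
              suc l * s                                ≤⟨ *-monoˡ-≤ s (<⇒≤ l<p) ⟩
              p * s                                    ≡⟨ *-comm p s ⟩
              s * p                                    ∎
            mean≤ : 2 * (a * p + b * suc P) ≤ 3 * (s * p)
            mean≤ = begin
              2 * (a * p + b * suc P)                  ≡⟨ eq₁ a b p (suc P) ⟩
              2 * (a * p) + 2 * b * suc P              ≤⟨ +-mono-≤ (*-monoʳ-≤ 2 (*-monoˡ-≤ p (m≤m+n a b))) 2b[1+P]≤sp ⟩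
              2 * (s * p) + s * p                      ≡⟨ eq₂ (s * p) ⟩
              3 * (s * p)                              ∎
              where
              eq₁ : ∀ a b p P → 2 * (a * p + b * P) ≡ 2 * (a * p) + 2 * b * P
              eq₁ = solve-∀
              eq₂ : ∀ q → 2 * q + q ≡ 3 * q
              eq₂ = solve-∀
            cancelled : 2 ^ s * suc P ^ b * (p ^ a * s ^ s) ≤ 3 ^ s * p ^ b * (p ^ a * s ^ s)
            cancelled = begin
              2 ^ s * suc P ^ b * (p ^ a * s ^ s)      ≡⟨ eq₁ (2 ^ s) (suc P ^ b) (p ^ a) (s ^ s) ⟩
              2 ^ s * (p ^ a * suc P ^ b * s ^ s)      ≤⟨ *-monoʳ-≤ (2 ^ s) (am-gm a b p (suc P)) ⟩
              2 ^ s * (a * p + b * suc P) ^ s          ≡⟨ ^-distribʳ-* 2 _ s ⟨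
              (2 * (a * p + b * suc P)) ^ s            ≤⟨ ^-monoˡ-≤ s mean≤ ⟩
              (3 * (s * p)) ^ s                        ≡⟨ trans (^-distribʳ-* 3 (s * p) s) (cong (3 ^ s *_) (trans (^-distribʳ-* s p s) (cong (s ^ s *_) (^-distribˡ-+-* p a b)))) ⟩
              3 ^ s * (s ^ s * (p ^ a * p ^ b))        ≡⟨ eq₂ (3 ^ s) (s ^ s) (p ^ a) (p ^ b) ⟩
              3 ^ s * p ^ b * (p ^ a * s ^ s)          ∎
              where
              eq₁ : ∀ t P p s → t * P * (p * s) ≡ t * (p * P * s)
              eq₁ = solve-∀
              eq₂ : ∀ t s p q → t * (s * (p * q)) ≡ t * q * (p * s)
              eq₂ = solve-∀

      cover-size : ∃ λ c → Cover k N c × c ^ (24 * s) ≤ 2 ^ (93 * (a * P) * k) * N ^ (24 * b)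
      cover-size with ≤-total a (3 * b)
      ... | inj₁ a≤3b = a≤3b-case a≤3b
      ... | inj₂ 3b≤a = 3b≤a-case 3b≤a

-- The bound on the number of zeros

module ZeroBound where

  open Zeros
  open Covers
  open Inequalities
  open CoverSize
  open import Data.Nat
  open import Data.Nat.Properties
  open import Data.Nat.Tactic.RingSolver using (solve-∀)

  module _ {k a b P ℓ N : ℕ} .{{_ : NonZero a}} .{{_ : NonZero b}} .{{_ : NonZero N}} (2≤k : 2 ≤ k)
           (2^b≤k^a : 2 ^ b ≤ k ^ a) (k^[a+b]< : k ^ (a + b) < suc P ^ b)
           (large-N : 2 ^ (31 * (a * P) * k + 8 * (a + b) * ℓ) ≤ N ^ (8 * a)) where

    -- The cube of `large-N` matches the exponents 93 = 3·31 and 24 = 3·8. It bounds the powers of 2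
    -- by N^(24a), which complements the N^(24b) from the cover to N^(24s).
    c2^ℓ≤N : ∀ {c} → c ^ (24 * (a + b)) ≤ 2 ^ (93 * (a * P) * k) * N ^ (24 * b) → c * 2 ^ ℓ ≤ N
    c2^ℓ≤N {c} c≤ = ^-cancelˡ-≤ (24 * s) {{m*n≢0 24 s {{nonZero}} {{m+n≢0 a}}}} (begin
      (c * 2 ^ ℓ) ^ (24 * s)                                 ≡⟨ trans (^-distribʳ-* c (2 ^ ℓ) (24 * s)) (cong (c ^ (24 * s) *_) (^-*-assoc 2 ℓ (24 * s))) ⟩
      c ^ (24 * s) * 2 ^ (ℓ * (24 * s))                      ≤⟨ *-monoˡ-≤ _ c≤ ⟩
      2 ^ (93 * (a * P) * k) * N ^ (24 * b) * 2 ^ (ℓ * (24 * s))  ≡⟨ eq₁ (2 ^ (93 * (a * P) * k)) (N ^ (24 * b)) (2 ^ (ℓ * (24 * s))) ⟩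
      2 ^ (93 * (a * P) * k) * 2 ^ (ℓ * (24 * s)) * N ^ (24 * b)  ≡⟨ cong (_* N ^ (24 * b)) (^-distribˡ-+-* 2 (93 * (a * P) * k) (ℓ * (24 * s))) ⟨
      2 ^ (93 * (a * P) * k + ℓ * (24 * s)) * N ^ (24 * b)   ≡⟨ cong (λ n → 2 ^ n * N ^ (24 * b)) (eq₂ (a * P) k ℓ s) ⟩
      2 ^ ((31 * (a * P) * k + 8 * s * ℓ) * 3) * N ^ (24 * b) ≡⟨ cong (_* N ^ (24 * b)) (^-*-assoc 2 (31 * (a * P) * k + 8 * s * ℓ) 3) ⟨
      (2 ^ (31 * (a * P) * k + 8 * s * ℓ)) ^ 3 * N ^ (24 * b) ≤⟨ *-monoˡ-≤ _ (^-monoˡ-≤ 3 large-N) ⟩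
      (N ^ (8 * a)) ^ 3 * N ^ (24 * b)                       ≡⟨ cong (_* N ^ (24 * b)) (trans (^-*-assoc N (8 * a) 3) (cong (N ^_) (eq₃ a))) ⟩
      N ^ (24 * a) * N ^ (24 * b)                            ≡⟨ ^-distribˡ-+-* N (24 * a) (24 * b) ⟨
      N ^ (24 * a + 24 * b)                                  ≡⟨ cong (N ^_) (*-distribˡ-+ 24 a b) ⟨
      N ^ (24 * s)                                           ∎)
      where
      open ≤-Reasoning
      s : ℕ
      s = a + b
      m+n≢0 : ∀ m {n} .{{_ : NonZero m}} → NonZero (m + n)
      m+n≢0 (suc m) = nonZero
      eq₁ : ∀ p n q → p * n * q ≡ p * q * n
      eq₁ = solve-∀
      eq₂ : ∀ e k ℓ s → 93 * e * k + ℓ * (24 * s) ≡ (31 * e * k + 8 * s * ℓ) * 3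
      eq₂ = solve-∀
      eq₃ : ∀ a → 8 * a * 3 ≡ 24 * a
      eq₃ = solve-∀

    small-cover⇒prodZeros-≤ : (∃ λ c → Cover k N c × c ^ (24 * (a + b)) ≤ 2 ^ (93 * (a * P) * k) * N ^ (24 * b)) →
                              prodZeros N k 1 * 2 ^ ℓ ≤ N ^ k
    small-cover⇒prodZeros-≤ (c , S , c≤) = *-cancelʳ-≤ _ _ N (begin
      prodZeros N k 1 * 2 ^ ℓ * N      ≡⟨ eq (prodZeros N k 1) (2 ^ ℓ) N ⟩
      prodZeros N k 1 * N * 2 ^ ℓ      ≤⟨ *-monoˡ-≤ (2 ^ ℓ) (prodZeros-cover S) ⟩
      c * N ^ k * 2 ^ ℓ                ≡⟨ eq c (N ^ k) (2 ^ ℓ) ⟩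
      c * 2 ^ ℓ * N ^ k                ≤⟨ *-monoˡ-≤ (N ^ k) (c2^ℓ≤N c≤) ⟩
      N * N ^ k                        ≡⟨ *-comm N (N ^ k) ⟩
      N ^ k * N                        ∎)
      where
      open ≤-Reasoning
      eq : ∀ p q r → p * q * r ≡ p * r * q
      eq = solve-∀

    prodZeros-≤ : prodZeros N k 1 * 2 ^ ℓ ≤ N ^ k
    prodZeros-≤ = small-cover⇒prodZeros-≤ (cover-size 2≤k 2^b≤k^a k^[a+b]< N)

    zeros-≤ : ∀ m (t : Tree k) → gcdContent N t ≡ 1 → m * zeros N m t * 2 ^ ℓ ≤ m ^ k * (m + k * 2 ^ ℓ)
    zeros-≤ m t D≡1 = *-cancelʳ-≤ _ _ (N ^ k) {{m^n≢0 N k}} (begin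
      m * zeros N m t * 2 ^ ℓ * N ^ k                                ≡⟨ eq₁ (m * zeros N m t) (2 ^ ℓ) (N ^ k) ⟩
      m * zeros N m t * N ^ k * 2 ^ ℓ                                ≤⟨ *-monoˡ-≤ (2 ^ ℓ) (zeros-bound N m t) ⟩
      (m ^ suc k * prodZeros N k (gcdContent N t) + k * m ^ k * N ^ k) * 2 ^ ℓ
        ≡⟨ cong (λ d → (m ^ suc k * prodZeros N k d + k * m ^ k * N ^ k) * 2 ^ ℓ) D≡1 ⟩
      (m ^ suc k * prodZeros N k 1 + k * m ^ k * N ^ k) * 2 ^ ℓ      ≡⟨ eq₂ m (m ^ k) (prodZeros N k 1) k (N ^ k) (2 ^ ℓ) ⟩
      m ^ k * m * (prodZeros N k 1 * 2 ^ ℓ) + m ^ k * k * 2 ^ ℓ * N ^ k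
        ≤⟨ +-monoˡ-≤ _ (*-monoʳ-≤ (m ^ k * m) prodZeros-≤) ⟩
      m ^ k * m * N ^ k + m ^ k * k * 2 ^ ℓ * N ^ k                  ≡⟨ eq₃ (m ^ k) m k (2 ^ ℓ) (N ^ k) ⟩
      m ^ k * (m + k * 2 ^ ℓ) * N ^ k                                ∎)
      where
      open ≤-Reasoning
      eq₁ : ∀ p q r → p * q * r ≡ p * r * q
      eq₁ = solve-∀
      eq₂ : ∀ m q p k n t → (m * q * p + k * q * n) * t ≡ q * m * (p * t) + q * k * t * n
      eq₂ = solve-∀
      eq₃ : ∀ q m k t n → q * m * n + q * k * t * n ≡ q * (m + k * t) * n
      eq₃ = solve-∀

-- From formal sums of terms to trees of coefficients

module Polynomials where

  open Zeros
  open import Defs using (Poly; coeff; monomial; eval; Multilinear; content; CoprimeTo)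
  open import Data.Integer as ℤ using (ℤ; +_; 0ℤ; ∣_∣)
  import Data.Integer.Properties as ℤ
  open import Data.Integer.Tactic.RingSolver using (solve-∀)
  open import Data.List as List using (List; []; _∷_; filter; length; foldr)
  import Data.List.Properties as List
  open import Data.Nat as ℕ using (ℕ; zero; suc; z≤n; s≤s)
  open import Data.Nat.Divisibility
  open import Data.Nat.GCD
  import Data.Nat.Properties as ℕ
  open import Data.Vec as Vec using (Vec; []; _∷_)
  import Data.Vec.Properties as Vec
  open import Data.Vec.Relation.Unary.All as All using (All; []; _∷_)
  import Data.Vec.Relation.Unary.All.Properties as All

  _≟ⱽ_ : ∀ {k} (d e : Vec ℕ k) → Dec (d ≡ e)
  _≟ⱽ_ = Vec.≡-dec ℕ._≟_

  single : ∀ {k} → ℤ → Vec ℕ k → Vec ℕ k → ℤ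
  single c d e = if does (d ≟ⱽ e) then c else 0ℤ

  single-≢ : ∀ {k} c {d e : Vec ℕ k} → d ≢ e → single c d e ≡ 0ℤ
  single-≢ c {d} {e} d≢e with d ≟ⱽ e
  ... | yes d≡e = contradiction d≡e d≢e
  ... | no  _   = refl

  module _ {k : ℕ} {P : Pred (Vec ℕ k) 0ℓ} (P? : Decidable P) where

    restrict : Poly k → Poly k
    restrict = filter (P? ∘ proj₂)

    coeff-restrict : ∀ f {e} → P e → coeff (restrict f) e ≡ coeff f e
    coeff-restrict []            Pe = refl
    coeff-restrict ((c , d) ∷ f) {e} Pe with P? d
    ... | yes _  = cong (λ z → single c d e ℤ.+ z) (coeff-restrict f Pe)
    ... | no ¬Pd = trans (coeff-restrict f Pe) (trans (sym (ℤ.+-identityˡ _))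
      (cong (ℤ._+ coeff f e) (sym (single-≢ c {d} {e} λ { refl → ¬Pd Pe }))))

    coeff-restrict-0 : ∀ f {e} → ¬ P e → coeff (restrict f) e ≡ 0ℤ
    coeff-restrict-0 []            ¬Pe = refl
    coeff-restrict-0 ((c , d) ∷ f) {e} ¬Pe with P? d
    ... | yes Pd = cong₂ ℤ._+_ (single-≢ c {d} {e} λ { refl → ¬Pe Pd }) (coeff-restrict-0 f ¬Pe)
    ... | no _   = coeff-restrict-0 f ¬Pe

  -- The link between values and coefficients of a list with repeated exponents: all terms with
  -- exponent e, wherever they occur, are merged into one.
  eval-remove : ∀ {k} (f : Poly k) e v →
    eval f v ≡ coeff f e ℤ.* monomial e v ℤ.+ eval (restrict (λ d → ¬? (d ≟ⱽ e)) f) v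
  eval-remove []            e v = sym (trans (ℤ.+-identityʳ _) (ℤ.*-zeroˡ (monomial e v)))
  eval-remove ((c , d) ∷ f) e v with d ≟ⱽ e
  ... | yes refl = trans (cong (λ z → c ℤ.* monomial d v ℤ.+ z) (eval-remove f e v))
    (eq c (coeff f e) (monomial e v) _)
    where
    eq : ∀ c a m r → c ℤ.* m ℤ.+ (a ℤ.* m ℤ.+ r) ≡ (c ℤ.+ a) ℤ.* m ℤ.+ r
    eq = solve-∀
  ... | no _ = trans (cong (λ z → c ℤ.* monomial d v ℤ.+ z) (eval-remove f e v))
    (eq (c ℤ.* monomial d v) (coeff f e) (monomial e v) _)
    where
    eq : ∀ c a m r → c ℤ.+ (a ℤ.* m ℤ.+ r) ≡ (0ℤ ℤ.+ a) ℤ.* m ℤ.+ (c ℤ.+ r)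
    eq = solve-∀

  -- The induction removes every term that shares the exponent of the head. The remaining list is
  -- shorter but not a sublist known to the termination check, hence the bound n on the length.
  eval-0 : ∀ {k} n (f : Poly k) → length f ℕ.≤ n → (∀ e → coeff f e ≡ 0ℤ) → ∀ v → eval f v ≡ 0ℤ
  eval-0 n       []               len    f≡0 v = refl
  eval-0 (suc n) f@((c , d) ∷ f′) (s≤s len) f≡0 v = begin
    eval f v                                              ≡⟨ eval-remove f d v ⟩
    coeff f d ℤ.* monomial d v ℤ.+ eval (restrict P? f) v ≡⟨ cong₂ (λ a b → a ℤ.* monomial d v ℤ.+ b) (f≡0 d) (eval-0 n (restrict P? f) len′ rest v) ⟩
    0ℤ ℤ.* monomial d v ℤ.+ 0ℤ                            ≡⟨ trans (ℤ.+-identityʳ _) (ℤ.*-zeroˡ (monomial d v)) ⟩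
    0ℤ                                                    ∎
    where
    open ≡-Reasoning
    P? : Decidable (_≢ d)
    P? e = ¬? (e ≟ⱽ d)
    len′ : length (restrict P? f) ℕ.≤ n
    len′ = ℕ.≤-trans (ℕ.≤-reflexive (cong length (List.filter-reject (P? ∘ proj₂) λ d≢d → d≢d refl)))
      (ℕ.≤-trans (List.length-filter (P? ∘ proj₂) f′) len)
    rest : ∀ e → coeff (restrict P? f) e ≡ 0ℤ
    rest e with e ≟ⱽ d
    ... | yes e≡d = coeff-restrict-0 P? f (λ e≢d → e≢d e≡d)
    ... | no e≢d  = trans (coeff-restrict P? f e≢d) (f≡0 e)

  Binary : ∀ {k} → Vec ℕ k → Set
  Binary = All (ℕ._≤ 1)

  binary? : ∀ {k} → Decidable (Binary {k})
  binary? = All.all? (ℕ._≤? 1)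

  toTree : ∀ {k} → (Vec ℕ k → ℤ) → Tree k
  toTree {zero}  F = F []
  toTree {suc k} F = toTree (F ∘ (0 ∷_)) , toTree (F ∘ (1 ∷_))

  toTree-cong : ∀ {k} {F G : Vec ℕ k → ℤ} → (∀ e → F e ≡ G e) → toTree F ≡ toTree G
  toTree-cong {zero}  F≡G = F≡G []
  toTree-cong {suc k} F≡G = cong₂ _,_ (toTree-cong (F≡G ∘ (0 ∷_))) (toTree-cong (F≡G ∘ (1 ∷_)))

  toTree-+[] : ∀ {k} (F G : Vec ℕ k → ℤ) x → toTree F +[ x ] toTree G ≡ toTree (λ e → F e ℤ.+ + x ℤ.* G e)
  toTree-+[] {zero}  F G x = refl
  toTree-+[] {suc k} F G x = cong₂ _,_ (toTree-+[] (F ∘ (0 ∷_)) (G ∘ (0 ∷_)) x) (toTree-+[] (F ∘ (1 ∷_)) (G ∘ (1 ∷_)) x)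

  evalᶠ : ∀ {k} → (Vec ℕ k → ℤ) → Vec ℕ k → ℤ
  evalᶠ F = evalᵗ (toTree F)

  evalᶠ-cong : ∀ {k} {F G : Vec ℕ k → ℤ} → (∀ e → F e ≡ G e) → ∀ xs → evalᶠ F xs ≡ evalᶠ G xs
  evalᶠ-cong F≡G xs = cong (λ t → evalᵗ t xs) (toTree-cong F≡G)

  evalᶠ-∷ : ∀ {k} (F : Vec ℕ (suc k) → ℤ) x xs → evalᶠ F (x ∷ xs) ≡ evalᶠ (λ e → F (0 ∷ e) ℤ.+ + x ℤ.* F (1 ∷ e)) xs
  evalᶠ-∷ F x xs = cong (λ t → evalᵗ t xs) (toTree-+[] (F ∘ (0 ∷_)) (F ∘ (1 ∷_)) x)

  evalᶠ-+ : ∀ {k} (F G : Vec ℕ k → ℤ) xs → evalᶠ (λ e → F e ℤ.+ G e) xs ≡ evalᶠ F xs ℤ.+ evalᶠ G xs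
  evalᶠ-+ F G []       = refl
  evalᶠ-+ F G (x ∷ xs) = begin
    evalᶠ (λ e → F e ℤ.+ G e) (x ∷ xs)
      ≡⟨ evalᶠ-∷ (λ e → F e ℤ.+ G e) x xs ⟩
    evalᶠ (λ e → F (0 ∷ e) ℤ.+ G (0 ∷ e) ℤ.+ + x ℤ.* (F (1 ∷ e) ℤ.+ G (1 ∷ e))) xs
      ≡⟨ evalᶠ-cong (λ e → eq (F (0 ∷ e)) (G (0 ∷ e)) (+ x) (F (1 ∷ e)) (G (1 ∷ e))) xs ⟩
    evalᶠ (λ e → (F (0 ∷ e) ℤ.+ + x ℤ.* F (1 ∷ e)) ℤ.+ (G (0 ∷ e) ℤ.+ + x ℤ.* G (1 ∷ e))) xs
      ≡⟨ evalᶠ-+ (λ e → F (0 ∷ e) ℤ.+ + x ℤ.* F (1 ∷ e)) (λ e → G (0 ∷ e) ℤ.+ + x ℤ.* G (1 ∷ e)) xs ⟩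
    evalᶠ (λ e → F (0 ∷ e) ℤ.+ + x ℤ.* F (1 ∷ e)) xs ℤ.+ evalᶠ (λ e → G (0 ∷ e) ℤ.+ + x ℤ.* G (1 ∷ e)) xs
      ≡⟨ cong₂ ℤ._+_ (evalᶠ-∷ F x xs) (evalᶠ-∷ G x xs) ⟨
    evalᶠ F (x ∷ xs) ℤ.+ evalᶠ G (x ∷ xs) ∎
    where
    open ≡-Reasoning
    eq : ∀ a b x c d → a ℤ.+ b ℤ.+ x ℤ.* (c ℤ.+ d) ≡ (a ℤ.+ x ℤ.* c) ℤ.+ (b ℤ.+ x ℤ.* d)
    eq = solve-∀

  evalᶠ-0 : ∀ {k} (xs : Vec ℕ k) → evalᶠ (λ _ → 0ℤ) xs ≡ 0ℤ
  evalᶠ-0 []       = refl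
  evalᶠ-0 (x ∷ xs) = trans (evalᶠ-∷ (λ _ → 0ℤ) x xs)
    (trans (evalᶠ-cong (λ e → trans (ℤ.+-identityˡ _) (ℤ.*-zeroʳ (+ x))) xs) (evalᶠ-0 xs))

  evalᶠ-single : ∀ {k} c {d : Vec ℕ k} → Binary d → ∀ xs → evalᶠ (single c d) xs ≡ c ℤ.* monomial d (Vec.map +_ xs)
  evalᶠ-single c [] [] = sym (ℤ.*-identityʳ c)
  evalᶠ-single c {0 ∷ d} (_ ∷ bin) (x ∷ xs) = begin
    evalᶠ (single c (0 ∷ d)) (x ∷ xs)                   ≡⟨ evalᶠ-∷ (single c (0 ∷ d)) x xs ⟩
    evalᶠ (λ e → single c d e ℤ.+ + x ℤ.* 0ℤ) xs        ≡⟨ evalᶠ-cong (λ e → trans (cong (λ z → single c d e ℤ.+ z) (ℤ.*-zeroʳ (+ x))) (ℤ.+-identityʳ _)) xs ⟩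
    evalᶠ (single c d) xs                               ≡⟨ evalᶠ-single c bin xs ⟩
    c ℤ.* monomial d (Vec.map +_ xs)                    ≡⟨ cong (c ℤ.*_) (ℤ.*-identityˡ _) ⟨
    c ℤ.* (+ 1 ℤ.* monomial d (Vec.map +_ xs))          ∎
    where open ≡-Reasoning
  evalᶠ-single c {1 ∷ d} (_ ∷ bin) (x ∷ xs) = begin
    evalᶠ (single c (1 ∷ d)) (x ∷ xs)                   ≡⟨ evalᶠ-∷ (single c (1 ∷ d)) x xs ⟩
    evalᶠ (λ e → 0ℤ ℤ.+ + x ℤ.* single c d e) xs        ≡⟨ evalᶠ-cong scale xs ⟩
    evalᶠ (single (+ x ℤ.* c) d) xs                     ≡⟨ evalᶠ-single (+ x ℤ.* c) bin xs ⟩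
    + x ℤ.* c ℤ.* monomial d (Vec.map +_ xs)            ≡⟨ eq (+ x) c (monomial d (Vec.map +_ xs)) ⟩
    c ℤ.* (+ x ℤ.* + 1 ℤ.* monomial d (Vec.map +_ xs))  ∎
    where
    open ≡-Reasoning
    scale : ∀ e → 0ℤ ℤ.+ + x ℤ.* single c d e ≡ single (+ x ℤ.* c) d e
    scale e with does (d ≟ⱽ e)
    ... | true  = ℤ.+-identityˡ _
    ... | false = trans (ℤ.+-identityˡ _) (ℤ.*-zeroʳ (+ x))
    eq : ∀ x c m → x ℤ.* c ℤ.* m ≡ c ℤ.* (x ℤ.* + 1 ℤ.* m)
    eq = solve-∀
  evalᶠ-single c {suc (suc _) ∷ d} (s≤s () ∷ bin) xs

  evalᶠ-single-0 : ∀ {k} c {d : Vec ℕ k} → ¬ Binary d → ∀ xs → evalᶠ (single c d) xs ≡ 0ℤ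
  evalᶠ-single-0 c {d} ¬bin xs = trans (cong (λ t → evalᵗ t xs) (vanishes (single c d) λ e bin → single-≢ c {d} {e} λ { refl → ¬bin bin })) (evalᶠ-0 xs)
    where
    vanishes : ∀ {k} (F : Vec ℕ k → ℤ) → (∀ e → Binary e → F e ≡ 0ℤ) → toTree F ≡ toTree (λ (_ : Vec ℕ k) → 0ℤ)
    vanishes {zero}  F F≡0 = F≡0 [] []
    vanishes {suc k} F F≡0 = cong₂ _,_ (vanishes (F ∘ (0 ∷_)) λ e bin → F≡0 (0 ∷ e) (z≤n ∷ bin))
                                       (vanishes (F ∘ (1 ∷_)) λ e bin → F≡0 (1 ∷ e) (s≤s z≤n ∷ bin))

  -- Multilinearity speaks of coefficients only: terms with non-binary exponents may still be
  -- listed, as long as they cancel. They are collected here in a remainder, which `eval-0` shows to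
  -- vanish.
  eval-split : ∀ {k} (f : Poly k) xs →
    eval f (Vec.map +_ xs) ≡ evalᶠ (coeff f) xs ℤ.+ eval (restrict (¬? ∘ binary?) f) (Vec.map +_ xs)
  eval-split []            xs = sym (trans (ℤ.+-identityʳ _) (evalᶠ-0 xs))
  eval-split ((c , d) ∷ f) xs with binary? d
  ... | yes bin = begin
    cm ℤ.+ eval f (Vec.map +_ xs)                      ≡⟨ cong₂ ℤ._+_ (sym (evalᶠ-single c bin xs)) (eval-split f xs) ⟩
    evalᶠ (single c d) xs ℤ.+ (evalᶠ (coeff f) xs ℤ.+ r) ≡⟨ ℤ.+-assoc (evalᶠ (single c d) xs) _ _ ⟨
    evalᶠ (single c d) xs ℤ.+ evalᶠ (coeff f) xs ℤ.+ r ≡⟨ cong (ℤ._+ r) (evalᶠ-+ (single c d) (coeff f) xs) ⟨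
    evalᶠ (coeff ((c , d) ∷ f)) xs ℤ.+ r               ∎
    where
    open ≡-Reasoning
    cm r : ℤ
    cm = c ℤ.* monomial d (Vec.map +_ xs)
    r  = eval (restrict (¬? ∘ binary?) f) (Vec.map +_ xs)
  ... | no ¬bin = begin
    cm ℤ.+ eval f (Vec.map +_ xs)                      ≡⟨ cong (λ z → cm ℤ.+ z) (eval-split f xs) ⟩
    cm ℤ.+ (evalᶠ (coeff f) xs ℤ.+ r)                  ≡⟨ eq cm (evalᶠ (coeff f) xs) r ⟩
    0ℤ ℤ.+ evalᶠ (coeff f) xs ℤ.+ (cm ℤ.+ r)           ≡⟨ cong (λ z → z ℤ.+ evalᶠ (coeff f) xs ℤ.+ (cm ℤ.+ r)) (evalᶠ-single-0 c ¬bin xs) ⟨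
    evalᶠ (single c d) xs ℤ.+ evalᶠ (coeff f) xs ℤ.+ (cm ℤ.+ r) ≡⟨ cong (ℤ._+ (cm ℤ.+ r)) (evalᶠ-+ (single c d) (coeff f) xs) ⟨
    evalᶠ (coeff ((c , d) ∷ f)) xs ℤ.+ (cm ℤ.+ r)      ∎
    where
    open ≡-Reasoning
    cm r : ℤ
    cm = c ℤ.* monomial d (Vec.map +_ xs)
    r  = eval (restrict (¬? ∘ binary?) f) (Vec.map +_ xs)
    eq : ∀ a b c → a ℤ.+ (b ℤ.+ c) ≡ 0ℤ ℤ.+ b ℤ.+ (a ℤ.+ c)
    eq = solve-∀

  module _ {k : ℕ} (f : Poly k) (ml : Multilinear f) where

    coeff-¬binary : ∀ {e} → ¬ Binary e → coeff f e ≡ 0ℤ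
    coeff-¬binary {e} ¬bin with coeff f e ℤ.≟ 0ℤ
    ... | yes f≡0 = f≡0
    ... | no  f≢0 = contradiction (All.lookup⁻ λ i → ml i e f≢0) ¬bin

    eval-toTree : ∀ xs → eval f (Vec.map +_ xs) ≡ evalᵗ (toTree (coeff f)) xs
    eval-toTree xs = trans (eval-split f xs) (trans
      (cong (λ z → evalᶠ (coeff f) xs ℤ.+ z) (eval-0 _ (restrict (¬? ∘ binary?) f) ℕ.≤-refl rest (Vec.map +_ xs)))
      (ℤ.+-identityʳ _))
      where
      rest : ∀ e → coeff (restrict (¬? ∘ binary?) f) e ≡ 0ℤ
      rest e with binary? e
      ... | yes bin = coeff-restrict-0 (¬? ∘ binary?) f (λ ¬bin → ¬bin bin)
      ... | no ¬bin = trans (coeff-restrict (¬? ∘ binary?) f ¬bin) (coeff-¬binary ¬bin)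

    contentᵗ∣coeff : ∀ {j} (F : Vec ℕ j → ℤ) {e} → Binary e → contentᵗ (toTree F) ∣ ∣ F e ∣
    contentᵗ∣coeff F [] = ∣-refl
    contentᵗ∣coeff F {0 ∷ e} (_ ∷ bin) = ∣-trans (gcd[m,n]∣m _ _) (contentᵗ∣coeff (F ∘ (0 ∷_)) bin)
    contentᵗ∣coeff F {1 ∷ e} (_ ∷ bin) = ∣-trans (gcd[m,n]∣n (contentᵗ (toTree (F ∘ (0 ∷_)))) _) (contentᵗ∣coeff (F ∘ (1 ∷_)) bin)
    contentᵗ∣coeff F {suc (suc _) ∷ e} (s≤s () ∷ bin)

    -- The leaves of the tree are the coefficients at binary exponents; all other coefficients are 0
    -- and divisible by anything.
    contentᵗ∣content : contentᵗ (toTree (coeff f)) ∣ content f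
    contentᵗ∣content = fold f
      where
      divides-coeff : ∀ e → contentᵗ (toTree (coeff f)) ∣ ∣ coeff f e ∣
      divides-coeff e with binary? e
      ... | yes bin = contentᵗ∣coeff (coeff f) bin
      ... | no ¬bin = subst (λ z → contentᵗ (toTree (coeff f)) ∣ ∣ z ∣) (sym (coeff-¬binary ¬bin)) (_ ∣0)
      fold : ∀ (g : Poly k) → contentᵗ (toTree (coeff f)) ∣ foldr gcd 0 (List.map (λ (_ , e) → ∣ coeff f e ∣) g)
      fold []            = _ ∣0
      fold ((_ , e) ∷ g) = gcd-greatest (divides-coeff e) (fold g)

    gcdContent≡1 : ∀ N .{{_ : ℕ.NonZero N}} → CoprimeTo f N → gcdContent N (toTree (coeff f)) ≡ 1
    gcdContent≡1 N coprime = ∣1⇒≡1 (subst (gcdContent N (toTree (coeff f)) ∣_) coprime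
      (gcd-greatest (gcd[m,n]∣m N _) (∣-trans (gcd[m,n]∣n N _) contentᵗ∣content)))

-- From Dedekind cuts to inequalities between natural numbers

module RealHypothesis where

  private module Ineq = Inequalities
  open import Defs
  open import Data.Integer as ℤ using (ℤ; +_; -[1+_])
  import Data.Integer.Properties as ℤ
  open import Data.Nat as ℕ using (ℕ; zero; suc)
  import Data.Nat.Properties as ℕ
  import Data.Nat.Tactic.RingSolver as ℕSolver
  open import Data.Rational
  open import Data.Rational.Properties
  open import Data.Rational.Solver
  open +-*-Solver using (solve; _:+_; _:*_; _:-_; con; _:=_)
  import Data.Rational.Unnormalised as ℚᵘ
  import Data.Rational.Unnormalised.Properties as ℚᵘ

  fromℕ-+ : ∀ m n → fromℕ (m ℕ.+ n) ≡ fromℕ m + fromℕ n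
  fromℕ-+ zero    n = sym (+-identityˡ (fromℕ n))
  fromℕ-+ (suc m) n = begin
    fromℕ (suc (m ℕ.+ n))          ≡⟨ fromℕ-suc (m ℕ.+ n) ⟩
    1ℚ + fromℕ (m ℕ.+ n)           ≡⟨ cong (λ q → 1ℚ + q) (fromℕ-+ m n) ⟩
    1ℚ + (fromℕ m + fromℕ n)       ≡⟨ +-assoc 1ℚ (fromℕ m) (fromℕ n) ⟨
    1ℚ + fromℕ m + fromℕ n         ≡⟨ cong (_+ fromℕ n) (fromℕ-suc m) ⟨
    fromℕ (suc m) + fromℕ n        ∎
    where open ≡-Reasoning

  fromℕ-* : ∀ m n → fromℕ (m ℕ.* n) ≡ fromℕ m * fromℕ n
  fromℕ-* zero    n = sym (*-zeroˡ (fromℕ n))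
  fromℕ-* (suc m) n = begin
    fromℕ (n ℕ.+ m ℕ.* n)               ≡⟨ fromℕ-+ n (m ℕ.* n) ⟩
    fromℕ n + fromℕ (m ℕ.* n)           ≡⟨ cong (λ q → fromℕ n + q) (fromℕ-* m n) ⟩
    fromℕ n + fromℕ m * fromℕ n         ≡⟨ cong (_+ fromℕ m * fromℕ n) (*-identityˡ (fromℕ n)) ⟨
    1ℚ * fromℕ n + fromℕ m * fromℕ n    ≡⟨ *-distribʳ-+ (fromℕ n) 1ℚ (fromℕ m) ⟨
    (1ℚ + fromℕ m) * fromℕ n            ≡⟨ cong (_* fromℕ n) (fromℕ-suc m) ⟨
    fromℕ (suc m) * fromℕ n             ∎
    where open ≡-Reasoning

  fromℕ-^ : ∀ m n → fromℕ (m ℕ.^ n) ≡ fromℕ m ^ n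
  fromℕ-^ m zero    = refl
  fromℕ-^ m (suc n) = trans (fromℕ-* m (m ℕ.^ n)) (cong (fromℕ m *_) (fromℕ-^ m n))

  fromℕ-cancel-≤ : ∀ {m n} → fromℕ m ≤ fromℕ n → m ℕ.≤ n
  fromℕ-cancel-≤ m≤n = ℕ.≮⇒≥ λ n<m → <-irrefl refl (<-≤-trans (fromℕ-mono-< n<m) m≤n)

  fromℕ-injective : ∀ {m n} → fromℕ m ≡ fromℕ n → m ≡ n
  fromℕ-injective refl = refl

  fromℕ-^-≤ : ∀ m j n k → fromℕ m ^ j ≤ fromℕ n ^ k → m ℕ.^ j ℕ.≤ n ℕ.^ k
  fromℕ-^-≤ m j n k le = fromℕ-cancel-≤ (subst₂ _≤_ (sym (fromℕ-^ m j)) (sym (fromℕ-^ n k)) le)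

  record Fraction (q : ℚ) : Set where
    field
      num          : ℕ
      ↥≡num        : ↥ q ≡ + num
      q*den≡num    : q * fromℕ (↧ₙ q) ≡ fromℕ num

  open Fraction

  fraction : ∀ {q} → 0ℚ < q → Fraction q
  fraction {mkℚ -[1+ _ ] _ _} (*<* ())
  fraction {q@(mkℚ (+ n) d _)} 0<q = record
    { num       = n
    ; ↥≡num     = refl
    ; q*den≡num = toℚᵘ-injective (ℚᵘ.≃-trans (toℚᵘ-homo-* q (fromℕ (suc d)))
        (ℚᵘ.*≡* (trans (ℤ.*-identityʳ (+ n ℤ.* + suc d)) (cong (+ n ℤ.*_) (cong +_ (sym (ℕ.*-identityʳ (suc d))))))))
    }

  lower-+ : ∀ x y {p q} → Lower x p → Lower y q → Lower (x +ᴿ y) (p + q)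
  lower-+ x y {p} {q} p∈L q∈L with lower-open x p∈L
  ... | r , p<r , r∈L = r + q , +-monoˡ-< q p<r , r , q , r∈L , q∈L , refl

  lower-· : ∀ n .{{_ : ℕ.NonZero n}} x {p} → Lower x p → Lower (n ·ᴿ x) (fromℕ n * p)
  lower-· n x {p} p∈L with lower-open x p∈L
  ... | r , p<r , r∈L = fromℕ n * r , *-monoˡ-< (fromℕ-mono-< {0} {n} (ℕ.>-nonZero⁻¹ n)) p<r , r , r∈L , refl

  -- r is not in its own lower cut. The open lower cut of y provides s > q, and r is lowered by the
  -- gain s - q.
  lower-fromℚ+ : ∀ r y {q} → Lower y q → Lower (fromℚ r +ᴿ y) (r + q)
  lower-fromℚ+ r y {q} q∈L with lower-open y q∈L
  ... | s , q<s , s∈L = subst (Lower (fromℚ r +ᴿ y)) (eq r q s)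
    (lower-+ (fromℚ r) y (r , subst (r - (s - q) <_) (+-identityʳ r) (+-monoʳ-< r (neg-antimono-< (p<q⇒0<q-p q<s))) , ≤-refl) s∈L)
    where
    eq : ∀ r q s → r - (s - q) + s ≡ r + q
    eq = solve 3 (λ r q s → r :- (s :- q) :+ s := r :+ q) refl

  lower-recip : ∀ x 0∈L {q u} → Upper x u → 0ℚ < q → q * u ≤ 1ℚ → Lower (recip x 0∈L) q
  lower-recip x 0∈L {q} {u} u∈U 0<q qu≤1 with upper-open x u∈U
  ... | v , v<u , v∈U with inverse (lower<upper x 0∈L v∈U)
  ...   | w , 0<w , vw≡1 = w , q<w , v , v∈U , ≤-reflexive (trans (*-comm w v) vw≡1)
    where
    q<w : q < w
    q<w = ≰⇒> λ w≤q → <-irrefl refl (begin-strict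
      1ℚ      ≡⟨ vw≡1 ⟨
      v * w   ≡⟨ *-comm v w ⟩
      w * v   <⟨ *-monoˡ-< 0<w v<u ⟩
      w * u   ≤⟨ *-monoʳ-≤ (<⇒≤ (lower<upper x 0∈L u∈U)) w≤q ⟩
      q * u   ≤⟨ qu≤1 ⟩
      1ℚ      ∎)
      where open ≤-Reasoning

  lower-^ᴿ : ∀ b .{{_ : ℕ.NonTrivial b}} x {p q e} → p < q → 0ℚ < q → Lower x e → q ^ ↧ₙ e ≤ b ^ℤ ↥ e → Lower (b ^ᴿ x) p
  lower-^ᴿ b x {q = q} {e} p<q 0<q e∈L q≤bᵉ = q , p<q , 0<q , e , e∈L , q≤bᵉ

  -- Membership is witnessed by some r > q in lowest terms, while n/d is an arbitrary representation
  -- of q. The two are compared after raising the claim to the denominator of r.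
  lower-log⁻ : ∀ b .{{_ : ℕ.NonTrivial b}} a .{{_ : ℕ.NonZero a}} {q} n d .{{_ : ℕ.NonZero d}} → 0ℚ < q → q * fromℕ d ≡ fromℕ n →
               Lower (log b a) q → b ℕ.^ n ℕ.≤ a ℕ.^ d
  lower-log⁻ b a {q} n d 0<q qd≡n (r , q<r , bʳ≤a) = Ineq.^-cancelˡ-≤ D (begin
    (b ℕ.^ n) ℕ.^ D          ≡⟨ ℕ.^-*-assoc b n D ⟩
    b ℕ.^ (n ℕ.* D)          ≤⟨ ℕ.^-monoʳ-≤ b {{ℕ.nonTrivial⇒nonZero b}} nD≤pd ⟩
    b ℕ.^ (p ℕ.* d)          ≡⟨ ℕ.^-*-assoc b p d ⟨
    (b ℕ.^ p) ℕ.^ d          ≤⟨ ℕ.^-monoˡ-≤ d (fromℕ-^-≤ b p a D (subst (λ z → b ^ℤ z ≤ fromℕ a ^ D) (↥≡num F) bʳ≤a)) ⟩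
    (a ℕ.^ D) ℕ.^ d          ≡⟨ Ineq.^-comm a D d ⟩
    (a ℕ.^ d) ℕ.^ D          ∎)
    where
    open ℕ.≤-Reasoning
    F : Fraction r
    F = fraction (<-trans 0<q q<r)
    p D : ℕ
    p = num F
    D = ↧ₙ r
    nD≤pd : n ℕ.* D ℕ.≤ p ℕ.* d
    nD≤pd = fromℕ-cancel-≤ (≤-trans (≤-reflexive left) (≤-trans mid (≤-reflexive right)))
      where
      left : fromℕ (n ℕ.* D) ≡ q * (fromℕ d * fromℕ D)
      left = trans (fromℕ-* n D) (trans (cong (_* fromℕ D) (sym qd≡n)) (*-assoc q (fromℕ d) (fromℕ D)))
      mid : q * (fromℕ d * fromℕ D) ≤ r * (fromℕ d * fromℕ D)
      mid = *-monoʳ-≤ (<⇒≤ (*-pos (fromℕ-mono-< {0} {d} (ℕ.>-nonZero⁻¹ d)) (fromℕ-mono-< {0} {D} ℕ.z<s))) (<⇒≤ q<r)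
      right : r * (fromℕ d * fromℕ D) ≡ fromℕ (p ℕ.* d)
      right = trans (solve 3 (λ r d D → r :* (d :* D) := r :* D :* d) refl r (fromℕ d) (fromℕ D))
        (trans (cong (_* fromℕ d) (q*den≡num F)) (sym (fromℕ-* p d)))

  floor-root : ∀ b .{{_ : ℕ.NonZero b}} X → ∃ λ P → P ℕ.^ b ℕ.≤ X × X ℕ.< suc P ℕ.^ b
  -- The search runs downwards from `suc X`, whose b-th power exceeds X because b ≥ 1.
  floor-root b@(suc b-1) X = search (suc X) (ℕ.m≤m*n (suc X) (suc X ℕ.^ b-1) {{ℕ.m^n≢0 (suc X) b-1}})
    where
    search : ∀ n → X ℕ.< n ℕ.^ b → ∃ λ P → P ℕ.^ b ℕ.≤ X × X ℕ.< suc P ℕ.^ b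
    search (suc n) X< with X ℕ.<? n ℕ.^ b
    ... | yes X<nᵇ = search n X<nᵇ
    ... | no  X≮nᵇ = n , ℕ.≮⇒≥ X≮nᵇ , X<

  -- Bernoulli's inequality for (1 + 1/32)^(n+1) with n = 32m, read off from `young` at z = 32 and w
  -- = 33.
  [33/32]^≥ : ∀ m → m ℕ.* 32 ℕ.^ suc (32 ℕ.* m) ℕ.≤ 33 ℕ.^ suc (32 ℕ.* m)
  [33/32]^≥ m = ℕ.+-cancelʳ-≤ (n ℕ.* (32 ℕ.* q)) _ _ (begin
    m ℕ.* (32 ℕ.* q) ℕ.+ n ℕ.* (32 ℕ.* q)    ≡⟨ eq m q ⟩
    n ℕ.* q ℕ.+ 32 ℕ.* (n ℕ.* q)             ≤⟨ ℕ.m≤m+n _ (33 ℕ.* q) ⟩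
    n ℕ.* q ℕ.+ 32 ℕ.* (n ℕ.* q) ℕ.+ 33 ℕ.* q ≡⟨ eq′ n q ⟩
    suc n ℕ.* (q ℕ.* 33)                     ≤⟨ Ineq.young n 32 33 ⟩
    33 ℕ.^ suc n ℕ.+ n ℕ.* (32 ℕ.* q)        ∎)
    where
    open ℕ.≤-Reasoning
    n q : ℕ
    n = 32 ℕ.* m
    q = 32 ℕ.^ n
    eq : ∀ m q → m ℕ.* (32 ℕ.* q) ℕ.+ 32 ℕ.* m ℕ.* (32 ℕ.* q) ≡ 32 ℕ.* m ℕ.* q ℕ.+ 32 ℕ.* (32 ℕ.* m ℕ.* q)
    eq = ℕSolver.solve-∀
    eq′ : ∀ n q → n ℕ.* q ℕ.+ 32 ℕ.* (n ℕ.* q) ℕ.+ 33 ℕ.* q ≡ (1 ℕ.+ n) ℕ.* (q ℕ.* 33)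
    eq′ = ℕSolver.solve-∀

  -- The next two lemmas say that (32/33) μP ≤ μ^(2+e) when P ≤ μ^(1+a/b), e = a/b - 1/K and μ ≤ (33/32)^K.
  root-bound : ∀ {μ a b P} k .{{_ : ℕ.NonZero μ}} → P ℕ.^ b ℕ.≤ μ ℕ.^ (a ℕ.+ b) → μ ℕ.* 32 ℕ.^ suc k ℕ.≤ 33 ℕ.^ suc k →
    (32 ℕ.* (μ ℕ.* P)) ℕ.^ (b ℕ.* suc k) ℕ.≤ 33 ℕ.^ (b ℕ.* suc k) ℕ.* μ ℕ.^ (b ℕ.* suc k ℕ.+ b ℕ.* k ℕ.+ a ℕ.* suc k)
  root-bound {μ} {a} {b} {P} k P^b≤ μ≤ = ℕ.*-cancelʳ-≤ _ _ (μ ℕ.^ b) {{ℕ.m^n≢0 μ b}} (begin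
    (32 ℕ.* (μ ℕ.* P)) ℕ.^ n ℕ.* μ ℕ.^ b
      ≡⟨ cong (ℕ._* μ ℕ.^ b) (trans (Ineq.^-distribʳ-* 32 (μ ℕ.* P) n) (cong (32 ℕ.^ n ℕ.*_) (Ineq.^-distribʳ-* μ P n))) ⟩
    32 ℕ.^ n ℕ.* (μ ℕ.^ n ℕ.* P ℕ.^ n) ℕ.* μ ℕ.^ b
      ≡⟨ eq₁ (32 ℕ.^ n) (μ ℕ.^ n) (P ℕ.^ n) (μ ℕ.^ b) ⟩
    μ ℕ.^ b ℕ.* 32 ℕ.^ n ℕ.* (μ ℕ.^ n ℕ.* P ℕ.^ n)
      ≤⟨ ℕ.*-mono-≤ 32≤ (ℕ.*-monoʳ-≤ (μ ℕ.^ n) P≤) ⟩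
    33 ℕ.^ n ℕ.* (μ ℕ.^ n ℕ.* μ ℕ.^ ((a ℕ.+ b) ℕ.* suc k))
      ≡⟨ cong (33 ℕ.^ n ℕ.*_) (trans (sym (ℕ.^-distribˡ-+-* μ n ((a ℕ.+ b) ℕ.* suc k)))
          (trans (cong (μ ℕ.^_) (eq₂ a b k)) (ℕ.^-distribˡ-+-* μ (b ℕ.* suc k ℕ.+ b ℕ.* k ℕ.+ a ℕ.* suc k) b))) ⟩
    33 ℕ.^ n ℕ.* (μ ℕ.^ (b ℕ.* suc k ℕ.+ b ℕ.* k ℕ.+ a ℕ.* suc k) ℕ.* μ ℕ.^ b)
      ≡⟨ ℕ.*-assoc (33 ℕ.^ n) _ _ ⟨
    33 ℕ.^ n ℕ.* μ ℕ.^ (b ℕ.* suc k ℕ.+ b ℕ.* k ℕ.+ a ℕ.* suc k) ℕ.* μ ℕ.^ b ∎)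
    where
    open ℕ.≤-Reasoning
    n : ℕ
    n = b ℕ.* suc k
    eq₁ : ∀ t m p q → t ℕ.* (m ℕ.* p) ℕ.* q ≡ q ℕ.* t ℕ.* (m ℕ.* p)
    eq₁ = ℕSolver.solve-∀
    eq₂ : ∀ a b k → b ℕ.* (1 ℕ.+ k) ℕ.+ (a ℕ.+ b) ℕ.* (1 ℕ.+ k) ≡ b ℕ.* (1 ℕ.+ k) ℕ.+ b ℕ.* k ℕ.+ a ℕ.* (1 ℕ.+ k) ℕ.+ b
    eq₂ = ℕSolver.solve-∀
    ^n : ∀ x → x ℕ.^ n ≡ (x ℕ.^ suc k) ℕ.^ b
    ^n x = trans (cong (x ℕ.^_) (ℕ.*-comm b (suc k))) (sym (ℕ.^-*-assoc x (suc k) b))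
    32≤ : μ ℕ.^ b ℕ.* 32 ℕ.^ n ℕ.≤ 33 ℕ.^ n
    32≤ = begin
      μ ℕ.^ b ℕ.* 32 ℕ.^ n                ≡⟨ cong (μ ℕ.^ b ℕ.*_) (^n 32) ⟩
      μ ℕ.^ b ℕ.* (32 ℕ.^ suc k) ℕ.^ b    ≡⟨ Ineq.^-distribʳ-* μ (32 ℕ.^ suc k) b ⟨
      (μ ℕ.* 32 ℕ.^ suc k) ℕ.^ b          ≤⟨ ℕ.^-monoˡ-≤ b μ≤ ⟩
      (33 ℕ.^ suc k) ℕ.^ b                ≡⟨ ^n 33 ⟨
      33 ℕ.^ n                            ∎
    P≤ : P ℕ.^ n ℕ.≤ μ ℕ.^ ((a ℕ.+ b) ℕ.* suc k)
    P≤ = begin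
      P ℕ.^ n                             ≡⟨ ℕ.^-*-assoc P b (suc k) ⟨
      (P ℕ.^ b) ℕ.^ suc k                 ≤⟨ ℕ.^-monoˡ-≤ (suc k) P^b≤ ⟩
      (μ ℕ.^ (a ℕ.+ b)) ℕ.^ suc k         ≡⟨ ℕ.^-*-assoc μ (a ℕ.+ b) (suc k) ⟩
      μ ℕ.^ ((a ℕ.+ b) ℕ.* suc k)         ∎

  31/32 32/33 : ℚ
  31/32 = + 31 / 32
  32/33 = + 32 / 33

  power-bound : ∀ {μ P} .{{_ : ℕ.NonTrivial μ}} n z e .{{_ : ℕ.NonZero n}} → 0ℚ < e → e * fromℕ n ≡ fromℕ z → 0ℚ < 32/33 * fromℕ (μ ℕ.* P) →
    (32 ℕ.* (μ ℕ.* P)) ℕ.^ n ℕ.≤ 33 ℕ.^ n ℕ.* μ ℕ.^ z → (32/33 * fromℕ (μ ℕ.* P)) ^ ↧ₙ e ≤ μ ^ℤ ↥ e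
  power-bound {μ} {P} n z e 0<e en≡z 0<r le = subst (λ y → r ^ D ≤ μ ^ℤ y) (sym (↥≡num F))
    (^-cancelˡ-≤ n (^-pos p 0<μ) (begin
      (r ^ D) ^ n                ≡⟨ ^-swap r D n ⟩
      (r ^ n) ^ D                ≤⟨ ^-monoˡ-≤ D (^-pos n 0<r) r^n≤ ⟩
      (fromℕ μ ^ z) ^ D          ≡⟨ ^-assocʳ (fromℕ μ) z D ⟩
      fromℕ μ ^ (z ℕ.* D)        ≡⟨ cong (fromℕ μ ^_) zD≡pn ⟩
      fromℕ μ ^ (p ℕ.* n)        ≡⟨ ^-assocʳ (fromℕ μ) p n ⟨
      (fromℕ μ ^ p) ^ n          ∎))
    where
    open ≤-Reasoning
    r : ℚ
    r = 32/33 * fromℕ (μ ℕ.* P)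
    F : Fraction e
    F = fraction 0<e
    p D : ℕ
    p = num F
    D = ↧ₙ e
    0<μ : 0ℚ < fromℕ μ
    0<μ = fromℕ-mono-< {0} {μ} (ℕ.<-trans ℕ.z<s (ℕ.nonTrivial⇒n>1 μ))
    zD≡pn : z ℕ.* D ≡ p ℕ.* n
    zD≡pn = fromℕ-injective (trans (fromℕ-* z D) (trans (cong (_* fromℕ D) (sym en≡z))
      (trans (solve 3 (λ e n D → e :* n :* D := e :* D :* n) refl e (fromℕ n) (fromℕ D))
        (trans (cong (_* fromℕ n) (q*den≡num F)) (sym (fromℕ-* p n))))))
    0<33ⁿ : 0ℚ < fromℕ 33 ^ n
    0<33ⁿ = ^-pos n (positive⁻¹ (fromℕ 33))
    r*33 : r * fromℕ 33 ≡ fromℕ (32 ℕ.* (μ ℕ.* P))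
    r*33 = trans (solve 1 (λ x → con 32/33 :* x :* con (fromℕ 33) := con (fromℕ 32) :* x) refl (fromℕ (μ ℕ.* P)))
      (sym (fromℕ-* 32 (μ ℕ.* P)))
    r^n≤ : r ^ n ≤ fromℕ μ ^ z
    r^n≤ = *-cancelʳ-≤-pos (fromℕ 33 ^ n) {{positive 0<33ⁿ}} (begin
      r ^ n * fromℕ 33 ^ n                         ≡⟨ ^-distrib-* r (fromℕ 33) n ⟨
      (r * fromℕ 33) ^ n                           ≡⟨ cong (_^ n) r*33 ⟩
      fromℕ (32 ℕ.* (μ ℕ.* P)) ^ n                 ≡⟨ fromℕ-^ (32 ℕ.* (μ ℕ.* P)) n ⟨
      fromℕ ((32 ℕ.* (μ ℕ.* P)) ℕ.^ n)             ≤⟨ fromℕ-mono-≤ le ⟩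
      fromℕ (33 ℕ.^ n ℕ.* μ ℕ.^ z)                 ≡⟨ trans (fromℕ-* (33 ℕ.^ n) (μ ℕ.^ z)) (cong₂ _*_ (fromℕ-^ 33 n) (fromℕ-^ μ z)) ⟩
      fromℕ 33 ^ n * fromℕ μ ^ z                   ≡⟨ *-comm (fromℕ 33 ^ n) (fromℕ μ ^ z) ⟩
      fromℕ μ ^ z * fromℕ 33 ^ n                   ∎)

  -- a/b is slightly larger than ε, and P is the integer part of μ^(1+a/b).
  record Approximant (μ ℓ N : ℕ) : Set where
    field
      a b P     : ℕ
      a≢0       : ℕ.NonZero a
      b≢0       : ℕ.NonZero b
      2^b≤μ^a   : 2 ℕ.^ b ℕ.≤ μ ℕ.^ a
      μ^[a+b]<  : μ ℕ.^ (a ℕ.+ b) ℕ.< suc P ℕ.^ b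
      large-N   : 2 ℕ.^ (31 ℕ.* (a ℕ.* P) ℕ.* μ ℕ.+ 8 ℕ.* (a ℕ.+ b) ℕ.* ℓ) ℕ.≤ N ℕ.^ (8 ℕ.* a)

  module _ (μ ℓ : ℕ) .{{_ : ℕ.NonTrivial μ}} .{{_ : ℕ.NonZero ℓ}} (ε : ℝ) (log≤ε : log μ 2 ≤ᴿ ε) where

    private
      instance
        μ≢0 : ℕ.NonZero μ
        μ≢0 = ℕ.nonTrivial⇒nonZero μ

      -- The precision δ = 1/(32μ+1) is fine enough for μ^δ ≤ 33/32, by `[33/32]^≥`.
      k : ℕ
      k = 32 ℕ.* μ

      δ : ℚ
      δ = 1/1+ k

      δ*K≡1 : δ * fromℕ (suc k) ≡ 1ℚ
      δ*K≡1 = q*den≡num (fraction (0<1/1+ k))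

    module _ {e : ℚ} (e∈L : Lower ε e) (u∈U : Upper ε (e + δ)) where

      private
        u : ℚ
        u = e + δ

        0<u : 0ℚ < u
        0<u = lower<upper ε (log≤ε (log2-positive μ)) u∈U

        F : Fraction u
        F = fraction 0<u

        a b : ℕ
        a = num F
        b = ↧ₙ u

        0<b : 0ℚ < fromℕ b
        0<b = fromℕ-mono-< {0} {b} ℕ.z<s

        instance
          a≢0 : ℕ.NonZero a
          a≢0 = ℕ.>-nonZero (ℕ.≰⇒> λ a≤0 → <-irrefl refl (<-≤-trans (*-pos 0<u 0<b)
            (≤-trans (≤-reflexive (q*den≡num F)) (fromℕ-mono-≤ a≤0))))

        -- Otherwise u = a/b ≤ log_μ 2. Since cuts are strict, the contradiction arises at some v <
        -- u that is still in the upper cut of ε: it is also below log_μ 2, hence below ε.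
        2^b≤μ^a : 2 ℕ.^ b ℕ.≤ μ ℕ.^ a
        2^b≤μ^a = ℕ.≮⇒≥ λ μ^a<2^b →
          let v , v<u , v∈U = upper-open ε u∈U
              u≤log         = subst (λ z → μ ^ℤ z ≤ fromℕ 2 ^ b) (sym (↥≡num F))
                                (subst₂ _≤_ (fromℕ-^ μ a) (fromℕ-^ 2 b) (fromℕ-mono-≤ (ℕ.<⇒≤ μ^a<2^b)))
          in disjoint ε (log≤ε (u , v<u , u≤log) , v∈U)

        root : ∃ λ P → P ℕ.^ b ℕ.≤ μ ℕ.^ (a ℕ.+ b) × μ ℕ.^ (a ℕ.+ b) ℕ.< suc P ℕ.^ b
        root = floor-root b (μ ℕ.^ (a ℕ.+ b))

        P : ℕ
        P = proj₁ root

        0<μP : 0 ℕ.< μ ℕ.* P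
        0<μP = ℕ.*-mono-< {0} {μ} {0} {P} (ℕ.>-nonZero⁻¹ μ) (ℕ.≰⇒> λ P≤0 → ℕ.<⇒≱ (proj₂ (proj₂ root)) (begin
          suc P ℕ.^ b         ≤⟨ ℕ.^-monoˡ-≤ b (ℕ.s≤s P≤0) ⟩
          1 ℕ.^ b             ≡⟨ ℕ.^-zeroˡ b ⟩
          1                   ≤⟨ ℕ.m^n>0 μ (a ℕ.+ b) ⟩
          μ ℕ.^ (a ℕ.+ b)     ∎))
          where open ℕ.≤-Reasoning

        -- Positivity is inherited from u, the upper approximation of ε, which is at most 2 + e
        -- because δ ≤ 1.
        0<e′ : 0ℚ < fromℕ 2 + e
        0<e′ = <-≤-trans 0<u (subst (u ≤_) (+-comm e (fromℕ 2))
          (+-monoʳ-≤ e (≤-trans (p≤∣↥p∣ δ) (fromℕ-mono-≤ {1} {2} (ℕ.s≤s ℕ.z≤n)))))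

        -- The numerator of 2 + e = 2 + a/b - 1/K over the denominator bK, where K = `suc k`; the
        -- summand `b * k` is bK - b written without subtraction.
        z : ℕ
        z = b ℕ.* suc k ℕ.+ b ℕ.* k ℕ.+ a ℕ.* suc k

        e′≡z : (fromℕ 2 + e) * fromℕ (b ℕ.* suc k) ≡ fromℕ z
        e′≡z = +-cancelʳ (fromℕ b) _ _ (begin
          (fromℕ 2 + e) * fromℕ (b ℕ.* suc k) + B         ≡⟨ cong (λ q → (fromℕ 2 + e) * q + B) (fromℕ-* b (suc k)) ⟩
          (fromℕ 2 + e) * (B * K) + B                     ≡⟨ cong (λ q → (fromℕ 2 + e) * (B * K) + q) (trans (cong (B *_) δ*K≡1) (*-identityʳ B)) ⟨
          (fromℕ 2 + e) * (B * K) + B * (δ * K)           ≡⟨ solve 4 (λ e δ B K → (con (fromℕ 2) :+ e) :* (B :* K) :+ B :* (δ :* K)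
                                                                := con (fromℕ 2) :* (B :* K) :+ (e :+ δ) :* B :* K) refl e δ B K ⟩
          fromℕ 2 * (B * K) + u * B * K                   ≡⟨ cong (λ q → fromℕ 2 * (B * K) + q * K) (q*den≡num F) ⟩
          fromℕ 2 * (B * K) + fromℕ a * K                 ≡⟨ cong₂ (λ p q → fromℕ 2 * p + q) (fromℕ-* b (suc k)) (fromℕ-* a (suc k)) ⟨
          fromℕ 2 * fromℕ (b ℕ.* suc k) + fromℕ (a ℕ.* suc k) ≡⟨ cong (_+ fromℕ (a ℕ.* suc k)) (fromℕ-* 2 (b ℕ.* suc k)) ⟨
          fromℕ (2 ℕ.* (b ℕ.* suc k)) + fromℕ (a ℕ.* suc k) ≡⟨ fromℕ-+ (2 ℕ.* (b ℕ.* suc k)) (a ℕ.* suc k) ⟨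
          fromℕ (2 ℕ.* (b ℕ.* suc k) ℕ.+ a ℕ.* suc k)     ≡⟨ cong fromℕ (eq a b k) ⟩
          fromℕ (z ℕ.+ b)                                 ≡⟨ fromℕ-+ z b ⟩
          fromℕ z + B                                     ∎)
          where
          open ≡-Reasoning
          open import Algebra.Properties.Group +-0-group using () renaming (∙-cancelʳ to +-cancelʳ)
          B K : ℚ
          B = fromℕ b
          K = fromℕ (suc k)
          eq : ∀ a b k → 2 ℕ.* (b ℕ.* (1 ℕ.+ k)) ℕ.+ a ℕ.* (1 ℕ.+ k) ≡ b ℕ.* (1 ℕ.+ k) ℕ.+ b ℕ.* k ℕ.+ a ℕ.* (1 ℕ.+ k) ℕ.+ b
          eq = ℕSolver.solve-∀

        -- The factor turns 4x into (31/8)μP. It lies strictly below 32/33, as membership in the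
        -- lower cut of a power requires.
        x : ℚ
        x = 31/32 * fromℕ (μ ℕ.* P)

        x∈L : Lower (μ ^ᴿ (fromℚ (fromℕ 2) +ᴿ ε)) x
        x∈L = lower-^ᴿ μ (fromℚ (fromℕ 2) +ᴿ ε) {q = 32/33 * fromℕ (μ ℕ.* P)} {fromℕ 2 + e}
          (*-monoʳ-< (fromℕ-mono-< 0<μP) (from-yes (31/32 <? 32/33)))
          0<r
          (lower-fromℚ+ (fromℕ 2) ε e∈L)
          (power-bound {P = P} (b ℕ.* suc k) z (fromℕ 2 + e) {{ℕ.m*n≢0 b (suc k)}} 0<e′ e′≡z 0<r
            (root-bound {a = a} {b} {P} k (proj₁ (proj₂ root)) ([33/32]^≥ μ)))
          where
          0<r : 0ℚ < 32/33 * fromℕ (μ ℕ.* P)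
          0<r = *-pos (positive⁻¹ 32/33) (fromℕ-mono-< 0<μP)

        w : ℚ
        w = proj₁ (inverse 0<u)

        uw≡1 : u * w ≡ 1ℚ
        uw≡1 = proj₂ (proj₂ (inverse 0<u))

        -- As w = 1/u = b/a, this is (31/8)μP + ℓ(1 + b/a); the factor 8a clears its denominators.
        T : ℚ
        T = fromℕ 4 * x + fromℕ ℓ * (1ℚ + w)

        T∈L : Lower (4 ·ᴿ (μ ^ᴿ (fromℚ (fromℕ 2) +ᴿ ε)) +ᴿ ℓ ·ᴿ (fromℚ 1ℚ +ᴿ recip ε (log≤ε (log2-positive μ)))) T
        T∈L = lower-+ (4 ·ᴿ X) (ℓ ·ᴿ Y) (lower-· 4 X x∈L) (lower-· ℓ Y (lower-fromℚ+ 1ℚ (recip ε (log≤ε (log2-positive μ)))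
          (lower-recip ε (log≤ε (log2-positive μ)) u∈U (proj₁ (proj₂ (inverse 0<u))) (≤-reflexive (trans (*-comm w u) uw≡1)))))
          where
          X Y : ℝ
          X = μ ^ᴿ (fromℚ (fromℕ 2) +ᴿ ε)
          Y = fromℚ 1ℚ +ᴿ recip ε (log≤ε (log2-positive μ))

        0<T : 0ℚ < T
        0<T = +-mono-< (*-pos (positive⁻¹ (fromℕ 4)) (*-pos (positive⁻¹ 31/32) (fromℕ-mono-< 0<μP)))
          (*-pos (fromℕ-mono-< {0} {ℓ} (ℕ.>-nonZero⁻¹ ℓ)) (+-mono-< (positive⁻¹ 1ℚ) (proj₁ (proj₂ (inverse 0<u)))))

        n : ℕ
        n = 31 ℕ.* (a ℕ.* P) ℕ.* μ ℕ.+ 8 ℕ.* (a ℕ.+ b) ℕ.* ℓ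

        T*8a≡n : T * fromℕ (8 ℕ.* a) ≡ fromℕ n
        T*8a≡n = begin
          T * fromℕ (8 ℕ.* a)       ≡⟨ cong₂ (λ p q → (fromℕ 4 * (31/32 * p) + L * (1ℚ + w)) * q) (fromℕ-* μ P) (fromℕ-* 8 a) ⟩
          (fromℕ 4 * (31/32 * (M * Q)) + L * (1ℚ + w)) * (fromℕ 8 * A)
            ≡⟨ solve 5 (λ M Q L w A → (con (fromℕ 4) :* (con 31/32 :* (M :* Q)) :+ L :* (con 1ℚ :+ w)) :* (con (fromℕ 8) :* A)
                 := con (fromℕ 31) :* (A :* Q) :* M :+ con (fromℕ 8) :* (A :+ A :* w) :* L) refl M Q L w A ⟩
          fromℕ 31 * (A * Q) * M + fromℕ 8 * (A + A * w) * L
            ≡⟨ cong (λ q → fromℕ 31 * (A * Q) * M + fromℕ 8 * (A + q) * L) Aw≡B ⟩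
          fromℕ 31 * (A * Q) * M + fromℕ 8 * (A + B) * L
            ≡⟨ cong₂ _+_
                 (trans (fromℕ-* (31 ℕ.* (a ℕ.* P)) μ) (cong (_* M) (trans (fromℕ-* 31 (a ℕ.* P)) (cong (fromℕ 31 *_) (fromℕ-* a P)))))
                 (trans (fromℕ-* (8 ℕ.* (a ℕ.+ b)) ℓ) (cong (_* L) (trans (fromℕ-* 8 (a ℕ.+ b)) (cong (fromℕ 8 *_) (fromℕ-+ a b))))) ⟨
          fromℕ (31 ℕ.* (a ℕ.* P) ℕ.* μ) + fromℕ (8 ℕ.* (a ℕ.+ b) ℕ.* ℓ)
            ≡⟨ fromℕ-+ (31 ℕ.* (a ℕ.* P) ℕ.* μ) (8 ℕ.* (a ℕ.+ b) ℕ.* ℓ) ⟨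
          fromℕ n                   ∎
          where
          open ≡-Reasoning
          A B M Q L : ℚ
          A = fromℕ a
          B = fromℕ b
          M = fromℕ μ
          Q = fromℕ P
          L = fromℕ ℓ
          Aw≡B : A * w ≡ B
          Aw≡B = begin
            A * w          ≡⟨ cong (_* w) (q*den≡num F) ⟨
            u * B * w      ≡⟨ solve 3 (λ u B w → u :* B :* w := u :* w :* B) refl u B w ⟩
            u * w * B      ≡⟨ cong (_* B) uw≡1 ⟩
            1ℚ * B         ≡⟨ *-identityˡ B ⟩
            B              ∎

      approximant : (N : ℕ) .{{_ : ℕ.NonZero N}} →
        4 ·ᴿ (μ ^ᴿ (fromℚ (fromℕ 2) +ᴿ ε)) +ᴿ ℓ ·ᴿ (fromℚ 1ℚ +ᴿ recip ε (log≤ε (log2-positive μ))) ≤ᴿ log 2 N →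
        Approximant μ ℓ N
      approximant N ≤log = record
        { a≢0      = a≢0
        ; b≢0      = _
        ; 2^b≤μ^a  = 2^b≤μ^a
        ; μ^[a+b]< = proj₂ (proj₂ root)
        ; large-N  = lower-log⁻ 2 N n (8 ℕ.* a) {{ℕ.m*n≢0 8 a}} 0<T T*8a≡n (≤log T∈L)
        }

-- Probabilities as normalised counts, and the conclusion

open Sums
open Zeros
open ZeroBound
open Polynomials
open RealHypothesis
open import Defs
open import Data.Integer using (+_)
open import Data.Integer.Divisibility.Signed using (_∣?_)
open import Data.Nat using (ℕ; NonZero; NonTrivial)
open import Data.Rational using (1ℚ; ½; _/_; _+_; _≤_)
open import Data.Vec using (map)

import Data.Integer as ℤ
import Data.Integer.Divisibility.Signed as ℤ
import Data.Integer.Properties as ℤ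
open import Data.List as List using (List; []; _∷_; length; filter; applyUpTo; cartesianProductWith)
import Data.List.Properties as List
import Data.Nat as ℕ
open import Data.Nat using (zero; suc)
import Data.Nat.Divisibility as ℕ
import Data.Nat.Properties as ℕ
open import Data.Rational using (ℚ; 0ℚ; _*_; _<_; positive)
open import Data.Rational.Properties
open import Data.Rational.Solver
open +-*-Solver using (solve; _:+_; _:*_; _:=_)
import Data.Rational.Unnormalised as ℚᵘ
import Data.Rational.Unnormalised.Properties as ℚᵘ
open import Data.Vec using (Vec; []; _∷_)

length-filter-map : ∀ {A B : Set} {P : Pred B 0ℓ} (P? : Decidable P) (f : A → B) xs →
                    length (filter P? (List.map f xs)) ≡ length (filter (λ x → P? (f x)) xs)
length-filter-map P? f []       = refl
length-filter-map P? f (x ∷ xs) with P? (f x)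
... | yes _ = cong suc (length-filter-map P? f xs)
... | no  _ = length-filter-map P? f xs

-- The general g is forced by the induction: `upTo n` is `applyUpTo id n`, and its tail is
-- `applyUpTo` of a shifted function.
length-filter-product : ∀ {k} {P : Pred (Vec ℕ (suc k)) 0ℓ} (P? : Decidable P) n (g : ℕ → ℕ) ys →
  length (filter P? (cartesianProductWith _∷_ (applyUpTo g n) ys)) ≡ Σ< n (λ i → length (filter (λ y → P? (g i ∷ y)) ys))
length-filter-product P? zero    g ys = refl
length-filter-product P? (suc n) g ys = begin
  length (filter P? (List.map (g 0 ∷_) ys List.++ rest))
    ≡⟨ cong length (List.filter-++ P? (List.map (g 0 ∷_) ys) rest) ⟩
  length (filter P? (List.map (g 0 ∷_) ys) List.++ filter P? rest)
    ≡⟨ List.length-++ (filter P? (List.map (g 0 ∷_) ys)) ⟩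
  length (filter P? (List.map (g 0 ∷_) ys)) ℕ.+ length (filter P? rest)
    ≡⟨ cong₂ ℕ._+_ (length-filter-map P? (g 0 ∷_) ys) (length-filter-product P? n (g ∘ suc) ys) ⟩
  length (filter (λ y → P? (g 0 ∷ y)) ys) ℕ.+ Σ< n (λ i → length (filter (λ y → P? (g (suc i) ∷ y)) ys)) ∎
  where
  open ≡-Reasoning
  rest : List _
  rest = cartesianProductWith _∷_ (applyUpTo (g ∘ suc) n) ys

length-filter-cube : ∀ m k {P : Pred (Vec ℕ k) 0ℓ} (P? : Decidable P) → length (filter P? (cube m k)) ≡ cubeΣ m k (λ x → 𝟙 (P? x))
length-filter-cube m zero    P? with P? []
... | yes _ = refl
... | no  _ = refl
length-filter-cube m (suc k) P? = trans (length-filter-product P? m id (cube m k))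
  (Σ-cong m λ i → length-filter-cube m k (λ y → P? (i ∷ y)))

/-*-cancel : ∀ p n .{{_ : NonZero n}} → (+ p / n) * fromℕ n ≡ fromℕ p
/-*-cancel p n@(suc n-1) = toℚᵘ-injective
  (ℚᵘ.≃-trans (toℚᵘ-homo-* (+ p / n) (fromℕ n))
  (ℚᵘ.≃-trans (ℚᵘ.*-cong (toℚᵘ-fromℚᵘ (ℚᵘ.mkℚᵘ (+ p) n-1)) (ℚᵘ.≃-refl {ℚᵘ.mkℚᵘ (+ n) 0}))
   (ℚᵘ.*≡* (trans (ℤ.*-identityʳ (+ p ℤ.* + n)) (cong (+ p ℤ.*_) (cong +_ (sym (ℕ.*-identityʳ n))))))))

½^-inverse : ∀ ℓ → ½ ^ ℓ * fromℕ (2 ℕ.^ ℓ) ≡ 1ℚ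
½^-inverse ℓ = trans (cong (½ ^ ℓ *_) (fromℕ-^ 2 ℓ)) (trans (sym (^-distrib-* ½ (fromℕ 2) ℓ)) (1^ ℓ))
  where
  1^ : ∀ n → 1ℚ ^ n ≡ 1ℚ
  1^ zero    = refl
  1^ (suc n) = trans (*-identityˡ _) (1^ n)

-- The hypothesis is the claim multiplied by C·m·2^ℓ.
fraction-≤ : ∀ {Z C m μ ℓ} .{{_ : NonZero C}} .{{_ : NonZero m}} →
  m ℕ.* Z ℕ.* 2 ℕ.^ ℓ ℕ.≤ C ℕ.* (m ℕ.+ μ ℕ.* 2 ℕ.^ ℓ) → + Z / C ≤ ½ ^ ℓ + (+ μ) / m
fraction-≤ {Z} {C} {m} {μ} {ℓ} le = *-cancelʳ-≤-pos (c * (d * e)) {{positive (*-pos 0<c (*-pos 0<d 0<e))}} (begin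
  + Z / C * (c * (d * e))                ≡⟨ *-assoc (+ Z / C) c (d * e) ⟨
  + Z / C * c * (d * e)                  ≡⟨ cong (_* (d * e)) (/-*-cancel Z C) ⟩
  fromℕ Z * (d * e)                      ≡⟨ solve 3 (λ z d e → z :* (d :* e) := d :* z :* e) refl (fromℕ Z) d e ⟩
  d * fromℕ Z * e                        ≡⟨ trans (fromℕ-* (m ℕ.* Z) (2 ℕ.^ ℓ)) (cong (_* e) (fromℕ-* m Z)) ⟨
  fromℕ (m ℕ.* Z ℕ.* 2 ℕ.^ ℓ)            ≤⟨ fromℕ-mono-≤ le ⟩
  fromℕ (C ℕ.* (m ℕ.+ μ ℕ.* 2 ℕ.^ ℓ))    ≡⟨ trans (fromℕ-* C _) (cong (c *_) (trans (fromℕ-+ m (μ ℕ.* 2 ℕ.^ ℓ)) (cong (λ q → d + q) (fromℕ-* μ (2 ℕ.^ ℓ))))) ⟩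
  c * (d + fromℕ μ * e)                  ≡⟨ cong₂ (λ p q → c * (p + q * e)) (*-identityˡ d) (/-*-cancel μ m) ⟨
  c * (1ℚ * d + + μ / m * d * e)         ≡⟨ cong (λ q → c * (q * d + + μ / m * d * e)) (½^-inverse ℓ) ⟨
  c * (½ ^ ℓ * e * d + + μ / m * d * e)  ≡⟨ solve 5 (λ h r c d e → c :* (h :* e :* d :+ r :* d :* e) := (h :+ r) :* (c :* (d :* e))) refl (½ ^ ℓ) (+ μ / m) c d e ⟩
  (½ ^ ℓ + + μ / m) * (c * (d * e))      ∎)
  where
  open ≤-Reasoning
  c d e : ℚ
  c = fromℕ C
  d = fromℕ m
  e = fromℕ (2 ℕ.^ ℓ)
  0<c : 0ℚ < c
  0<c = fromℕ-mono-< (ℕ.>-nonZero⁻¹ C)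
  0<d : 0ℚ < d
  0<d = fromℕ-mono-< (ℕ.>-nonZero⁻¹ m)
  0<e : 0ℚ < e
  0<e = fromℕ-mono-< (ℕ.m^n>0 2 ℓ)

Pr-≤ : ∀ {μ ℓ N} m .{{_ : NonZero N}} .{{_ : NonZero m}} (f : Poly μ) → Multilinear f →
  m ℕ.* zeros N m (toTree (coeff f)) ℕ.* 2 ℕ.^ ℓ ℕ.≤ m ℕ.^ μ ℕ.* (m ℕ.+ μ ℕ.* 2 ℕ.^ ℓ) →
  Pr m μ (λ x → + N ∣? eval f (map +_ x)) ≤ ½ ^ ℓ + (+ μ) / m
Pr-≤ {μ} {ℓ} {N} m f ml zeros≤ = fraction-≤ {C = length (cube m μ)} {μ = μ} {ℓ = ℓ} {{cube-nonEmpty m μ}} (begin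
  m ℕ.* length (filter P? (cube m μ)) ℕ.* 2 ℕ.^ ℓ    ≡⟨ cong (λ n → m ℕ.* n ℕ.* 2 ℕ.^ ℓ) (length-filter-cube m μ P?) ⟩
  m ℕ.* cubeΣ m μ (λ x → 𝟙 (P? x)) ℕ.* 2 ℕ.^ ℓ       ≤⟨ ℕ.*-monoˡ-≤ (2 ℕ.^ ℓ) (ℕ.*-monoʳ-≤ m (cubeΣ-mono m μ zero⇒zeroᵗ)) ⟩
  m ℕ.* zeros N m (toTree (coeff f)) ℕ.* 2 ℕ.^ ℓ     ≤⟨ zeros≤ ⟩
  m ℕ.^ μ ℕ.* (m ℕ.+ μ ℕ.* 2 ℕ.^ ℓ)                  ≡⟨ cong (ℕ._* (m ℕ.+ μ ℕ.* 2 ℕ.^ ℓ)) (length-cube m μ) ⟨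
  length (cube m μ) ℕ.* (m ℕ.+ μ ℕ.* 2 ℕ.^ ℓ)        ∎)
  where
  open ℕ.≤-Reasoning
  P? : Decidable (λ x → + N ℤ.∣ eval f (map +_ x))
  P? x = + N ∣? eval f (map +_ x)
  zero⇒zeroᵗ : ∀ x → 𝟙 (P? x) ℕ.≤ 𝟙 (N ℕ.∣? ℤ.∣ evalᵗ (toTree (coeff f)) x ∣)
  zero⇒zeroᵗ x = 𝟙-mono (P? x) (N ℕ.∣? ℤ.∣ evalᵗ (toTree (coeff f)) x ∣)
    (λ N∣f → subst (λ z → N ℕ.∣ ℤ.∣ z ∣) (eval-toTree f ml x) (ℤ.∣⇒∣ᵤ N∣f))

approximant⇒zeros-≤ : ∀ {μ ℓ N} .{{_ : NonTrivial μ}} .{{_ : NonZero N}} → Approximant μ ℓ N → ∀ m (t : Tree μ) → gcdContent N t ≡ 1 →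
  m ℕ.* zeros N m t ℕ.* 2 ℕ.^ ℓ ℕ.≤ m ℕ.^ μ ℕ.* (m ℕ.+ μ ℕ.* 2 ℕ.^ ℓ)
approximant⇒zeros-≤ {μ} app = zeros-≤ {{a≢0}} {{b≢0}} (ℕ.nonTrivial⇒n>1 μ) 2^b≤μ^a μ^[a+b]< large-N
  where open Approximant app

theorem2 : (μ ℓ : ℕ) .{{_ : NonTrivial μ}} .{{_ : NonZero ℓ}}
    (ε : ℝ) (log≤ε : log μ 2 ≤ᴿ ε)
    (N : ℕ) .{{_ : NonZero N}} →
    4 ·ᴿ (μ ^ᴿ (fromℚ (fromℕ 2) +ᴿ ε)) +ᴿ ℓ ·ᴿ (fromℚ 1ℚ +ᴿ recip ε (log≤ε (log2-positive μ))) ≤ᴿ log 2 N →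
    (m : ℕ) .{{_ : NonZero m}} (f : Poly μ) → Multilinear f → CoprimeTo f N →
    Pr m μ (λ x → + N ∣? eval f (map +_ x)) ≤ ½ ^ ℓ + (+ μ) / m
theorem2 μ ℓ ε log≤ε N large m f ml coprime =
  let e , e∈L , u∈U = approximate ε (0<1/1+ (32 ℕ.* μ)) in
  Pr-≤ {ℓ = ℓ} m f ml (approximant⇒zeros-≤ (approximant μ ℓ ε log≤ε e∈L u∈U N large) m (toTree (coeff f)) (gcdContent≡1 f ml N coprime))
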